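{- Let $k\geq 2$, $\Gamma=J(2k,k)$ and $G\leqslant\mathrm{Aut}(\Gamma)=S_{2k}\times\langle\tau\rangle$ such that both $G$ and $G\cap S_{2k}$ are arc-transitive on $\Gamma$. If $(\Gamma,\mathcal{P})$ is a $G$-primitive decomposition, then $(\Gamma,\mathcal{P})$ is also a $(G\cap S_{2k})$-primitive decomposition.
   Context: $J(2k,k)$ has vertices the $k$-subsets of $X=\{1,\dots,2k\}$, adjacent when they share $k-1$ points; $S_{2k}$ acts naturally and $\tau$ maps each $k$-subset to its complement. A decomposition is a partition of the edge set into at least two parts (divisors); for a group $L$ of automorphisms it is $L$-transitive if $L$ preserves it and is transitive on parts, and $L$-primitive if moreover $L$ acts primitively on the parts. -}

module Defs where

open import Data.Nat using (ℕ; _+_; _∸_)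
open import Data.Bool using (Bool; true; false; if_then_else_; _xor_)
open import Data.Fin using (Fin)
open import Data.Fin.Subset using (Subset; ∁; _∩_; ∣_∣)
open import Data.Fin.Permutation using (Permutation′; _⟨$⟩ˡ_; id; flip; _∘ₚ_)
open import Data.Vec using (tabulate; lookup)
open import Data.Product using (Σ; _×_; _,_; ∃-syntax)
open import Data.Sum using (_⊎_)
open import Relation.Nullary using (¬_)
open import Relation.Binary.PropositionalEquality using (_≡_)
open import Function.Bundles using (_⇔_)
open import Level using (Level; suc; zero)

-- The ground set X = {1,…,2k} is Fin (k + k); a vertex of J(2k,k) is a
-- subset (Vec Bool) of size k.
X : ℕ → ℕ
X k = k + k

-- Elements of Aut(Γ) = S_{2k} × ⟨τ⟩ : a permutation σ and a bit b
-- (b = true means "followed by complementation τ").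
Aut : ℕ → Set
Aut k = Permutation′ (X k) × Bool

permute : ∀ {n} → Permutation′ n → Subset n → Subset n
permute σ s = tabulate (λ j → lookup s (σ ⟨$⟩ˡ j))

act : ∀ k → Aut k → Subset (X k) → Subset (X k)
act k (σ , b) s = if b then ∁ (permute σ s) else permute σ s

-- group structure of S_{2k} × ⟨τ⟩ (τ is central, order 2)
one : ∀ {k} → Aut k
one = id , false

_·_ : ∀ {k} → Aut k → Aut k → Aut k
(σ , b) · (π , c) = (π ∘ₚ σ) , (b xor c)

inv : ∀ {k} → Aut k → Aut k
inv (σ , b) = flip σ , b

record IsSubgroup (k : ℕ) (G : Aut k → Set) : Set where
  field
    one∈ : G (one {k})
    ·∈   : ∀ {g h} → G g → G h → G (_·_ {k} g h)
    inv∈ : ∀ {g} → G g → G (inv {k} g)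

InSym : ∀ k → (Aut k → Set) → Aut k → Set
InSym k G (σ , b) = G (σ , b) × (b ≡ false)

IsVertex : (k : ℕ) → Subset (X k) → Set
IsVertex k s = ∣ s ∣ ≡ k

Adj : (k : ℕ) → Subset (X k) → Subset (X k) → Set
Adj k u v = IsVertex k u × IsVertex k v × ∣ u ∩ v ∣ ≡ k ∸ 1

ArcTransitive : (k : ℕ) → (Aut k → Set) → Set
ArcTransitive k L = ∀ u v u' v' → Adj k u v → Adj k u' v' →
  ∃[ g ] (L g × act k g u ≡ u' × act k g v ≡ v')

-- An edge {u,v} is represented by either ordered pair (u , v).
Pair : ℕ → Set
Pair k = Subset (X k) × Subset (X k)

IsEdge : (k : ℕ) → Pair k → Set
IsEdge k (u , v) = Adj k u v

actP : ∀ k → Aut k → Pair k → Pair k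
actP k g (u , v) = act k g u , act k g v

-- A partition of the edge set, encoded as its "same part" relation on
-- edges (an equivalence relation on edges, not distinguishing (u,v)
-- from (v,u)).
record IsEdgePartition (k : ℕ) (R : Pair k → Pair k → Set) : Set where
  field
    onEdges : ∀ e e' → R e e' → IsEdge k e × IsEdge k e'
    refl    : ∀ e → IsEdge k e → R e e
    sym     : ∀ e e' → R e e' → R e' e
    trans   : ∀ e e' e'' → R e e' → R e' e'' → R e e''
    unord   : ∀ u v → IsEdge k (u , v) → R (u , v) (v , u)

record IsDecomposition (k : ℕ) (R : Pair k → Pair k → Set) : Set where
  field
    partition : IsEdgePartition k R
    twoParts  : ∃[ e ] ∃[ e' ] (IsEdge k e × IsEdge k e' × ¬ R e e')

Preserves : (k : ℕ) → (Aut k → Set) → (Pair k → Pair k → Set) → Set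
Preserves k L R = ∀ g → L g → ∀ e e' → R e e' ⇔ R (actP k g e) (actP k g e')

TransitiveOnParts : (k : ℕ) → (Aut k → Set) → (Pair k → Pair k → Set) → Set
TransitiveOnParts k L R = ∀ e e' → IsEdge k e → IsEdge k e' →
  ∃[ g ] (L g × R (actP k g e) e')

-- L-invariant partitions of the set of parts of R correspond to L-invariant
-- equivalence relations S on edges coarser than R; primitivity says every
-- such block system is trivial (S = R, i.e. singletons, or S total).
PrimitiveOnParts : (k : ℕ) → (Aut k → Set) → (Pair k → Pair k → Set) → Set₁
PrimitiveOnParts k L R = TransitiveOnParts k L R ×
  ((S : Pair k → Pair k → Set) → IsEdgePartition k S →
     (∀ e e' → R e e' → S e e') → Preserves k L S →
     (∀ e e' → S e e' → R e e') ⊎ (∀ e e' → IsEdge k e → IsEdge k e' → S e e'))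

IsTransitiveDecomposition : (k : ℕ) → (Aut k → Set) → (Pair k → Pair k → Set) → Set
IsTransitiveDecomposition k L R =
  IsDecomposition k R × Preserves k L R × TransitiveOnParts k L R

IsPrimitiveDecomposition : (k : ℕ) → (Aut k → Set) → (Pair k → Pair k → Set) → Set₁
IsPrimitiveDecomposition k L R =
  IsDecomposition k R × Preserves k L R × PrimitiveOnParts k L R

{-# OPTIONS --safe #-}

-- Write H = G ∩ S₂ₖ and let S be an H-invariant partition coarser than R; if S is G-invariant, primitivity of G applies.
-- Primitivity of G also decides every proposition, so one may argue classically.
-- If τ ∈ G, then joining each part of R to its image under τ gives a G-invariant partition: either it is R, and then S is
-- τ-invariant, or it is total, and then R has two parts.
-- Suppose τ ∉ G ≠ H. Arc-transitivity of H and the Livingstone–Wagner theorem make H transitive on flags (A,x,y) with |A| < k.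
-- If H has no base of size at most k, then Bochert's commutator trick gives a 3-cycle in H. Otherwise all sets of the least
-- size d of a base are bases and H is sharply d-transitive; d = 3 again gives a 3-cycle, and d ≥ 4 is impossible because two
-- elements inducing different transpositions would both invert the regular group fixing d − 1 points. Hence H contains the
-- alternating group, and since τ ∉ G it is the alternating group and G consists of the pairs (σ, sgn σ).
-- An edge is (A,{x,y},B) with τ exchanging A and B. If k ≥ 4, the 3-cycles on A and on B force any R relating edges with
-- different {x,y} to be total, so R is the partition by {x,y}, and every coarser S is invariant under the full group because
-- a transposition fixes two given pairs. If k = 3, a finite computation in the alternating group of degree 6 shows that S is
-- G-invariant.
module Submission where

open import Defs
open import Algebra.Properties.AbelianGroup using (∙-cancelˡ; identityʳ-unique)
import Algebra.Properties.CommutativeMonoid.Sum as Sum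
open import Data.Bool as Bool using (Bool; true; false; if_then_else_; not; _xor_; _∧_; _∨_)
open import Data.Bool.Properties using (not-involutive; xor-comm)
open import Data.Empty using (⊥; ⊥-elim)
open import Data.Fin using (Fin; zero; suc; punchOut)
open import Data.Fin.Patterns using (0F; 1F; 2F; 3F; 4F; 5F)
open import Data.Fin.Permutation
  using (Permutation′; _⟨$⟩ʳ_; _⟨$⟩ˡ_; _∘ₚ_; flip; transpose; inverseˡ; inverseʳ; _≈_) renaming (id to idₚ)
open import Data.Fin.Permutation.Transposition.List using (TranspositionList; eval; decompose; eval-decompose)
open import Data.Fin.Properties using (_≟_; <⇒notInjective; punchOut-injective) renaming (any? to anyFin?)
open import Data.Fin.Subset using (Subset; ∁; _∩_; ∣_∣)
open import Data.Fin.Subset.Properties using (∣∁p∣≡n∸∣p∣; ∩-comm)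
open import Data.Integer as ℤ using (ℤ; 0ℤ; 1ℤ)
import Data.Integer.Properties as ℤₚ
open import Data.List using (List; []; _∷_; _++_; foldr) renaming (map to mapᴸ)
open import Data.List.Membership.Propositional using (_∈_; find)
open import Data.List.Membership.Propositional.Properties using (∈-++⁺ˡ; ∈-++⁺ʳ; ∈-map⁺)
open import Data.List.Relation.Unary.All using (All; []; _∷_; all?) renaming (lookup to all-lookup)
open import Data.List.Relation.Unary.Any using (Any; here; any?)
open import Data.Nat as ℕ using (ℕ; zero; suc; _+_; _∸_; _≤_; _<_; z≤n; s≤s)
import Data.Nat.Properties as ℕₚ
open import Data.Product using (∃; ∃₂; _×_; _,_; proj₁; proj₂; ∃-syntax)
open import Data.Sum using (_⊎_; inj₁; inj₂; [_,_]′; map₁)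
open import Data.Vec as Vec using (Vec; []; _∷_; lookup; tabulate; replicate; _[_]≔_; zipWith)
open import Data.Vec.Properties as Vecₚ
  using (lookup∘update; lookup∘update′; lookup∘tabulate; tabulate∘lookup; tabulate-cong;
         lookup-map; lookup-zipWith; lookup-replicate)
open import Function using (_∘_)
open import Function.Bundles using (mk⇔; Equivalence)
open import Relation.Binary.PropositionalEquality
  using (_≡_; _≢_; refl; sym; trans; cong; cong₂; subst; subst₂)
open import Relation.Nullary using (¬_; Dec; yes; no; does)
open import Relation.Nullary.Decidable using (toWitness; _×-dec_; _⊎-dec_; _→-dec_)

open Sum ℤₚ.+-0-commutativeMonoid using (sum; sum-cong-≗; ∑-distrib-+; sum-permute)

-- Finite subsets

-- `S` is given invariant only under `H`, so everything hinges on showing that odd elements of `G`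
-- preserve it too. When `τ ∉ G`, the only hold on `H` is arc-transitivity, and `H` must be
-- identified from that. Arcs are flags with `|A| = k − 1`; going down to smaller `A` yields
-- 3-transitivity (`|A| = 1`) and transitivity on `j`-sets for all `j ≤ k`, which is what makes sets
-- of equal size comparable as bases. The threshold `k` for base sizes is half the degree: the
-- complement of a minimal base with more than `k` points is too small to be a base. Signs enter
-- only relatively: a group with all 3-cycles contains `σ` or every `σ (i j)`, and the assumption on
-- `τ` keeps transpositions out of `H`. The case `k = 3` stands apart because `A` and `B` then have
-- two points each and no 3-cycle fixes an edge. There the stabiliser of a part of `R` is normalised
-- by an odd permutation, while for `S` this is the very claim; what `R` provides is carried to `S`
-- through `R ⊆ S`.

infix 4 _∋_ _∌_ _⊑_

_∋_ _∌_ : ∀ {n} → Subset n → Fin n → Set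
A ∋ i = lookup A i ≡ true
A ∌ i = lookup A i ≡ false

_⊑_ : ∀ {n} → Subset n → Subset n → Set
A ⊑ B = ∀ {i} → A ∋ i → B ∋ i

∋⊎∌ : ∀ {n} (A : Subset n) i → A ∋ i ⊎ A ∌ i
∋⊎∌ A i with lookup A i
... | true  = inj₁ refl
... | false = inj₂ refl

∋-∌ : ∀ {n} {A : Subset n} {i} → A ∋ i → A ∌ i → ⊥
∋-∌ p q with () ← trans (sym p) q

∋∌⇒≢ : ∀ {n} {A : Subset n} {i j} → A ∋ i → A ∌ j → i ≢ j
∋∌⇒≢ {A = A} p q refl = ∋-∌ {A = A} p q

⊑-∌ : ∀ {n} {A B : Subset n} {i} → A ⊑ B → B ∌ i → A ∌ i
⊑-∌ {A = A} {B} {i} s q with ∋⊎∌ A i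
... | inj₁ p = ⊥-elim (∋-∌ {A = B} (s p) q)
... | inj₂ p = p

lookup-ext : ∀ {n} {A B : Subset n} → (∀ i → lookup A i ≡ lookup B i) → A ≡ B
lookup-ext {A = A} {B} eq =
  trans (sym (tabulate∘lookup A)) (trans (tabulate-cong eq) (tabulate∘lookup B))

⊑-antisym : ∀ {n} {A B : Subset n} → A ⊑ B → B ⊑ A → A ≡ B
⊑-antisym {A = A} {B} s t = lookup-ext pointwise
  where
  pointwise : ∀ i → lookup A i ≡ lookup B i
  pointwise i with ∋⊎∌ A i | ∋⊎∌ B i
  ... | inj₁ p | _      = trans p (sym (s p))
  ... | inj₂ p | inj₁ q = ⊥-elim (∋-∌ {A = A} (t q) p)
  ... | inj₂ p | inj₂ q = trans p (sym q)

ins del : ∀ {n} → Subset n → Fin n → Subset n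
ins A i = A [ i ]≔ true
del A i = A [ i ]≔ false

ins-self : ∀ {n} (A : Subset n) i → ins A i ∋ i
ins-self A i = lookup∘update i A true

del-self : ∀ {n} (A : Subset n) i → del A i ∌ i
del-self A i = lookup∘update i A false

lookup-ins : ∀ {n} {i j : Fin n} (A : Subset n) → i ≢ j → lookup (ins A j) i ≡ lookup A i
lookup-ins A i≢j = lookup∘update′ i≢j A true

lookup-del : ∀ {n} {i j : Fin n} (A : Subset n) → i ≢ j → lookup (del A j) i ≡ lookup A i
lookup-del A i≢j = lookup∘update′ i≢j A false

ins-⊒ : ∀ {n} (A : Subset n) i → A ⊑ ins A i
ins-⊒ A i {j} p with j ≟ i
... | yes refl = ins-self A i
... | no j≢i   = trans (lookup-ins A j≢i) p

del-⊑ : ∀ {n} (A : Subset n) i → del A i ⊑ A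
del-⊑ A i {j} p with j ≟ i
... | yes refl = ⊥-elim (∋-∌ {A = del A i} p (del-self A i))
... | no j≢i   = trans (sym (lookup-del A j≢i)) p

ins⁻ : ∀ {n} (A : Subset n) i {j} → ins A i ∋ j → j ≡ i ⊎ A ∋ j
ins⁻ A i {j} p with j ≟ i
... | yes eq = inj₁ eq
... | no j≢i = inj₂ (trans (sym (lookup-ins A j≢i)) p)

ins-∌ : ∀ {n} (A : Subset n) {i j} → j ≢ i → A ∌ j → ins A i ∌ j
ins-∌ A j≢i q = trans (lookup-ins A j≢i) q

ins-∌⁻ : ∀ {n} (A : Subset n) {i j} → ins A i ∌ j → j ≢ i × A ∌ j
ins-∌⁻ A {i} {j} q = j≢i , trans (sym (lookup-ins A j≢i)) q
  where
  j≢i : j ≢ i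
  j≢i refl = ∋-∌ {A = ins A j} (ins-self A j) q

del-∋ : ∀ {n} (A : Subset n) {i j} → j ≢ i → A ∋ j → del A i ∋ j
del-∋ A j≢i p = trans (lookup-del A j≢i) p

del-∌ : ∀ {n} (A : Subset n) i {j} → A ∌ j → del A i ∌ j
del-∌ A i = ⊑-∌ {A = del A i} {A} (del-⊑ A i)

ins-del : ∀ {n} (A : Subset n) {i} → A ∋ i → ins (del A i) i ≡ A
ins-del A {i} p = lookup-ext pointwise
  where
  pointwise : ∀ j → lookup (ins (del A i) i) j ≡ lookup A j
  pointwise j with j ≟ i
  ... | yes refl = trans (ins-self (del A i) i) (sym p)
  ... | no j≢i   = trans (lookup-ins (del A i) j≢i) (lookup-del A j≢i)

del-ins : ∀ {n} (A : Subset n) {i} → A ∌ i → del (ins A i) i ≡ A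
del-ins A {i} p = lookup-ext pointwise
  where
  pointwise : ∀ j → lookup (del (ins A i) i) j ≡ lookup A j
  pointwise j with j ≟ i
  ... | yes refl = trans (del-self (ins A i) i) (sym p)
  ... | no j≢i   = trans (lookup-del (ins A i) j≢i) (lookup-ins A j≢i)

del-ins-comm : ∀ {n} (A : Subset n) {i j} → i ≢ j → del (ins A j) i ≡ ins (del A i) j
del-ins-comm A {i} {j} i≢j = lookup-ext pointwise
  where
  pointwise : ∀ l → lookup (del (ins A j) i) l ≡ lookup (ins (del A i) j) l
  pointwise l with l ≟ i | l ≟ j
  ... | yes refl | yes eq   = ⊥-elim (i≢j eq)
  ... | yes refl | no l≢j   = trans (del-self (ins A j) l) (sym (trans (lookup-ins (del A l) l≢j) (del-self A l)))
  ... | no l≢i   | yes refl = trans (lookup-del (ins A l) l≢i) (trans (ins-self A l) (sym (ins-self (del A i) l)))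
  ... | no l≢i   | no l≢j   =
    trans (lookup-del (ins A j) l≢i) (trans (lookup-ins A l≢j) (sym (trans (lookup-ins (del A i) l≢j) (lookup-del A l≢i))))

∣ins∣ : ∀ {n} (A : Subset n) i → A ∌ i → ∣ ins A i ∣ ≡ suc ∣ A ∣
∣ins∣ (false ∷ A) zero    _ = refl
∣ins∣ (true ∷ A)  (suc i) q = cong suc (∣ins∣ A i q)
∣ins∣ (false ∷ A) (suc i) q = ∣ins∣ A i q

∣del∣ : ∀ {n} (A : Subset n) i → A ∋ i → ∣ A ∣ ≡ suc ∣ del A i ∣
∣del∣ A i p = trans (cong ∣_∣ (sym (ins-del A p))) (∣ins∣ (del A i) i (del-self A i))

∅ full : ∀ n → Subset n
∅ n    = replicate n false
full n = replicate n true

∣∅∣ : ∀ n → ∣ ∅ n ∣ ≡ 0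
∣∅∣ zero    = refl
∣∅∣ (suc n) = ∣∅∣ n

∣full∣ : ∀ n → ∣ full n ∣ ≡ n
∣full∣ zero    = refl
∣full∣ (suc n) = cong suc (∣full∣ n)

∅-∌ : ∀ {n} (i : Fin n) → ∅ n ∌ i
∅-∌ i = lookup-replicate i false

full-∋ : ∀ {n} (i : Fin n) → full n ∋ i
full-∋ i = lookup-replicate i true

∣∣≡0 : ∀ {n} {A : Subset n} → ∣ A ∣ ≡ 0 → ∀ i → A ∌ i
∣∣≡0 {A = false ∷ A} eq zero    = refl
∣∣≡0 {A = false ∷ A} eq (suc i) = ∣∣≡0 {A = A} eq i

pick : ∀ {n} (A B : Subset n) → ∣ B ∣ < ∣ A ∣ → ∃ λ i → A ∋ i × B ∌ i
pick (true ∷ A)  (false ∷ B) _         = zero , refl , refl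
pick (true ∷ A)  (true ∷ B)  (s≤s lt)  with pick A B lt
... | i , p , q = suc i , p , q
pick (false ∷ A) (true ∷ B)  lt        with pick A B (ℕₚ.≤-trans (ℕₚ.n≤1+n _) lt)
... | i , p , q = suc i , p , q
pick (false ∷ A) (false ∷ B) lt        with pick A B lt
... | i , p , q = suc i , p , q

fresh : ∀ {n} (A : Subset n) → ∣ A ∣ < n → ∃ λ i → A ∌ i
fresh {n} A lt with pick (full n) A (subst (∣ A ∣ <_) (sym (∣full∣ n)) lt)
... | i , _ , q = i , q

member : ∀ {n} (A : Subset n) → 0 < ∣ A ∣ → ∃ λ i → A ∋ i
member {n} A lt with pick A (∅ n) (subst (_< ∣ A ∣) (sym (∣∅∣ n)) lt)
... | i , p , _ = i , p

subset-of-size : ∀ {n} (A : Subset n) m → m ≤ ∣ A ∣ → ∃ λ B → B ⊑ A × ∣ B ∣ ≡ m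
subset-of-size {n} A zero    _  = ∅ n , (λ {i} p → ⊥-elim (∋-∌ {A = ∅ n} p (∅-∌ i))) , ∣∅∣ n
subset-of-size A (suc m) le with subset-of-size A m (ℕₚ.≤-trans (ℕₚ.n≤1+n m) le)
... | B , s , eq with pick A B (subst (_< ∣ A ∣) (sym eq) le)
... | i , p , q = ins B i , t , trans (∣ins∣ B i q) (cong suc eq)
  where
  t : ins B i ⊑ A
  t r with ins⁻ B i r
  ... | inj₁ refl = p
  ... | inj₂ r′   = s r′

∣∣-injection : ∀ {n} m (A B : Subset n) (f : Fin n → Fin n) → (∀ {i j} → f i ≡ f j → i ≡ j) →
  ∣ A ∣ ≡ m → (∀ {i} → A ∋ i → B ∋ f i) → ∣ A ∣ ≤ ∣ B ∣
∣∣-injection zero    A B f inj eq g = subst (_≤ ∣ B ∣) (sym eq) z≤n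
∣∣-injection (suc m) A B f inj eq g with member A (subst (0 <_) (sym eq) (s≤s z≤n))
... | i , p = subst₂ _≤_ (sym (∣del∣ A i p)) (sym (∣del∣ B (f i) (g p)))
    (s≤s (∣∣-injection m (del A i) (del B (f i)) f inj (ℕₚ.suc-injective (trans (sym (∣del∣ A i p)) eq)) h))
  where
  h : ∀ {j} → del A i ∋ j → del B (f i) ∋ f j
  h {j} q = del-∋ B (λ fj≡fi → ∋∌⇒≢ {A = del A i} q (del-self A i) (inj fj≡fi)) (g (del-⊑ A i q))

⊑-∣∣ : ∀ {n} {A B : Subset n} → A ⊑ B → ∣ A ∣ ≤ ∣ B ∣
⊑-∣∣ {A = A} {B} s = ∣∣-injection ∣ A ∣ A B (λ i → i) (λ eq → eq) refl s

∣ins∣≤ : ∀ {n} (A : Subset n) i → ∣ ins A i ∣ ≤ suc ∣ A ∣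
∣ins∣≤ A i with ∋⊎∌ A i
... | inj₂ q = ℕₚ.≤-reflexive (∣ins∣ A i q)
... | inj₁ p = ℕₚ.≤-trans (⊑-∣∣ {A = ins A i} {A} s) (ℕₚ.n≤1+n _)
  where
  s : ins A i ⊑ A
  s r with ins⁻ A i r
  ... | inj₁ refl = p
  ... | inj₂ r′   = r′

ins-≤ : ∀ {n} (A : Subset n) i {m} → ∣ A ∣ ≤ m → ∣ ins A i ∣ ≤ suc m
ins-≤ A i le = ℕₚ.≤-trans (∣ins∣≤ A i) (s≤s le)

⊑-∣∣≡ : ∀ {n} {A B : Subset n} → A ⊑ B → ∣ B ∣ ≤ ∣ A ∣ → A ≡ B
⊑-∣∣≡ {A = A} {B} s le = ⊑-antisym {A = A} {B} s t
  where
  t : B ⊑ A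
  t {i} p with ∋⊎∌ A i
  ... | inj₁ q = q
  ... | inj₂ q = ⊥-elim (ℕₚ.<⇒≱ (ℕₚ.≤-refl {suc ∣ A ∣})
      (ℕₚ.≤-trans (ℕₚ.≤-reflexive (sym (∣ins∣ A i q))) (ℕₚ.≤-trans (⊑-∣∣ {A = ins A i} {B} u) le)))
    where
    u : ins A i ⊑ B
    u r with ins⁻ A i r
    ... | inj₁ refl = p
    ... | inj₂ r′   = s r′

-- Permutations acting on subsets

infixr 9 _∙_

_∙_ : ∀ {n} → Permutation′ n → Permutation′ n → Permutation′ n
σ ∙ π = π ∘ₚ σ

perm-inj : ∀ {n} (σ : Permutation′ n) {i j} → σ ⟨$⟩ʳ i ≡ σ ⟨$⟩ʳ j → i ≡ j
perm-inj σ eq = trans (sym (inverseˡ σ)) (trans (cong (σ ⟨$⟩ˡ_) eq) (inverseˡ σ))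

inv-of : ∀ {n} (σ : Permutation′ n) {i j} → σ ⟨$⟩ʳ i ≡ j → σ ⟨$⟩ˡ j ≡ i
inv-of σ refl = inverseˡ σ

lookup-permute : ∀ {n} (σ : Permutation′ n) (A : Subset n) i → lookup (permute σ A) (σ ⟨$⟩ʳ i) ≡ lookup A i
lookup-permute σ A i = trans (lookup∘tabulate _ (σ ⟨$⟩ʳ i)) (cong (lookup A) (inverseˡ σ))

permute-unique : ∀ {n} (σ : Permutation′ n) (A B : Subset n) →
  (∀ i → lookup B (σ ⟨$⟩ʳ i) ≡ lookup A i) → permute σ A ≡ B
permute-unique σ A B eq = lookup-ext λ j → trans (lookup∘tabulate _ j)
  (trans (sym (eq (σ ⟨$⟩ˡ j))) (cong (lookup B) (inverseʳ σ)))

permute-∙ : ∀ {n} (σ π : Permutation′ n) A → permute (σ ∙ π) A ≡ permute σ (permute π A)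
permute-∙ σ π A = permute-unique (σ ∙ π) A (permute σ (permute π A))
  (λ i → trans (lookup-permute σ (permute π A) (π ⟨$⟩ʳ i)) (lookup-permute π A i))

permute-id : ∀ {n} (A : Subset n) → permute idₚ A ≡ A
permute-id A = tabulate∘lookup A

permute-cong : ∀ {n} {σ π : Permutation′ n} → σ ≈ π → ∀ A → permute σ A ≡ permute π A
permute-cong {σ = σ} {π} eq A = permute-unique σ A (permute π A)
  (λ i → trans (cong (lookup (permute π A)) (eq i)) (lookup-permute π A i))

permute-flip : ∀ {n} (σ : Permutation′ n) A → permute (flip σ) (permute σ A) ≡ A
permute-flip σ A = permute-unique (flip σ) (permute σ A) A
  (λ i → trans (sym (lookup-permute σ A (σ ⟨$⟩ˡ i))) (cong (lookup (permute σ A)) (inverseʳ σ)))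

∣permute∣ : ∀ {n} (σ : Permutation′ n) A → ∣ permute σ A ∣ ≡ ∣ A ∣
∣permute∣ σ A = ℕₚ.≤-antisym
  (∣∣-injection _ (permute σ A) A (σ ⟨$⟩ˡ_) (perm-inj (flip σ)) refl
    (λ {i} p → trans (sym (lookup∘tabulate (λ j → lookup A (σ ⟨$⟩ˡ j)) i)) p))
  (∣∣-injection _ A (permute σ A) (σ ⟨$⟩ʳ_) (perm-inj σ) refl (λ {i} p → trans (lookup-permute σ A i) p))

permute-ins : ∀ {n} (σ : Permutation′ n) A i → permute σ (ins A i) ≡ ins (permute σ A) (σ ⟨$⟩ʳ i)
permute-ins σ A i = permute-unique σ (ins A i) _ pointwise
  where
  pointwise : ∀ j → lookup (ins (permute σ A) (σ ⟨$⟩ʳ i)) (σ ⟨$⟩ʳ j) ≡ lookup (ins A i) j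
  pointwise j with j ≟ i
  ... | yes refl = trans (ins-self (permute σ A) (σ ⟨$⟩ʳ j)) (sym (ins-self A j))
  ... | no j≢i   = trans (lookup-ins (permute σ A) (j≢i ∘ perm-inj σ))
                     (trans (lookup-permute σ A j) (sym (lookup-ins A j≢i)))

permute-del : ∀ {n} (σ : Permutation′ n) A i → permute σ (del A i) ≡ del (permute σ A) (σ ⟨$⟩ʳ i)
permute-del σ A i = permute-unique σ (del A i) _ pointwise
  where
  pointwise : ∀ j → lookup (del (permute σ A) (σ ⟨$⟩ʳ i)) (σ ⟨$⟩ʳ j) ≡ lookup (del A i) j
  pointwise j with j ≟ i
  ... | yes refl = trans (del-self (permute σ A) (σ ⟨$⟩ʳ j)) (sym (del-self A j))
  ... | no j≢i   = trans (lookup-del (permute σ A) (j≢i ∘ perm-inj σ))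
                     (trans (lookup-permute σ A j) (sym (lookup-del A j≢i)))

-- Sums over subsets and the Livingstone-Wagner argument

sum-zero : ∀ n → sum {n} (λ _ → 0ℤ) ≡ 0ℤ
sum-zero zero    = refl
sum-zero (suc n) = trans (ℤₚ.+-identityˡ _) (sum-zero n)

at : ∀ {n} → Fin n → ℤ → Fin n → ℤ
at a c i = if does (i ≟ a) then c else 0ℤ

sum-at : ∀ {n} (a : Fin n) c → sum (at a c) ≡ c
sum-at {suc n} zero    c = trans (cong (λ z → c ℤ.+ z) (sum-zero n)) (ℤₚ.+-identityʳ c)
sum-at {suc n} (suc a) c = trans (ℤₚ.+-identityˡ _) (trans (sum-cong-≗ pointwise) (sum-at a c))
  where
  pointwise : ∀ i → at (suc a) c (suc i) ≡ at a c i
  pointwise i with does (i ≟ a)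
  ... | true  = refl
  ... | false = refl

sum-over : ∀ {n} → (Fin n → ℤ) → Subset n → ℤ
sum-over f A = sum (λ i → if lookup A i then f i else 0ℤ)

sum-over-cong : ∀ {n} {f g : Fin n → ℤ} (A : Subset n) → (∀ i → A ∋ i → f i ≡ g i) → sum-over f A ≡ sum-over g A
sum-over-cong {f = f} {g} A eq = sum-cong-≗ pointwise
  where
  pointwise : ∀ i → (if lookup A i then f i else 0ℤ) ≡ (if lookup A i then g i else 0ℤ)
  pointwise i with lookup A i | eq i
  ... | true  | e = e refl
  ... | false | _ = refl

sum-over-const : ∀ {n} (A : Subset n) c → sum-over (λ _ → c) A ≡ ℤ.+ ∣ A ∣ ℤ.* c
sum-over-const []          c = refl
sum-over-const (true ∷ A)  c = trans (cong (λ z → c ℤ.+ z) (sum-over-const A c)) (sym (ℤₚ.suc-* (ℤ.+ ∣ A ∣) c))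
sum-over-const (false ∷ A) c = trans (ℤₚ.+-identityˡ _) (sum-over-const A c)

sum-over-+ : ∀ {n} (f g : Fin n → ℤ) (A : Subset n) → sum-over (λ i → f i ℤ.+ g i) A ≡ sum-over f A ℤ.+ sum-over g A
sum-over-+ f g A = trans (sum-cong-≗ pointwise) (∑-distrib-+ (λ i → if lookup A i then f i else 0ℤ) _)
  where
  pointwise : ∀ i → (if lookup A i then f i ℤ.+ g i else 0ℤ) ≡
    (if lookup A i then f i else 0ℤ) ℤ.+ (if lookup A i then g i else 0ℤ)
  pointwise i with lookup A i
  ... | true  = refl
  ... | false = refl

sum-over-ins : ∀ {n} (f : Fin n → ℤ) (A : Subset n) a → A ∌ a → sum-over f (ins A a) ≡ f a ℤ.+ sum-over f A
sum-over-ins f A a q = trans (sum-cong-≗ pointwise)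
  (trans (∑-distrib-+ (at a (f a)) _) (cong (λ z → z ℤ.+ sum-over f A) (sum-at a (f a))))
  where
  pointwise : ∀ i → (if lookup (ins A a) i then f i else 0ℤ) ≡ at a (f a) i ℤ.+ (if lookup A i then f i else 0ℤ)
  pointwise i with i ≟ a
  ... | yes refl rewrite ins-self A i | q = sym (ℤₚ.+-identityʳ (f i))
  ... | no i≢a   rewrite lookup-ins A i≢a = sym (ℤₚ.+-identityˡ _)

-- The inclusion matrix of `m`-sets in `(m+1)`-sets, applied to the vector `g`.
shadow : ∀ {n} → (Subset n → ℤ) → Subset n → ℤ
shadow g C = sum-over (λ i → g (del C i)) C

Disjoint : ∀ {n} → Subset n → Subset n → Set
Disjoint D B = ∀ i → D ∋ i → B ∌ i

shadow-ins : ∀ {n} (g : Subset n → ℤ) C a → C ∌ a → shadow g (ins C a) ≡ g C ℤ.+ shadow (λ B → g (ins B a)) C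
shadow-ins g C a q = trans (sum-over-ins _ C a q)
  (cong₂ ℤ._+_ (cong g (del-ins C q))
    (sum-over-cong C λ i p → cong g (del-ins-comm C (∋∌⇒≢ {A = C} p q))))

shadow-permute : ∀ {n} (g : Subset n → ℤ) (σ : Permutation′ n) → (∀ B → g (permute σ B) ≡ g B) →
  ∀ C → shadow g (permute σ C) ≡ shadow g C
shadow-permute g σ inv C = trans (sum-permute _ σ) (sum-cong-≗ pointwise)
  where
  pointwise : ∀ i → (if lookup (permute σ C) (σ ⟨$⟩ʳ i) then g (del (permute σ C) (σ ⟨$⟩ʳ i)) else 0ℤ) ≡
    (if lookup C i then g (del C i) else 0ℤ)
  pointwise i rewrite lookup-permute σ C i | sym (permute-del σ C i) | inv (del C i) = refl

ins-Disjoint : ∀ {n} {D B : Subset n} {a} → Disjoint D B → D ∌ a → Disjoint D (ins B a)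
ins-Disjoint {D = D} {B} dis q i p = ins-∌ B (∋∌⇒≢ {A = D} p q) (dis i p)

Disjoint-ins⁻ : ∀ {n} (D B : Subset n) {a} → Disjoint (ins D a) B → Disjoint D B × B ∌ a
Disjoint-ins⁻ D B {a} dis = (λ i p → dis i (ins-⊒ D a p)) , dis a (ins-self D a)

disjoint-of-size : ∀ {n} (D : Subset n) m → ∣ D ∣ + m ≤ n → ∃ λ B → Disjoint D B × ∣ B ∣ ≡ m
disjoint-of-size {n} D zero    _  = ∅ n , (λ i _ → ∅-∌ i) , ∣∅∣ n
disjoint-of-size {n} D (suc m) le with disjoint-of-size D m (ℕₚ.≤-trans (ℕₚ.+-monoʳ-≤ ∣ D ∣ (ℕₚ.n≤1+n m)) le)
... | B , dis , eq with fresh (zipWith _∨_ D B) lt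
  where
  union≤ : ∀ {l} (D B : Subset l) → ∣ zipWith _∨_ D B ∣ ≤ ∣ D ∣ + ∣ B ∣
  union≤ []          []          = z≤n
  union≤ (true ∷ D)  (true ∷ B)  = s≤s (ℕₚ.≤-trans (union≤ D B) (ℕₚ.+-monoʳ-≤ ∣ D ∣ (ℕₚ.n≤1+n _)))
  union≤ (true ∷ D)  (false ∷ B) = s≤s (union≤ D B)
  union≤ (false ∷ D) (true ∷ B)  = ℕₚ.≤-trans (s≤s (union≤ D B)) (ℕₚ.≤-reflexive (sym (ℕₚ.+-suc ∣ D ∣ ∣ B ∣)))
  union≤ (false ∷ D) (false ∷ B) = union≤ D B
  lt : ∣ zipWith _∨_ D B ∣ < n
  lt = ℕₚ.≤-trans (s≤s (union≤ D B)) (ℕₚ.≤-trans (ℕₚ.≤-reflexive (trans (sym (ℕₚ.+-suc ∣ D ∣ ∣ B ∣)) (cong (λ x → ∣ D ∣ + suc x) eq))) le)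
... | i , q = ins B i , ins-Disjoint {D = D} {B} dis (proj₁ parts) , trans (∣ins∣ B i (proj₂ parts)) (cong suc eq)
  where
  ∨-false : ∀ x y → x ∨ y ≡ false → x ≡ false × y ≡ false
  ∨-false false y e = refl , e
  parts : D ∌ i × B ∌ i
  parts = ∨-false _ _ (trans (sym (lookup-zipWith _∨_ i D B)) q)

-- The Johnson graph on the sets outside `D` is connected: `B` is moved towards `C` by trading a
-- point of `B` not in `C` for a point of `C` not in `B`. The fuel bounds the points of `C` still
-- missing.
exchange-connected : ∀ {n} (D : Subset n) (g : Subset n → ℤ) m →
  (∀ B a b → ∣ B ∣ ≡ m → Disjoint D B → B ∌ a → B ∌ b → D ∌ a → D ∌ b → a ≢ b → g (ins B a) ≡ g (ins B b)) →
  ∀ B C → ∣ B ∣ ≡ suc m → ∣ C ∣ ≡ suc m → Disjoint D B → Disjoint D C → g B ≡ g C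
exchange-connected {n} D g m step B C ∣B∣ ∣C∣ disB disC = go (suc m) B ∣B∣ disB (ℕₚ.m≤m+n (suc m) _)
  where
  ∧⁻ : ∀ x y → x ∧ y ≡ true → x ≡ true × y ≡ true
  ∧⁻ true true _ = refl , refl
  ∩⁻ : ∀ B {i} → B ∩ C ∋ i → B ∋ i × C ∋ i
  ∩⁻ B {i} p = ∧⁻ _ _ (trans (sym (lookup-zipWith _∧_ i B C)) p)
  ∩⁺ : ∀ B {i} → B ∋ i → C ∋ i → B ∩ C ∋ i
  ∩⁺ B {i} p q = trans (lookup-zipWith _∧_ i B C) (cong₂ _∧_ p q)
  equal : ∀ B → ∣ B ∣ ≡ suc m → suc m ≤ ∣ B ∩ C ∣ → g B ≡ g C
  equal B ∣B∣ le = cong g (trans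
    (sym (⊑-∣∣≡ {A = B ∩ C} {B} (λ p → proj₁ (∩⁻ B p)) (subst (_≤ ∣ B ∩ C ∣) (sym ∣B∣) le)))
    (⊑-∣∣≡ {A = B ∩ C} {C} (λ p → proj₂ (∩⁻ B p)) (subst (_≤ ∣ B ∩ C ∣) (sym ∣C∣) le)))
  go : ∀ fuel B → ∣ B ∣ ≡ suc m → Disjoint D B → suc m ≤ fuel + ∣ B ∩ C ∣ → g B ≡ g C
  go zero B ∣B∣ dis le = equal B ∣B∣ le
  go (suc fuel) B ∣B∣ dis le with ℕₚ.<-≤-connex ∣ B ∩ C ∣ (suc m)
  ... | inj₂ ge = equal B ∣B∣ ge
  ... | inj₁ lt with pick B (B ∩ C) (subst (∣ B ∩ C ∣ <_) (sym ∣B∣) lt) | pick C (B ∩ C) (subst (∣ B ∩ C ∣ <_) (sym ∣C∣) lt)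
  ... | a , Ba , a∌ | b , Cb , b∌ = trans eq (go fuel B₁ ∣B₁∣ dis₁ le₁)
    where
    Bb : B ∌ b
    Bb with ∋⊎∌ B b
    ... | inj₁ p = ⊥-elim (∋-∌ {A = B ∩ C} (∩⁺ B p Cb) b∌)
    ... | inj₂ q = q
    a≢b : a ≢ b
    a≢b = ∋∌⇒≢ {A = B} Ba Bb
    B₀ B₁ : Subset n
    B₀ = del B a
    B₁ = ins B₀ b
    D∌ : ∀ {C i} → Disjoint D C → C ∋ i → D ∌ i
    D∌ {C} {i} dis p with ∋⊎∌ D i
    ... | inj₁ d = ⊥-elim (∋-∌ {A = C} p (dis i d))
    ... | inj₂ d = d
    dis₀ : Disjoint D B₀
    dis₀ i d = del-∌ B a (dis i d)
    ∣B₀∣ : ∣ B₀ ∣ ≡ m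
    ∣B₀∣ = ℕₚ.suc-injective (trans (sym (∣del∣ B a Ba)) ∣B∣)
    eq : g B ≡ g B₁
    eq = trans (cong g (sym (ins-del B Ba)))
      (step B₀ a b ∣B₀∣ dis₀ (del-self B a) (del-∌ B a Bb) (D∌ {B} dis Ba) (D∌ {C} disC Cb) a≢b)
    ∣B₁∣ : ∣ B₁ ∣ ≡ suc m
    ∣B₁∣ = trans (∣ins∣ B₀ b (del-∌ B a Bb)) (cong suc ∣B₀∣)
    dis₁ : Disjoint D B₁
    dis₁ = ins-Disjoint {D = D} {B₀} dis₀ (D∌ {C} disC Cb)
    grow : ins (B ∩ C) b ⊑ B₁ ∩ C
    grow p with ins⁻ (B ∩ C) b p
    ... | inj₁ refl = ∩⁺ B₁ (ins-self B₀ b) Cb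
    ... | inj₂ q    = ∩⁺ B₁ (ins-⊒ B₀ b (del-∋ B (∋∌⇒≢ {A = B ∩ C} q a∌) (proj₁ (∩⁻ B q)))) (proj₂ (∩⁻ B q))
    le₁ : suc m ≤ fuel + ∣ B₁ ∩ C ∣
    le₁ = ℕₚ.≤-trans le (ℕₚ.≤-trans (ℕₚ.≤-reflexive (sym (ℕₚ.+-suc fuel _)))
      (ℕₚ.+-monoʳ-≤ fuel (subst (_≤ ∣ B₁ ∩ C ∣) (∣ins∣ (B ∩ C) b b∌) (⊑-∣∣ {A = ins (B ∩ C) b} {B₁ ∩ C} grow))))

-- This is the combinatorial content of the Livingstone–Wagner theorem. The induction replaces g by B ↦ g (B ∪ a) − g (B ∪ b), whose sums vanish.
shadow-injective : ∀ {n} m (D : Subset n) (g : Subset n → ℤ) → ∣ D ∣ + suc (m + m) ≤ n →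
  (∀ C C′ → ∣ C ∣ ≡ suc m → ∣ C′ ∣ ≡ suc m → Disjoint D C → Disjoint D C′ → shadow g C ≡ shadow g C′) →
  ∀ B B′ → ∣ B ∣ ≡ m → ∣ B′ ∣ ≡ m → Disjoint D B → Disjoint D B′ → g B ≡ g B′
shadow-injective zero D g le const B B′ eq eq′ dis dis′ =
  cong g (lookup-ext λ i → trans (∣∣≡0 {A = B} eq i) (sym (∣∣≡0 {A = B′} eq′ i)))
shadow-injective {n} (suc m) D g le const = exchange-connected D g m step
  where
  step : ∀ B a b → ∣ B ∣ ≡ m → Disjoint D B → B ∌ a → B ∌ b → D ∌ a → D ∌ b → a ≢ b → g (ins B a) ≡ g (ins B b)
  step B a b ∣B∣ disB Ba Bb Da Db a≢b = ℤₚ.i-j≡0⇒i≡j _ _ g′B≡0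
    where
    D′ : Subset n
    D′ = ins (ins D a) b
    ∣D′∣ : ∣ D′ ∣ ≡ suc (suc ∣ D ∣)
    ∣D′∣ = trans (∣ins∣ (ins D a) b (ins-∌ D (a≢b ∘ sym) Db)) (cong suc (∣ins∣ D a Da))
    -- Two points enter `D′` while `m` drops by one, so the bound is kept exactly.
    room : ∣ D′ ∣ + suc (m + m) ≤ n
    room = subst (_≤ n) (trans (cong (λ x → ∣ D ∣ + suc (suc x)) (ℕₚ.+-suc m m))
      (trans (trans (ℕₚ.+-suc ∣ D ∣ _) (cong suc (ℕₚ.+-suc ∣ D ∣ _))) (cong (_+ suc (m + m)) (sym ∣D′∣)))) le
    split : ∀ C → Disjoint D′ C → Disjoint D C × C ∌ a × C ∌ b
    split C dis with Disjoint-ins⁻ (ins D a) C dis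
    ... | dis₁ , Cb with Disjoint-ins⁻ D C dis₁
    ... | dis₂ , Ca = dis₂ , Ca , Cb
    g′ : Subset n → ℤ
    g′ C = g (ins C a) ℤ.- g (ins C b)
    -- The shadows of `C ∪ a` and `C ∪ b` are equal and share the term `g C`. Cancelling it leaves
    -- two equal sums, whose difference is the shadow of `g′`.
    vanish : ∀ C → ∣ C ∣ ≡ suc m → Disjoint D′ C → shadow g′ C ≡ 0ℤ
    vanish C ∣C∣ dis = identityʳ-unique ℤₚ.+-0-abelianGroup (shadow (λ B → g (ins B b)) C) (shadow g′ C) (trans rejoin (sym sums))
      where
      disD = proj₁ (split C dis)
      Ca   = proj₁ (proj₂ (split C dis))
      Cb   = proj₂ (proj₂ (split C dis))
      sums : shadow (λ B → g (ins B b)) C ≡ shadow (λ B → g (ins B a)) C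
      sums = ∙-cancelˡ ℤₚ.+-0-abelianGroup (g C) _ _ (trans (sym (shadow-ins g C b Cb)) (trans
        (const (ins C b) (ins C a) (trans (∣ins∣ C b Cb) (cong suc ∣C∣)) (trans (∣ins∣ C a Ca) (cong suc ∣C∣))
          (ins-Disjoint {D = D} {C} disD Db) (ins-Disjoint {D = D} {C} disD Da)) (shadow-ins g C a Ca)))
      rejoin : shadow (λ B → g (ins B b)) C ℤ.+ shadow g′ C ≡ shadow (λ B → g (ins B a)) C
      rejoin = trans (sym (sum-over-+ _ _ C)) (sum-over-cong C λ i _ → cancel (g (ins (del C i) b)) (g (ins (del C i) a)))
        where
        cancel : ∀ x y → x ℤ.+ (y ℤ.- x) ≡ y
        cancel x y = trans (ℤₚ.+-comm x _) (trans (ℤₚ.+-assoc y (ℤ.- x) x)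
          (trans (cong (λ z → y ℤ.+ z) (ℤₚ.+-inverseˡ x)) (ℤₚ.+-identityʳ y)))
    disB′ : Disjoint D′ B
    disB′ i p with ins⁻ (ins D a) b p
    ... | inj₁ refl = Bb
    ... | inj₂ p₁ with ins⁻ D a p₁
    ... | inj₁ refl = Ba
    ... | inj₂ p₂   = disB i p₂
    constant : ∀ C → ∣ C ∣ ≡ m → Disjoint D′ C → g′ C ≡ g′ B
    constant C ∣C∣ dis = shadow-injective m D′ g′ room
      (λ C₁ C₂ e₁ e₂ d₁ d₂ → trans (vanish C₁ e₁ d₁) (sym (vanish C₂ e₂ d₂))) C B ∣C∣ ∣B∣ dis disB′
    -- By induction `g′` is constant on the `m`-sets outside `D′`, so its shadow at an `(m+1)`-set
    -- is `m + 1` times that constant; it vanishes, and `ℤ` has no torsion.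
    g′B≡0 : g′ B ≡ 0ℤ
    g′B≡0 with disjoint-of-size D′ (suc m) (ℕₚ.≤-trans (ℕₚ.+-monoʳ-≤ ∣ D′ ∣ (s≤s (ℕₚ.m≤m+n m m))) room)
    ... | C , dis , ∣C∣ = [ (λ ()) , (λ e → e) ]′ (ℤₚ.i*j≡0⇒i≡0∨j≡0 (ℤ.+ suc m) (trans (sym total) (vanish C ∣C∣ dis)))
      where
      total : shadow g′ C ≡ ℤ.+ suc m ℤ.* g′ B
      total = trans (sum-over-cong C λ i p → constant (del C i) (ℕₚ.suc-injective (trans (sym (∣del∣ C i p)) ∣C∣))
          (λ j d → del-∌ C i (dis j d)))
        (trans (sum-over-const C (g′ B)) (cong (λ x → ℤ.+ x ℤ.* g′ B) ∣C∣))

-- Flag-transitive permutation groups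

record IsPermGroup {n} (H : Permutation′ n → Set) : Set where
  field
    resp : ∀ {σ π} → σ ≈ π → H σ → H π
    id∈  : H idₚ
    ∙∈   : ∀ {σ π} → H σ → H π → H (σ ∙ π)
    inv∈ : ∀ {σ} → H σ → H (flip σ)

Classical : Set₁
Classical = (Q : Set) → Q ⊎ ¬ Q

-- For `j = k − 1` this is an arc of the Johnson graph, from `A ∪ x` to `A ∪ y`.
IsFlag : ∀ {n} → ℕ → Subset n → Fin n → Fin n → Set
IsFlag j A x y = ∣ A ∣ ≡ j × A ∌ x × A ∌ y × x ≢ y

FlagTransitive : ∀ {n} → (Permutation′ n → Set) → ℕ → Set
FlagTransitive H j = ∀ A x y A′ x′ y′ → IsFlag j A x y → IsFlag j A′ x′ y′ →
  ∃ λ σ → H σ × permute σ A ≡ A′ × σ ⟨$⟩ʳ x ≡ x′ × σ ⟨$⟩ʳ y ≡ y′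

doubleton : ∀ {n} → Fin n → Fin n → Subset n
doubleton {n} x y = ins (ins (∅ n) x) y

∣doubleton∣ : ∀ {n} {x y : Fin n} → x ≢ y → ∣ doubleton x y ∣ ≡ 2
∣doubleton∣ {n} {x} {y} x≢y = trans (∣ins∣ (ins (∅ n) x) y (ins-∌ (∅ n) (x≢y ∘ sym) (∅-∌ y)))
  (cong suc (trans (∣ins∣ (∅ n) x (∅-∌ x)) (cong suc (∣∅∣ n))))

doubleton-Disjoint : ∀ {n} {x y : Fin n} {A} → A ∌ x → A ∌ y → Disjoint (doubleton x y) A
doubleton-Disjoint {n} {x} {y} Ax Ay i p with ins⁻ (ins (∅ n) x) y p
... | inj₁ refl = Ay
... | inj₂ p₁ with ins⁻ (∅ n) x p₁
... | inj₁ refl = Ax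
... | inj₂ p₂   = ⊥-elim (∋-∌ {A = ∅ n} p₂ (∅-∌ i))

doubleton-Disjoint⁻ : ∀ {n} {x y : Fin n} A → Disjoint (doubleton x y) A → A ∌ x × A ∌ y
doubleton-Disjoint⁻ {n} {x} {y} A dis with Disjoint-ins⁻ (ins (∅ n) x) A dis
... | dis₁ , Ay = proj₂ (Disjoint-ins⁻ (∅ n) A dis₁) , Ay

permute-∌ : ∀ {n} (σ : Permutation′ n) A {i j} → σ ⟨$⟩ʳ i ≡ j → A ∌ i → permute σ A ∌ j
permute-∌ σ A refl q = trans (lookup-permute σ A _) q

indicator : ∀ {Q : Set} → Q ⊎ ¬ Q → ℤ
indicator (inj₁ _) = 1ℤ
indicator (inj₂ _) = 0ℤ

indicator-cong : ∀ {P Q : Set} (p : P ⊎ ¬ P) (q : Q ⊎ ¬ Q) → (P → Q) → (Q → P) → indicator p ≡ indicator q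
indicator-cong (inj₁ _)  (inj₁ _)  f g = refl
indicator-cong (inj₁ p)  (inj₂ ¬q) f g = ⊥-elim (¬q (f p))
indicator-cong (inj₂ ¬p) (inj₁ q)  f g = ⊥-elim (¬p (g q))
indicator-cong (inj₂ _)  (inj₂ _)  f g = refl

module Flags {n} (lem : Classical) (H : Permutation′ n → Set) (grp : IsPermGroup H) where
  open IsPermGroup grp

  flag-of-size : ∀ j (x y : Fin n) → x ≢ y → 2 + j ≤ n → ∃ λ A → IsFlag j A x y
  flag-of-size j x y x≢y le with disjoint-of-size (doubleton x y) j (subst (λ d → d + j ≤ n) (sym (∣doubleton∣ x≢y)) le)
  ... | A , dis , ∣A∣ = A , ∣A∣ , proj₁ (doubleton-Disjoint⁻ A dis) , proj₂ (doubleton-Disjoint⁻ A dis) , x≢y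

  -- After aligning `x`, `y` with `x′`, `y′`, let `K` be the stabiliser of `x′` and `y′`. The
  -- indicator of the `K`-orbit of `permute σ A` is `K`-invariant, and so is its shadow. As `K` is
  -- transitive on the `(j+1)`-sets avoiding both points, the shadow is constant, and
  -- `shadow-injective` makes the indicator constant. Excluded middle turns the orbit into an
  -- integer-valued function.
  flag-descend : ∀ j → 2 + suc (j + j) ≤ n → FlagTransitive H (suc j) → FlagTransitive H j
  flag-descend j le ft A x y A′ x′ y′ (∣A∣ , Ax , Ay , x≢y) (∣A′∣ , A′x′ , A′y′ , x′≢y′)
    with flag-of-size (suc j) x y x≢y le′ | flag-of-size (suc j) x′ y′ x′≢y′ le′
    where
    le′ : 2 + suc j ≤ n
    le′ = ℕₚ.≤-trans (s≤s (s≤s (s≤s (ℕₚ.m≤m+n j j)))) le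
  ... | B , fB | B′ , fB′ with ft B x y B′ x′ y′ fB fB′
  ... | σ , Hσ , _ , σx , σy = conclude (lem (Orbit A′)) refl
    where
    A₀ : Subset n
    A₀ = permute σ A
    Orbit : Subset n → Set
    Orbit C = ∃ λ π → H π × π ⟨$⟩ʳ x′ ≡ x′ × π ⟨$⟩ʳ y′ ≡ y′ × permute π A₀ ≡ C
    g : Subset n → ℤ
    g C = indicator (lem (Orbit C))
    g-inv : ∀ π → H π → π ⟨$⟩ʳ x′ ≡ x′ → π ⟨$⟩ʳ y′ ≡ y′ → ∀ C → g (permute π C) ≡ g C
    g-inv π Hπ πx πy C = indicator-cong (lem (Orbit (permute π C))) (lem (Orbit C))
      (λ (ρ , Hρ , ρx , ρy , eq) → flip π ∙ ρ , ∙∈ (inv∈ Hπ) Hρ , trans (cong (π ⟨$⟩ˡ_) ρx) (inv-of π πx) ,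
        trans (cong (π ⟨$⟩ˡ_) ρy) (inv-of π πy) ,
        trans (permute-∙ (flip π) ρ A₀) (trans (cong (permute (flip π)) eq) (permute-flip π C)))
      (λ (ρ , Hρ , ρx , ρy , eq) → π ∙ ρ , ∙∈ Hπ Hρ , trans (cong (π ⟨$⟩ʳ_) ρx) πx ,
        trans (cong (π ⟨$⟩ʳ_) ρy) πy , trans (permute-∙ π ρ A₀) (cong (permute π) eq))
    constant : ∀ C C′ → ∣ C ∣ ≡ suc j → ∣ C′ ∣ ≡ suc j → Disjoint (doubleton x′ y′) C → Disjoint (doubleton x′ y′) C′ →
      shadow g C ≡ shadow g C′
    constant C C′ ∣C∣ ∣C′∣ dis dis′
      with ft C x′ y′ C′ x′ y′ (∣C∣ , proj₁ (doubleton-Disjoint⁻ C dis) , proj₂ (doubleton-Disjoint⁻ C dis) , x′≢y′)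
                               (∣C′∣ , proj₁ (doubleton-Disjoint⁻ C′ dis′) , proj₂ (doubleton-Disjoint⁻ C′ dis′) , x′≢y′)
    ... | π , Hπ , eq , πx , πy = trans (sym (shadow-permute g π (g-inv π Hπ πx πy) C)) (cong (shadow g) eq)
    gA₀ : g A₀ ≡ g A′
    gA₀ = shadow-injective j (doubleton x′ y′) g (subst (λ d → d + suc (j + j) ≤ n) (sym (∣doubleton∣ x′≢y′)) le)
      constant A₀ A′ (trans (∣permute∣ σ A) ∣A∣) ∣A′∣
      (doubleton-Disjoint {A = A₀} (permute-∌ σ A σx Ax) (permute-∌ σ A σy Ay)) (doubleton-Disjoint {A = A′} A′x′ A′y′)
    g≡1 : g A₀ ≡ 1ℤ
    g≡1 with lem (Orbit A₀)
    ... | inj₁ _  = refl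
    ... | inj₂ ¬o = ⊥-elim (¬o (idₚ , id∈ , refl , refl , permute-id A₀))
    conclude : (d : Orbit A′ ⊎ ¬ Orbit A′) → lem (Orbit A′) ≡ d →
      ∃ λ π → H π × permute π A ≡ A′ × π ⟨$⟩ʳ x ≡ x′ × π ⟨$⟩ʳ y ≡ y′
    conclude (inj₁ (π , Hπ , πx , πy , eq)) _ =
      π ∙ σ , ∙∈ Hπ Hσ , trans (permute-∙ π σ A) eq , trans (cong (π ⟨$⟩ʳ_) σx) πx , trans (cong (π ⟨$⟩ʳ_) σy) πy
    conclude (inj₂ ¬o) eq with () ← trans (sym g≡1) (trans gA₀ (cong indicator eq))

  flags-below : ∀ j m → 2 + (j + j) ≤ n → m ≤ j → FlagTransitive H j → FlagTransitive H m
  flags-below j m le m≤j ft with ℕₚ.m≤n⇒m<n∨m≡n m≤j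
  ... | inj₂ refl = ft
  flags-below (suc j) m le _ ft | inj₁ (s≤s m≤j) = flags-below j m
    (ℕₚ.≤-trans (s≤s (s≤s (ℕₚ.+-mono-≤ (ℕₚ.n≤1+n j) (ℕₚ.n≤1+n j)))) le) m≤j
    (flag-descend j (ℕₚ.≤-trans (s≤s (s≤s (s≤s (ℕₚ.+-monoʳ-≤ j (ℕₚ.n≤1+n j))))) le) ft)

-- Bases and three-cycles

least : Classical → (P : ℕ → Set) → ∀ m → P m → ∃ λ d → P d × (∀ j → j < d → ¬ P j)
least lem P m Pm = go m m ℕₚ.≤-refl Pm
  where
  go : ∀ fuel m → m ≤ fuel → P m → ∃ λ d → P d × (∀ j → j < d → ¬ P j)
  go fuel m le Pm with lem (∃ λ j → j < m × P j)
  ... | inj₂ none = m , Pm , λ j lt Pj → none (j , lt , Pj)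
  go zero .zero z≤n Pm | inj₁ (j , () , _)
  go (suc fuel) m le Pm | inj₁ (j , lt , Pj) = go fuel j (ℕₚ.≤-pred (ℕₚ.≤-trans lt le)) Pj

surjective : ∀ {n} (f : Fin n → Fin n) → (∀ {i j} → f i ≡ f j → i ≡ j) → ∀ y → ∃ λ x → f x ≡ y
surjective {suc n} f inj y with anyFin? (λ x → f x ≟ y)
... | yes r = r
... | no none = ⊥-elim (<⇒notInjective {f = λ x → punchOut (λ eq → none (x , sym eq))} (ℕₚ.n<1+n n)
  (λ {i} {j} eq → inj (punchOut-injective (λ e → none (i , sym e)) (λ e → none (j , sym e)) eq)))

∁-∋⁻ : ∀ {n} (A : Subset n) {i} → ∁ A ∋ i → A ∌ i
∁-∋⁻ A {i} q with lookup A i in eq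
... | false = refl
... | true with () ← trans (sym q) (trans (lookup-map i not A) (cong not eq))

∁-∋ : ∀ {n} (A : Subset n) {i} → A ∌ i → ∁ A ∋ i
∁-∋ A {i} q = trans (lookup-map i not A) (cong not q)

∣A∣+∣∁A∣ : ∀ {n} (A : Subset n) → ∣ A ∣ + ∣ ∁ A ∣ ≡ n
∣A∣+∣∁A∣ []          = refl
∣A∣+∣∁A∣ (true ∷ A)  = cong suc (∣A∣+∣∁A∣ A)
∣A∣+∣∁A∣ (false ∷ A) = trans (ℕₚ.+-suc (∣ A ∣) (∣ ∁ A ∣)) (cong suc (∣A∣+∣∁A∣ A))

Fixes : ∀ {n} → Permutation′ n → Subset n → Set
Fixes σ A = ∀ i → A ∋ i → σ ⟨$⟩ʳ i ≡ i

Fixes-∌ : ∀ {n} (σ : Permutation′ n) A → Fixes σ A → ∀ {i} → A ∌ i → A ∌ σ ⟨$⟩ʳ i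
Fixes-∌ σ A fix {i} q with ∋⊎∌ A (σ ⟨$⟩ʳ i)
... | inj₁ p = ⊥-elim (∋-∌ {A = A} p (subst (A ∌_) (sym (perm-inj σ (fix _ p))) q))
... | inj₂ r = r

record ThreeCycle {n} (σ : Permutation′ n) (p q r : Fin n) : Set where
  constructor cycle
  field
    p≢q : p ≢ q
    q≢r : q ≢ r
    p≢r : p ≢ r
    p↦q : σ ⟨$⟩ʳ p ≡ q
    q↦r : σ ⟨$⟩ʳ q ≡ r
    r↦p : σ ⟨$⟩ʳ r ≡ p
    off : ∀ i → i ≢ p → i ≢ q → i ≢ r → σ ⟨$⟩ʳ i ≡ i

-- The supports of `h` and `g` meet in `δ` alone. Each of the two therefore fixes the images and
-- preimages of `δ` under the other, and away from the three points of the cycle they commute.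
commutator-cycle : ∀ {n} (h g : Permutation′ n) δ → h ⟨$⟩ʳ δ ≢ δ → g ⟨$⟩ʳ δ ≢ δ →
  (∀ i → i ≢ δ → h ⟨$⟩ʳ i ≡ i ⊎ g ⟨$⟩ʳ i ≡ i) →
  ThreeCycle (h ∙ g ∙ flip h ∙ flip g) (g ⟨$⟩ʳ δ) δ (h ⟨$⟩ʳ δ)
commutator-cycle {n} h g δ hδ gδ disjoint = cycle gδ (hδ ∘ sym) a≢b ca cδ cb coff
  where
  a b e f : Fin n
  a = g ⟨$⟩ʳ δ
  b = h ⟨$⟩ʳ δ
  e = h ⟨$⟩ˡ δ
  f = g ⟨$⟩ˡ δ
  g-moves : ∀ i → i ≢ δ → g ⟨$⟩ʳ i ≢ i → h ⟨$⟩ʳ i ≡ i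
  g-moves i i≢δ m with disjoint i i≢δ
  ... | inj₁ eq = eq
  ... | inj₂ eq = ⊥-elim (m eq)
  h-moves : ∀ i → i ≢ δ → h ⟨$⟩ʳ i ≢ i → g ⟨$⟩ʳ i ≡ i
  h-moves i i≢δ m with disjoint i i≢δ
  ... | inj₁ eq = ⊥-elim (m eq)
  ... | inj₂ eq = eq
  ha : h ⟨$⟩ʳ a ≡ a
  ha = g-moves a gδ (λ eq → gδ (perm-inj g eq))
  gb : g ⟨$⟩ʳ b ≡ b
  gb = h-moves b hδ (λ eq → hδ (perm-inj h eq))
  a≢b : a ≢ b
  a≢b eq = gδ (perm-inj h (trans ha eq))
  e≢δ : e ≢ δ
  e≢δ eq = hδ (trans (cong (h ⟨$⟩ʳ_) (sym eq)) (inverseʳ h))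
  f≢δ : f ≢ δ
  f≢δ eq = gδ (trans (cong (g ⟨$⟩ʳ_) (sym eq)) (inverseʳ g))
  ge : g ⟨$⟩ʳ e ≡ e
  ge = h-moves e e≢δ (λ eq → e≢δ (trans (sym eq) (inverseʳ h)))
  hf : h ⟨$⟩ʳ f ≡ f
  hf = g-moves f f≢δ (λ eq → f≢δ (trans (sym eq) (inverseʳ g)))
  c : Fin n → Fin n
  c i = h ⟨$⟩ʳ (g ⟨$⟩ʳ (h ⟨$⟩ˡ (g ⟨$⟩ˡ i)))
  step : ∀ {i j l m o} → g ⟨$⟩ˡ i ≡ j → h ⟨$⟩ˡ j ≡ l → g ⟨$⟩ʳ l ≡ m → h ⟨$⟩ʳ m ≡ o → c i ≡ o
  step refl refl refl eq = eq
  ca : c a ≡ δ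
  ca = step (inverseˡ g) refl ge (inverseʳ h)
  cδ : c δ ≡ b
  cδ = step refl (inv-of h hf) (inverseʳ g) refl
  cb : c b ≡ a
  cb = step (inv-of g gb) (inverseˡ h) refl ha
  coff : ∀ i → i ≢ a → i ≢ δ → i ≢ b → c i ≡ i
  coff i i≢a i≢δ i≢b with g ⟨$⟩ʳ i ≟ i
  ... | no gi≢i = step refl (inv-of h (g-moves (g ⟨$⟩ˡ i) i′≢δ i′-moved)) (inverseʳ g) (g-moves i i≢δ gi≢i)
    where
    i′≢δ : g ⟨$⟩ˡ i ≢ δ
    i′≢δ eq = i≢a (trans (sym (inverseʳ g)) (cong (g ⟨$⟩ʳ_) eq))
    i′-moved : g ⟨$⟩ʳ (g ⟨$⟩ˡ i) ≢ g ⟨$⟩ˡ i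
    i′-moved eq = gi≢i (trans (cong (g ⟨$⟩ʳ_) (trans (sym (inverseʳ g)) eq)) (inverseʳ g))
  ... | yes gi≡i with h ⟨$⟩ʳ i ≟ i
  ... | yes hi≡i = step (inv-of g gi≡i) (inv-of h hi≡i) gi≡i hi≡i
  ... | no hi≢i  = step (inv-of g gi≡i) refl (h-moves (h ⟨$⟩ˡ i) j≢δ j-moved) (inverseʳ h)
    where
    j≢δ : h ⟨$⟩ˡ i ≢ δ
    j≢δ eq = i≢b (trans (sym (inverseʳ h)) (cong (h ⟨$⟩ʳ_) eq))
    j-moved : h ⟨$⟩ʳ (h ⟨$⟩ˡ i) ≢ h ⟨$⟩ˡ i
    j-moved eq = hi≢i (trans (cong (h ⟨$⟩ʳ_) (trans (sym (inverseʳ h)) eq)) (inverseʳ h))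

permute-∋ : ∀ {n} (σ : Permutation′ n) {A B : Subset n} {i} → permute σ A ≡ B → A ∋ i → B ∋ σ ⟨$⟩ʳ i
permute-∋ σ {A} refl p = trans (lookup-permute σ A _) p

doubleton⁻ : ∀ {n} (x y : Fin n) {i} → doubleton x y ∋ i → i ≡ x ⊎ i ≡ y
doubleton⁻ {n} x y {i} p with ins⁻ (ins (∅ n) x) y p
... | inj₁ eq = inj₂ eq
... | inj₂ p₁ with ins⁻ (∅ n) x p₁
... | inj₁ eq = inj₁ eq
... | inj₂ p₂ = ⊥-elim (∋-∌ {A = ∅ n} p₂ (∅-∌ i))

doubleton-left : ∀ {n} (x y : Fin n) → doubleton x y ∋ x
doubleton-left {n} x y = ins-⊒ (ins (∅ n) x) y (ins-self (∅ n) x)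

doubleton-right : ∀ {n} (x y : Fin n) → doubleton x y ∋ y
doubleton-right {n} x y = ins-self (ins (∅ n) x) y

doubleton-∌ : ∀ {n} {x y i : Fin n} → i ≢ x → i ≢ y → doubleton x y ∌ i
doubleton-∌ {n} {x} {y} {i} i≢x i≢y = ins-∌ (ins (∅ n) x) i≢y (ins-∌ (∅ n) i≢x (∅-∌ i))

singleton-image : ∀ {n} (σ : Permutation′ n) {p p′} → permute σ (ins (∅ n) p) ≡ ins (∅ n) p′ → σ ⟨$⟩ʳ p ≡ p′
singleton-image {n} σ {p} {p′} eq with ins⁻ (∅ n) p′ (permute-∋ σ {ins (∅ n) p} eq (ins-self (∅ n) p))
... | inj₁ e = e
... | inj₂ m = ⊥-elim (∋-∌ {A = ∅ n} m (∅-∌ (σ ⟨$⟩ʳ p)))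

four-points : ∀ {n} → 4 ≤ n → ∃ λ (p : Fin n) → ∃ λ q → ∃ λ r → ∃ λ s →
  p ≢ q × p ≢ r × q ≢ r × p ≢ s × q ≢ s × r ≢ s
four-points (s≤s (s≤s (s≤s (s≤s _)))) = zero , suc zero , suc (suc zero) , suc (suc (suc zero)) ,
  (λ ()) , (λ ()) , (λ ()) , (λ ()) , (λ ()) , (λ ())

module Bases (k : ℕ) (2≤k : 2 ≤ k) (lem : Classical) (H : Permutation′ (k + k) → Set) (grp : IsPermGroup H)
             (flags : ∀ j → j < k → FlagTransitive H j) where
  open IsPermGroup grp

  n : ℕ
  n = k + k

  k≤n : k ≤ n
  k≤n = ℕₚ.m≤m+n k k

  2+k≤n : 2 + k ≤ n
  2+k≤n = ℕₚ.+-monoˡ-≤ k 2≤k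

  -- A flag whose set is a singleton is an ordered triple.
  3-transitive : ∀ p q r p′ q′ r′ → p ≢ q → p ≢ r → q ≢ r → p′ ≢ q′ → p′ ≢ r′ → q′ ≢ r′ →
    ∃ λ σ → H σ × σ ⟨$⟩ʳ p ≡ p′ × σ ⟨$⟩ʳ q ≡ q′ × σ ⟨$⟩ʳ r ≡ r′
  3-transitive p q r p′ q′ r′ p≢q p≢r q≢r p′≢q′ p′≢r′ q′≢r′
    with flags 1 2≤k (ins (∅ n) p) q r (ins (∅ n) p′) q′ r′ (flag p q r p≢q p≢r q≢r) (flag p′ q′ r′ p′≢q′ p′≢r′ q′≢r′)
    where
    flag : ∀ p q r → p ≢ q → p ≢ r → q ≢ r → IsFlag 1 (ins (∅ n) p) q r
    flag p q r p≢q p≢r q≢r = trans (∣ins∣ (∅ n) p (∅-∌ p)) (cong suc (∣∅∣ n)) ,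
      ins-∌ (∅ n) (p≢q ∘ sym) (∅-∌ q) , ins-∌ (∅ n) (p≢r ∘ sym) (∅-∌ r) , q≢r
  ... | σ , Hσ , eq , σq , σr = σ , Hσ , singleton-image σ eq , σq , σr

  -- One point of the set is removed and becomes the first marked point of a flag; the second is any
  -- point outside the set, which exists because `j ≤ k < n`.
  homogeneous : ∀ j → j ≤ k → ∀ A B → ∣ A ∣ ≡ j → ∣ B ∣ ≡ j → ∃ λ σ → H σ × permute σ A ≡ B
  homogeneous zero _ A B ∣A∣ ∣B∣ = idₚ , id∈ , trans (permute-id A)
    (lookup-ext λ i → trans (∣∣≡0 {A = A} ∣A∣ i) (sym (∣∣≡0 {A = B} ∣B∣ i)))
  homogeneous (suc j) j<k A B ∣A∣ ∣B∣
    with member A (subst (0 <_) (sym ∣A∣) (s≤s z≤n)) | member B (subst (0 <_) (sym ∣B∣) (s≤s z≤n))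
       | fresh A (room A ∣A∣) | fresh B (room B ∣B∣)
    where
    room : ∀ A → ∣ A ∣ ≡ suc j → ∣ A ∣ < n
    room A eq = subst (_< n) (sym eq) (ℕₚ.≤-trans (s≤s j<k) (ℕₚ.≤-trans (ℕₚ.n≤1+n (suc k)) 2+k≤n))
  ... | a , Aa | b , Bb | x , Ax | y , By
    with flags j j<k (del A a) a x (del B b) b y
      (ℕₚ.suc-injective (trans (sym (∣del∣ A a Aa)) ∣A∣) , del-self A a , del-∌ A a Ax , ∋∌⇒≢ {A = A} Aa Ax)
      (ℕₚ.suc-injective (trans (sym (∣del∣ B b Bb)) ∣B∣) , del-self B b , del-∌ B b By , ∋∌⇒≢ {A = B} Bb By)
  ... | σ , Hσ , eq , σa , _ = σ , Hσ , trans (cong (permute σ) (sym (ins-del A Aa)))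
    (trans (permute-ins σ (del A a) a) (trans (cong₂ ins eq σa) (ins-del B Bb)))

  Base : Subset n → Set
  Base A = ∀ σ → H σ → Fixes σ A → σ ≈ idₚ

  nonbase : ∀ A → ¬ Base A → ∃ λ σ → H σ × Fixes σ A × ∃ λ i → σ ⟨$⟩ʳ i ≢ i
  nonbase A ¬b with lem (∃ λ σ → H σ × Fixes σ A × ∃ λ i → σ ⟨$⟩ʳ i ≢ i)
  ... | inj₁ r = r
  ... | inj₂ none = ⊥-elim (¬b λ σ Hσ fix i → stable σ Hσ fix i)
    where
    stable : ∀ σ → H σ → Fixes σ A → ∀ i → σ ⟨$⟩ʳ i ≡ i
    stable σ Hσ fix i with σ ⟨$⟩ʳ i ≟ i
    ... | yes eq = eq
    ... | no neq = ⊥-elim (none (σ , Hσ , fix , i , neq))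

  base-permute : ∀ σ → H σ → ∀ A → Base A → Base (permute σ A)
  base-permute σ Hσ A b π Hπ fix i = trans (cong (π ⟨$⟩ʳ_) (sym (inverseʳ σ)))
    (trans (trans (sym (inverseʳ σ)) (cong (σ ⟨$⟩ʳ_) (b (flip σ ∙ π ∙ σ) (∙∈ (inv∈ Hσ) (∙∈ Hπ Hσ)) fix′ (σ ⟨$⟩ˡ i)))) (inverseʳ σ))
    where
    fix′ : Fixes (flip σ ∙ π ∙ σ) A
    fix′ j Aj = inv-of σ (sym (fix (σ ⟨$⟩ʳ j) (trans (lookup-permute σ A j) Aj)))

  base-⊑ : ∀ A B → A ⊑ B → Base A → Base B
  base-⊑ A B s b σ Hσ fix = b σ Hσ (λ i p → fix i (s p))

  BaseOfSize : ℕ → Set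
  BaseOfSize j = ∃ λ A → ∣ A ∣ ≡ j × Base A

  HasThreeCycle : Set
  HasThreeCycle = ∃ λ σ → H σ × ∃ λ p → ∃ λ q → ∃ λ r → ThreeCycle σ p q r

  -- Bochert: elements supported in Δ and in (X ∖ Δ) ∪ {δ} share only the moved point δ, so their commutator is a 3-cycle.
  large-base⇒three-cycle : ∀ d → BaseOfSize d → (∀ j → j < d → ¬ BaseOfSize j) → k < d → HasThreeCycle
  large-base⇒three-cycle d (Δ , ∣Δ∣ , base) minimal k<d
    with nonbase (∁ Δ) (λ b → minimal ∣ ∁ Δ ∣ small (∁ Δ , refl , b))
    where
    small : ∣ ∁ Δ ∣ < d
    small = ℕₚ.≤-<-trans (ℕₚ.≤-trans (ℕₚ.≤-reflexive (trans (∣∁p∣≡n∸∣p∣ Δ) (cong (n ∸_) ∣Δ∣)))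
      (ℕₚ.≤-trans (ℕₚ.∸-monoʳ-≤ n (ℕₚ.<⇒≤ k<d)) (ℕₚ.≤-reflexive (ℕₚ.m+n∸n≡m k k)))) k<d
  ... | h , Hh , hfix , δ , hδ with nonbase (del Δ δ) (λ b → minimal ∣ del Δ δ ∣ smaller (del Δ δ , refl , b))
    where
    Δδ : Δ ∋ δ
    Δδ with ∋⊎∌ Δ δ
    ... | inj₁ p = p
    ... | inj₂ q = ⊥-elim (hδ (hfix δ (∁-∋ Δ q)))
    smaller : ∣ del Δ δ ∣ < d
    smaller = ℕₚ.≤-reflexive (trans (sym (∣del∣ Δ δ Δδ)) ∣Δ∣)
  ... | g , Hg , gfix , m , gm =
    h ∙ g ∙ flip h ∙ flip g , ∙∈ Hh (∙∈ Hg (∙∈ (inv∈ Hh) (inv∈ Hg))) , _ , _ , _ ,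
    commutator-cycle h g δ hδ gδ disjoint
    where
    -- Otherwise `g` would fix the whole base `Δ` and be the identity.
    gδ : g ⟨$⟩ʳ δ ≢ δ
    gδ eq = gm (base g Hg fix m)
      where
      fix : Fixes g Δ
      fix i p with i ≟ δ
      ... | yes refl = eq
      ... | no i≢δ   = gfix i (del-∋ Δ i≢δ p)
    disjoint : ∀ i → i ≢ δ → h ⟨$⟩ʳ i ≡ i ⊎ g ⟨$⟩ʳ i ≡ i
    disjoint i i≢δ with ∋⊎∌ Δ i
    ... | inj₁ p = inj₂ (gfix i (del-∋ Δ i≢δ p))
    ... | inj₂ q = inj₁ (hfix i (∁-∋ Δ q))

  module SmallBase (d : ℕ) (d≤k : d ≤ k) (base-d : BaseOfSize d) (minimal : ∀ j → j < d → ¬ BaseOfSize j) where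

    -- As `d ≤ k`, `H` is transitive on `d`-sets, and it carries bases to bases. One base of size
    -- `d` thus makes every `d`-set a base.
    base≥ : ∀ A → d ≤ ∣ A ∣ → Base A
    base≥ A le with subset-of-size A d le
    ... | B , B⊑A , ∣B∣ with homogeneous d d≤k (proj₁ base-d) B (proj₁ (proj₂ base-d)) ∣B∣
    ... | σ , Hσ , eq = base-⊑ B A B⊑A (subst Base eq (base-permute σ Hσ (proj₁ base-d) (proj₂ (proj₂ base-d))))

    agree : ∀ A → d ≤ ∣ A ∣ → ∀ σ π → H σ → H π → (∀ i → A ∋ i → σ ⟨$⟩ʳ i ≡ π ⟨$⟩ʳ i) → σ ≈ π
    agree A le σ π Hσ Hπ eq i = trans (sym (inverseʳ π)) (cong (π ⟨$⟩ʳ_)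
      (base≥ A le (flip π ∙ σ) (∙∈ (inv∈ Hπ) Hσ) (λ j p → inv-of π (sym (eq j p))) i))

    -- By 3-transitivity some element fixes two points and moves a third, so two points never form a
    -- base.
    3≤d : 3 ≤ d
    3≤d with ℕₚ.<-≤-connex d 3
    ... | inj₂ le = le
    ... | inj₁ (s≤s d≤2) = ⊥-elim (small d≤2 (four-points (ℕₚ.≤-trans (s≤s (s≤s 2≤k)) 2+k≤n)))
      where
      small : d ≤ 2 → (∃ λ (p : Fin n) → ∃ λ q → ∃ λ r → ∃ λ s → p ≢ q × p ≢ r × q ≢ r × p ≢ s × q ≢ s × r ≢ s) → ⊥
      small d≤2 (p , q , r , s , p≢q , p≢r , q≢r , p≢s , q≢s , r≢s)
        with 3-transitive p q r p q s p≢q p≢r q≢r p≢q p≢s q≢s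
      ... | σ , Hσ , σp , σq , σr = r≢s (trans (sym (base≥ (doubleton p q)
        (subst (d ≤_) (sym (∣doubleton∣ p≢q)) d≤2) σ Hσ fix r)) σr)
        where
        fix : Fixes σ (doubleton p q)
        fix i m with doubleton⁻ p q m
        ... | inj₁ refl = σp
        ... | inj₂ refl = σq

    d∸1<k : ∀ {j} → suc j ≡ d → j < k
    d∸1<k refl = d≤k

    extend : ∀ fuel (F : Subset n) x y → F ∌ x → F ∌ y → ∣ F ∣ + fuel < k → ∃ λ A → F ⊑ A × A ∌ x × A ∌ y × ∣ A ∣ ≡ ∣ F ∣ + fuel
    extend zero F x y Fx Fy lt = F , (λ p → p) , Fx , Fy , sym (ℕₚ.+-identityʳ ∣ F ∣)
    extend (suc fuel) F x y Fx Fy lt with fresh (ins (ins F x) y) room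
      where
      room : ∣ ins (ins F x) y ∣ < n
      room = ℕₚ.≤-<-trans (∣ins∣≤ (ins F x) y) (ℕₚ.≤-<-trans (s≤s (∣ins∣≤ F x))
        (ℕₚ.≤-trans (s≤s (s≤s (ℕₚ.≤-<-trans (ℕₚ.m≤m+n ∣ F ∣ (suc fuel)) lt))) 2+k≤n))
    ... | z , z∌ with ins-∌⁻ (ins F x) z∌
    ... | z≢y , z∌′ with ins-∌⁻ F z∌′
    ... | z≢x , Fz with extend fuel (ins F z) x y (ins-∌ F (z≢x ∘ sym) Fx) (ins-∌ F (z≢y ∘ sym) Fy)
                          (subst (_< k) (trans (ℕₚ.+-suc ∣ F ∣ fuel) (cong (_+ fuel) (sym (∣ins∣ F z Fz)))) lt)
    ... | A , s , Ax , Ay , eq = A , (λ {i} p → s {i} (ins-⊒ F z p)) , Ax , Ay ,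
      trans eq (trans (cong (_+ fuel) (∣ins∣ F z Fz)) (sym (ℕₚ.+-suc ∣ F ∣ fuel)))

    -- The set `A` is one point short of `d`, so some `g` fixes it pointwise and moves a point `v`.
    -- Conjugate by an element taking the flag `(A, v, g v)` to `(A, x, y)`: it preserves `A` only
    -- as a set, but the conjugate still fixes `A` pointwise.
    move-exact : ∀ A x y → suc ∣ A ∣ ≡ d → A ∌ x → A ∌ y → x ≢ y → ∃ λ σ → H σ × Fixes σ A × σ ⟨$⟩ʳ x ≡ y
    move-exact A x y eq Ax Ay x≢y
      with nonbase A (λ b → minimal ∣ A ∣ (ℕₚ.≤-reflexive eq) (A , refl , b))
    ... | g , Hg , fix , v , gv
      with flags ∣ A ∣ (d∸1<k eq) A v (g ⟨$⟩ʳ v) A x y (refl , Av , Agv , gv ∘ sym) (refl , Ax , Ay , x≢y)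
      where
      Av : A ∌ v
      Av with ∋⊎∌ A v
      ... | inj₁ p = ⊥-elim (gv (fix v p))
      ... | inj₂ q = q
      Agv : A ∌ g ⟨$⟩ʳ v
      Agv with ∋⊎∌ A (g ⟨$⟩ʳ v)
      ... | inj₁ p = ⊥-elim (gv (perm-inj g (fix (g ⟨$⟩ʳ v) p)))
      ... | inj₂ q = q
    ... | h , Hh , hA , hv , hgv = h ∙ g ∙ flip h , ∙∈ Hh (∙∈ Hg (inv∈ Hh)) , fix′ ,
      trans (cong (λ z → h ⟨$⟩ʳ (g ⟨$⟩ʳ z)) (inv-of h hv)) hgv
      where
      fix′ : Fixes (h ∙ g ∙ flip h) A
      fix′ i p = trans (cong (h ⟨$⟩ʳ_) (fix (h ⟨$⟩ˡ i) (trans (sym (lookup-permute h A (h ⟨$⟩ˡ i)))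
        (trans (cong (lookup (permute h A)) (inverseʳ h)) (trans (cong (λ B → lookup B i) hA) p))))) (inverseʳ h)

    -- Enlarging `F` to `d − 1` points while avoiding `x` and `y` reduces to `move-exact`.
    move : ∀ F x y → ∣ F ∣ < d → F ∌ x → F ∌ y → ∃ λ σ → H σ × Fixes σ F × σ ⟨$⟩ʳ x ≡ y
    move F x y lt Fx Fy with x ≟ y
    ... | yes x≡y = idₚ , id∈ , (λ _ _ → refl) , x≡y
    ... | no x≢y = widen (extend (d ∸ suc ∣ F ∣) F x y Fx Fy (subst (_≤ k) (sym size) d≤k))
      where
      size : suc ∣ F ∣ + (d ∸ suc ∣ F ∣) ≡ d
      size = ℕₚ.m+[n∸m]≡n {suc ∣ F ∣} {d} lt
      widen : (∃ λ A → F ⊑ A × A ∌ x × A ∌ y × ∣ A ∣ ≡ ∣ F ∣ + (d ∸ suc ∣ F ∣)) → ∃ λ σ → H σ × Fixes σ F × σ ⟨$⟩ʳ x ≡ y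
      widen (A , s , Ax , Ay , eq) =
        let σ , Hσ , fix , σx = move-exact A x y (trans (cong suc eq) size) Ax Ay x≢y in
        σ , Hσ , (λ i p → fix i (s {i} p)) , σx

    -- Both `F` and `F ∪ t` have fewer than `d` points. So `s` can first be sent to `t`, and then,
    -- with `t` held fixed, the image of `t` can be brought to `s`.
    swap : ∀ F s t → suc ∣ F ∣ < d → F ∌ s → F ∌ t → s ≢ t →
      ∃ λ σ → H σ × Fixes σ F × σ ⟨$⟩ʳ s ≡ t × σ ⟨$⟩ʳ t ≡ s
    swap F s t lt Fs Ft s≢t =
      let g , Hg , gF , gs = move F s t (ℕₚ.<⇒≤ lt) Fs Ft
          gt≢t : g ⟨$⟩ʳ t ≢ t
          gt≢t = λ eq → s≢t (perm-inj g (trans gs (sym eq)))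
          h , Hh , hF , hgt = move (ins F t) (g ⟨$⟩ʳ t) s (subst (_< d) (sym (∣ins∣ F t Ft)) lt)
                                (ins-∌ F gt≢t (Fixes-∌ g F gF Ft)) (ins-∌ F s≢t Fs)
      in h ∙ g , ∙∈ Hh Hg ,
         (λ i p → trans (cong (h ⟨$⟩ʳ_) (gF i p)) (hF i (ins-⊒ F t p))) ,
         trans (cong (h ⟨$⟩ʳ_) gs) (hF t (ins-self F t)) , hgt

-- Groups with a minimal base of three points

module ThreePointBase (k : ℕ) (2≤k : 2 ≤ k) (lem : Classical) (H : Permutation′ (k + k) → Set) (grp : IsPermGroup H)
    (flags : ∀ j → j < k → FlagTransitive H j) where
  open Bases k 2≤k lem H grp flags
  open IsPermGroup grp

  module _ (3≤k : 3 ≤ k) (base-3 : BaseOfSize 3) (minimal : ∀ j → j < 3 → ¬ BaseOfSize j) where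
    open SmallBase 3 3≤k base-3 minimal

    -- Each of the two flag maps leaves one ambiguity. On the three points the first is the rotation
    -- or the exchange of `x` and `z`; the second is the inverse rotation or the exchange of `y` and
    -- `z`. If both are exchanges, their product is the rotation. All of them fix `w`.
    rotation-fixing : ∀ x y z w → x ≢ y → y ≢ z → x ≢ z → w ≢ x → w ≢ y → w ≢ z →
      ∃ λ σ → H σ × σ ⟨$⟩ʳ x ≡ y × σ ⟨$⟩ʳ y ≡ z × σ ⟨$⟩ʳ z ≡ x × σ ⟨$⟩ʳ w ≡ w
    rotation-fixing x y z w x≢y y≢z x≢z w≢x w≢y w≢z = first
        (flags 2 3≤k (doubleton x y) z w (doubleton y z) x w flag (∣doubleton∣ y≢z , doubleton-∌ x≢y x≢z , doubleton-∌ w≢y w≢z , w≢x ∘ sym))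
        (flags 2 3≤k (doubleton x y) z w (doubleton x z) y w flag (∣doubleton∣ x≢z , doubleton-∌ (x≢y ∘ sym) y≢z , doubleton-∌ w≢x w≢z , w≢y ∘ sym))
      where
      Goal : Set
      Goal = ∃ λ σ → H σ × σ ⟨$⟩ʳ x ≡ y × σ ⟨$⟩ʳ y ≡ z × σ ⟨$⟩ʳ z ≡ x × σ ⟨$⟩ʳ w ≡ w
      flag : IsFlag 2 (doubleton x y) z w
      flag = ∣doubleton∣ x≢y , doubleton-∌ (x≢z ∘ sym) (y≢z ∘ sym) , doubleton-∌ w≢x w≢y , w≢z ∘ sym
      image : ∀ σ {a b} i → permute σ (doubleton x y) ≡ doubleton a b → doubleton x y ∋ i → σ ⟨$⟩ʳ i ≡ a ⊎ σ ⟨$⟩ʳ i ≡ b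
      image σ {a} {b} i eq p = doubleton⁻ a b (permute-∋ σ {doubleton x y} eq p)
      clash : ∀ (σ : Permutation′ (k + k)) {c} → σ ⟨$⟩ʳ x ≡ c → σ ⟨$⟩ʳ y ≡ c → ⊥
      clash σ p q = x≢y (perm-inj σ (trans p (sym q)))
      first : (∃ λ σ → H σ × permute σ (doubleton x y) ≡ doubleton y z × σ ⟨$⟩ʳ z ≡ x × σ ⟨$⟩ʳ w ≡ w) →
              (∃ λ σ → H σ × permute σ (doubleton x y) ≡ doubleton x z × σ ⟨$⟩ʳ z ≡ y × σ ⟨$⟩ʳ w ≡ w) → Goal
      first (σ , Hσ , σA , σz , σw) (π , Hπ , πA , πz , πw)
        with image σ x σA (doubleton-left x y) | image σ y σA (doubleton-right x y)
           | image π x πA (doubleton-left x y) | image π y πA (doubleton-right x y)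
      ... | inj₁ xy | inj₁ yy | _ | _ = ⊥-elim (clash σ xy yy)
      ... | inj₂ xz | inj₂ yz | _ | _ = ⊥-elim (clash σ xz yz)
      ... | inj₁ xy | inj₂ yz | _ | _ = σ , Hσ , xy , yz , σz , σw
      ... | inj₂ xz | inj₁ yy | inj₁ xx | inj₁ yx = ⊥-elim (clash π xx yx)
      ... | inj₂ xz | inj₁ yy | inj₂ xz′ | inj₂ yz = ⊥-elim (clash π xz′ yz)
      ... | inj₂ xz | inj₁ yy | inj₂ xz′ | inj₁ yx = flip π , inv∈ Hπ , inv-of π yx , inv-of π πz , inv-of π xz′ , inv-of π πw
      ... | inj₂ xz | inj₁ yy | inj₁ xx | inj₂ yz =
        π ∙ σ , ∙∈ Hπ Hσ , trans (cong (π ⟨$⟩ʳ_) xz) πz , trans (cong (π ⟨$⟩ʳ_) yy) yz ,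
        trans (cong (π ⟨$⟩ʳ_) σz) xx , trans (cong (π ⟨$⟩ʳ_) σw) πw

    -- The rotation of x, y, z is determined by its action on these three points, so it fixes every w.
    three-cycle : HasThreeCycle
    three-cycle = build (four-points (ℕₚ.≤-trans (s≤s (s≤s 2≤k)) 2+k≤n))
      where
      build : (∃ λ (p : Fin n) → ∃ λ q → ∃ λ r → ∃ λ s → p ≢ q × p ≢ r × q ≢ r × p ≢ s × q ≢ s × r ≢ s) → HasThreeCycle
      build (x , y , z , s , x≢y , x≢z , y≢z , x≢s , y≢s , z≢s) =
        let σ , Hσ , σx , σy , σz , _ = rotation-fixing x y z s x≢y y≢z x≢z (x≢s ∘ sym) (y≢s ∘ sym) (z≢s ∘ sym) in
        σ , Hσ , x , y , z , cycle x≢y y≢z x≢z σx σy σz λ w w≢x w≢y w≢z →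
        let π , Hπ , πx , πy , πz , πw = rotation-fixing x y z w x≢y y≢z x≢z w≢x w≢y w≢z in
        trans (agree (ins (doubleton x y) z) (ℕₚ.≤-reflexive (sym (trans (∣ins∣ (doubleton x y) z
            (doubleton-∌ (x≢z ∘ sym) (y≢z ∘ sym))) (cong suc (∣doubleton∣ x≢y)))))
          σ π Hσ Hπ (λ i p → on σ π σx σy σz πx πy πz (ins⁻ (doubleton x y) z p)) w) πw
        where
        on : ∀ (σ π : Permutation′ (k + k)) {i} → σ ⟨$⟩ʳ x ≡ y → σ ⟨$⟩ʳ y ≡ z → σ ⟨$⟩ʳ z ≡ x →
          π ⟨$⟩ʳ x ≡ y → π ⟨$⟩ʳ y ≡ z → π ⟨$⟩ʳ z ≡ x → i ≡ z ⊎ doubleton x y ∋ i → σ ⟨$⟩ʳ i ≡ π ⟨$⟩ʳ i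
        on σ π σx σy σz πx πy πz (inj₁ refl) = trans σz (sym πz)
        on σ π σx σy σz πx πy πz (inj₂ p) with doubleton⁻ x y p
        ... | inj₁ refl = trans σx (sym πx)
        ... | inj₂ refl = trans σy (sym πy)

-- Sharply d-transitive groups with d ≥ 4

branch : ∀ {A B C : Set} → A ⊎ B → C → C → C
branch (inj₁ _) c c′ = c
branch (inj₂ _) c c′ = c′

branch-left : ∀ {A B C : Set} (x : A ⊎ B) {c c′ : C} → ¬ B → branch x c c′ ≡ c
branch-left (inj₁ _) ¬b = refl
branch-left (inj₂ b) ¬b = ⊥-elim (¬b b)

branch-right : ∀ {A B C : Set} (x : A ⊎ B) {c c′ : C} → ¬ A → branch x c c′ ≡ c′
branch-right (inj₁ a) ¬a = ⊥-elim (¬a a)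
branch-right (inj₂ _) ¬a = refl

≢true : ∀ {b : Bool} → ¬ (b ≡ true) → b ≡ false
≢true {false} _ = refl
≢true {true} ¬p = ⊥-elim (¬p refl)

module LargerBase (k : ℕ) (2≤k : 2 ≤ k) (lem : Classical) (H : Permutation′ (k + k) → Set) (grp : IsPermGroup H)
    (flags : ∀ j → j < k → FlagTransitive H j) where
  open Bases k 2≤k lem H grp flags
  open IsPermGroup grp

  module _ (d : ℕ) (d≤k : d ≤ k) (base-d : BaseOfSize d) (minimal : ∀ j → j < d → ¬ BaseOfSize j) (4≤d : 4 ≤ d)
           (S : Subset n) (∣S∣ : suc ∣ S ∣ ≡ d) (v : Fin n) (Sv : S ∌ v) where
    open SmallBase d d≤k base-d minimal

    outside≥d : d ≤ ∣ ∁ S ∣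
    outside≥d = ℕₚ.+-cancelˡ-≤ (∣ S ∣) d (∣ ∁ S ∣) (ℕₚ.≤-trans
      (ℕₚ.+-mono-≤ (ℕₚ.≤-trans (ℕₚ.n≤1+n _) (ℕₚ.≤-trans (ℕₚ.≤-reflexive ∣S∣) d≤k)) d≤k) (ℕₚ.≤-reflexive (sym (∣A∣+∣∁A∣ S))))

    -- Q, the pointwise stabiliser of S, is regular on the complement of S.
    InQ : Permutation′ n → Set
    InQ σ = H σ × Fixes σ S

    Q-unique : ∀ σ π → InQ σ → InQ π → σ ⟨$⟩ʳ v ≡ π ⟨$⟩ʳ v → σ ≈ π
    Q-unique σ π (Hσ , fσ) (Hπ , fπ) eq = agree (ins S v) (ℕₚ.≤-reflexive (trans (sym ∣S∣) (sym (∣ins∣ S v Sv)))) σ π Hσ Hπ on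
      where
      on : ∀ i → ins S v ∋ i → σ ⟨$⟩ʳ i ≡ π ⟨$⟩ʳ i
      on i p with ins⁻ S v p
      ... | inj₁ refl = eq
      ... | inj₂ s    = trans (fσ i s) (sym (fπ i s))

    Q-∙ : ∀ {σ π} → InQ σ → InQ π → InQ (σ ∙ π)
    Q-∙ {σ} (Hσ , fσ) (Hπ , fπ) = ∙∈ Hσ Hπ , λ i s → trans (cong (σ ⟨$⟩ʳ_) (fπ i s)) (fσ i s)

    Q-inv : ∀ {σ} → InQ σ → InQ (flip σ)
    Q-inv {σ} (Hσ , fσ) = inv∈ Hσ , λ i s → inv-of σ (fσ i s)

    Q-id : InQ idₚ
    Q-id = id∈ , λ _ _ → refl

    translation : ∀ w → ∃ λ σ → InQ σ × (S ∌ w → σ ⟨$⟩ʳ v ≡ w)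
    translation w with ∋⊎∌ S w
    ... | inj₁ p = idₚ , Q-id , λ q → ⊥-elim (∋-∌ {A = S} p q)
    ... | inj₂ q =
      let σ , Hσ , fσ , σv = move S v w (ℕₚ.≤-reflexive ∣S∣) Sv q in σ , (Hσ , fσ) , λ _ → σv

    -- The elements of Q are labelled by the image of v.
    t : Fin n → Permutation′ n
    t w = proj₁ (translation w)

    t∈ : ∀ w → InQ (t w)
    t∈ w = proj₁ (proj₂ (translation w))

    tv : ∀ {w} → S ∌ w → t w ⟨$⟩ʳ v ≡ w
    tv {w} = proj₂ (proj₂ (translation w))

    Q-≈t : ∀ σ {w} → InQ σ → S ∌ w → σ ⟨$⟩ʳ v ≡ w → σ ≈ t w
    Q-≈t σ {w} q Sw eq = Q-unique σ (t w) q (t∈ w) (trans eq (sym (tv Sw)))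

    t-∌ : ∀ w {i} → S ∌ i → S ∌ t w ⟨$⟩ʳ i
    t-∌ w = Fixes-∌ (t w) S (proj₂ (t∈ w))

    t⁻-∌ : ∀ w {i} → S ∌ i → S ∌ t w ⟨$⟩ˡ i
    t⁻-∌ w = Fixes-∌ (flip (t w)) S (proj₂ (Q-inv (t∈ w)))

    tt≡v? : (∃ λ w → S ∌ w × w ≢ v × t w ⟨$⟩ʳ w ≡ v) ⊎ ¬ (∃ λ w → S ∌ w × w ≢ v × t w ⟨$⟩ʳ w ≡ v)
    tt≡v? = lem _

    -- Under the labelling of `Q` by points outside `S`, conjugation by `u` becomes the action of
    -- `u` on these points. The field `few` then says that at most one nontrivial element of `Q`
    -- commutes with `u`.
    record Swapper (u : Permutation′ n) : Set where
      field
        u∈   : H u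
        u-v  : u ⟨$⟩ʳ v ≡ v
        u-S  : ∀ {i} → S ∋ i → S ∋ u ⟨$⟩ʳ i
        uu   : ∀ i → u ⟨$⟩ʳ (u ⟨$⟩ʳ i) ≡ i
        few  : ∀ a b → S ∌ a → S ∌ b → a ≢ v → b ≢ v → u ⟨$⟩ʳ a ≡ a → u ⟨$⟩ʳ b ≡ b → a ≡ b

      u-∌ : ∀ {i} → S ∌ i → S ∌ u ⟨$⟩ʳ i
      u-∌ {i} q with ∋⊎∌ S (u ⟨$⟩ʳ i)
      ... | inj₁ p = ⊥-elim (∋-∌ {A = S} (subst (S ∋_) (uu i) (u-S p)) q)
      ... | inj₂ r = r

      conj∈ : ∀ {σ} → InQ σ → InQ (u ∙ σ ∙ u)
      conj∈ {σ} (Hσ , fσ) = ∙∈ u∈ (∙∈ Hσ u∈) , λ i s → trans (cong (u ⟨$⟩ʳ_) (fσ _ (u-S s))) (uu i)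

      conj-t : ∀ {w} → S ∌ w → u ∙ t w ∙ u ≈ t (u ⟨$⟩ʳ w)
      conj-t {w} Sw = Q-≈t (u ∙ t w ∙ u) (conj∈ (t∈ w)) (u-∌ Sw)
        (cong (u ⟨$⟩ʳ_) (trans (cong (t w ⟨$⟩ʳ_) u-v) (tv Sw)))

      u-t : ∀ {w} → S ∌ w → ∀ i → u ⟨$⟩ʳ (t w ⟨$⟩ʳ i) ≡ t (u ⟨$⟩ʳ w) ⟨$⟩ʳ (u ⟨$⟩ʳ i)
      u-t {w} Sw i = trans (cong (λ z → u ⟨$⟩ʳ (t w ⟨$⟩ʳ z)) (sym (uu i))) (conj-t Sw (u ⟨$⟩ʳ i))

    module Involutive (w₀ : Fin n) (Sw₀ : S ∌ w₀) (w₀≢v : w₀ ≢ v) (inv₀ : t w₀ ⟨$⟩ʳ w₀ ≡ v) where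

      -- The stabiliser of the set `S` and the point `v` is transitive on the remaining points, so
      -- all nontrivial elements of `Q` are conjugate, and one involution makes them all
      -- involutions.
      t-back : ∀ {w} → S ∌ w → t w ⟨$⟩ʳ w ≡ v
      t-back {w} Sw with w ≟ v
      ... | yes refl = tv Sw
      ... | no w≢v = back (flags ∣ S ∣ (d∸1<k ∣S∣) S v w₀ S v w (refl , Sv , Sw₀ , w₀≢v ∘ sym) (refl , Sv , Sw , w≢v ∘ sym))
        where
        back : (∃ λ h → H h × permute h S ≡ S × h ⟨$⟩ʳ v ≡ v × h ⟨$⟩ʳ w₀ ≡ w) → t w ⟨$⟩ʳ w ≡ v
        back (h , Hh , hS , hv , hw) = trans (sym (same w)) (trans (cong (λ z → h ⟨$⟩ʳ (t w₀ ⟨$⟩ʳ z)) (inv-of h hw))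
          (trans (cong (h ⟨$⟩ʳ_) inv₀) hv))
          where
          g : Permutation′ n
          g = h ∙ t w₀ ∙ flip h
          h⁻S : ∀ {i} → S ∋ i → S ∋ h ⟨$⟩ˡ i
          h⁻S {i} p = trans (sym (lookup-permute h S (h ⟨$⟩ˡ i))) (trans (cong₂ lookup hS (inverseʳ h)) p)
          same : g ≈ t w
          same = Q-≈t g (∙∈ Hh (∙∈ (proj₁ (t∈ w₀)) (inv∈ Hh)) ,
              λ i p → trans (cong (h ⟨$⟩ʳ_) (proj₂ (t∈ w₀) _ (h⁻S p))) (inverseʳ h)) Sw
            (trans (cong (λ z → h ⟨$⟩ʳ (t w₀ ⟨$⟩ʳ z)) (inv-of h hv)) (trans (cong (h ⟨$⟩ʳ_) (tv Sw₀)) hw))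

      tt : ∀ {w} → S ∌ w → ∀ i → t w ⟨$⟩ʳ (t w ⟨$⟩ʳ i) ≡ i
      tt {w} Sw = Q-unique (t w ∙ t w) idₚ (Q-∙ (t∈ w) (t∈ w)) Q-id (trans (cong (t w ⟨$⟩ʳ_) (tv Sw)) (t-back Sw))

      t-∙ : ∀ {a b} → S ∌ a → S ∌ b → t a ∙ t b ≈ t (t a ⟨$⟩ʳ b)
      t-∙ {a} {b} Sa Sb = Q-≈t (t a ∙ t b) (Q-∙ (t∈ a) (t∈ b)) (t-∌ a Sb) (cong (t a ⟨$⟩ʳ_) (tv Sb))

      t-comm : ∀ {a b} → S ∌ a → S ∌ b → ∀ i → t a ⟨$⟩ʳ (t b ⟨$⟩ʳ i) ≡ t b ⟨$⟩ʳ (t a ⟨$⟩ʳ i)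
      t-comm {a} {b} Sa Sb i = trans (sym (cong (λ z → t a ⟨$⟩ʳ (t b ⟨$⟩ʳ z)) (trans (cong (t a ⟨$⟩ʳ_) (tt Sb _)) (tt Sa i))))
        (square (t b ⟨$⟩ʳ (t a ⟨$⟩ʳ i)))
        where
        square : ∀ j → t a ⟨$⟩ʳ (t b ⟨$⟩ʳ (t a ⟨$⟩ʳ (t b ⟨$⟩ʳ j))) ≡ j
        square j = trans (cong (λ z → t a ⟨$⟩ʳ (t b ⟨$⟩ʳ z)) (t-∙ Sa Sb j))
          (trans (t-∙ Sa Sb _) (tt (t-∌ a Sb) j))

      module _ (u : Permutation′ n) (sw : Swapper u) where
        open Swapper sw

        -- Points outside `S` are read as elements of `Q`, now elementary abelian. If `u` moves `w`,
        -- the product of `w` and `u w` is nontrivial and fixed by `u`, hence the same `z₀` for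
        -- every such `w`. For two moved elements the product `w₁ w₂` is then also fixed by `u`, so
        -- it is trivial or `z₀`. This forces `w₂` to be `w₁` or `u w₁`, but there are other choices
        -- for `w₂`.
        contradiction-from : ∀ w₁ → S ∌ w₁ → u ⟨$⟩ʳ w₁ ≢ w₁ → ⊥
        contradiction-from w₁ Sw₁ uw₁≢ = last (fresh (ins (ins (ins (ins S v) z₀) w₁) (u ⟨$⟩ʳ w₁)) room)
          where
          fixed : ∀ {w} → S ∌ w → u ⟨$⟩ʳ (t w ⟨$⟩ʳ (u ⟨$⟩ʳ w)) ≡ t w ⟨$⟩ʳ (u ⟨$⟩ʳ w)
          fixed {w} Sw = trans (u-t Sw _) (trans (cong (t (u ⟨$⟩ʳ w) ⟨$⟩ʳ_) (trans (uu w) (sym (tv Sw))))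
            (trans (t-comm (u-∌ Sw) Sw v) (cong (t w ⟨$⟩ʳ_) (tv (u-∌ Sw)))))
          not-v : ∀ {w} → S ∌ w → u ⟨$⟩ʳ w ≢ w → t w ⟨$⟩ʳ (u ⟨$⟩ʳ w) ≢ v
          not-v {w} Sw moved eq = moved (perm-inj (t w) (trans eq (sym (t-back Sw))))
          z₀ : Fin n
          z₀ = t w₁ ⟨$⟩ʳ (u ⟨$⟩ʳ w₁)
          Sz₀ : S ∌ z₀
          Sz₀ = t-∌ w₁ (u-∌ Sw₁)
          z₀≢v : z₀ ≢ v
          z₀≢v = not-v Sw₁ uw₁≢
          -- The set has at most `d + 3` points, and `4 ≤ d ≤ k` gives `d + 4 ≤ 2k`.
          room : ∣ ins (ins (ins (ins S v) z₀) w₁) (u ⟨$⟩ʳ w₁) ∣ < n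
          room = ℕₚ.≤-trans (s≤s (ins-≤ (ins (ins (ins S v) z₀) w₁) _ (ins-≤ (ins (ins S v) z₀) w₁ (ins-≤ (ins S v) z₀ (∣ins∣≤ S v)))))
            (ℕₚ.≤-trans (s≤s (s≤s (s≤s (s≤s (ℕₚ.≤-trans (ℕₚ.≤-reflexive ∣S∣) d≤k))))) (ℕₚ.+-monoˡ-≤ k (ℕₚ.≤-trans 4≤d d≤k)))
          last : (∃ λ i → ins (ins (ins (ins S v) z₀) w₁) (u ⟨$⟩ʳ w₁) ∌ i) → ⊥
          last (w₂ , q₁) =
            let w₂≢uw₁ , q₂ = ins-∌⁻ (ins (ins (ins S v) z₀) w₁) q₁
                w₂≢w₁ , q₃ = ins-∌⁻ (ins (ins S v) z₀) q₂
                w₂≢z₀ , q₄ = ins-∌⁻ (ins S v) q₃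
                w₂≢v , Sw₂ = ins-∌⁻ S q₄
                uw₂≢ = λ eq → w₂≢z₀ (few w₂ z₀ Sw₂ Sz₀ w₂≢v z₀≢v eq (fixed Sw₁))
                z₂≡z₀ = few (t w₂ ⟨$⟩ʳ (u ⟨$⟩ʳ w₂)) z₀ (t-∌ w₂ (u-∌ Sw₂)) Sz₀ (not-v Sw₂ uw₂≢) z₀≢v (fixed Sw₂) (fixed Sw₁)
                uw₁ = trans (sym (tt Sw₁ (u ⟨$⟩ʳ w₁))) refl
                uw₂ = trans (sym (tt Sw₂ (u ⟨$⟩ʳ w₂))) (cong (t w₂ ⟨$⟩ʳ_) z₂≡z₀)
                w₃-fixed = trans (u-t Sw₁ w₂) (trans (cong₂ (λ a b → t a ⟨$⟩ʳ b) uw₁ uw₂)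
                  (trans (sym (t-∙ Sw₁ Sz₀ _)) (cong (t w₁ ⟨$⟩ʳ_) (back Sw₂))))
            in w₂≢uw₁ (perm-inj (t w₁) (few (t w₁ ⟨$⟩ʳ w₂) z₀ (t-∌ w₁ Sw₂) Sz₀
                 (λ eq → w₂≢w₁ (perm-inj (t w₁) (trans eq (sym (t-back Sw₁))))) z₀≢v w₃-fixed (fixed Sw₁)))
            where
            back : ∀ {w} → S ∌ w → t z₀ ⟨$⟩ʳ (t w ⟨$⟩ʳ z₀) ≡ w
            back {w} Sw = trans (cong (λ z → t z₀ ⟨$⟩ʳ (t w ⟨$⟩ʳ z)) (sym (tv Sz₀)))
              (trans (cong (t z₀ ⟨$⟩ʳ_) (t-comm Sw Sz₀ v)) (trans (tt Sz₀ _) (tv Sw)))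

    module NonInvolutive (none : ¬ (∃ λ w → S ∌ w × w ≢ v × t w ⟨$⟩ʳ w ≡ v)) (u : Permutation′ n) (sw : Swapper u) where
      open Swapper sw

      -- If `u` fixes `w ≠ v`, it also fixes the square of `t w`, which is nontrivial because `Q`
      -- has no involution. By `few` the square is `t w` itself, so `t w` is trivial.
      only-v : ∀ {w} → S ∌ w → u ⟨$⟩ʳ w ≡ w → w ≡ v
      only-v {w} Sw uw with w ≟ v
      ... | yes eq = eq
      ... | no w≢v = ⊥-elim (w≢v (perm-inj (t w) (trans (sym w≡tww) (sym (tv Sw)))))
        where
        w≡tww : w ≡ t w ⟨$⟩ʳ w
        w≡tww = few w (t w ⟨$⟩ʳ w) Sw (t-∌ w Sw) w≢v (λ eq → none (w , Sw , w≢v , eq)) uw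
          (trans (u-t Sw w) (cong₂ (λ a b → t a ⟨$⟩ʳ b) uw uw))

      u-t⁻ : ∀ {w} → S ∌ w → ∀ i → u ⟨$⟩ʳ (t w ⟨$⟩ˡ i) ≡ t (u ⟨$⟩ʳ w) ⟨$⟩ˡ (u ⟨$⟩ʳ i)
      u-t⁻ {w} Sw i = sym (inv-of (t (u ⟨$⟩ʳ w)) (trans (sym (u-t Sw _)) (cong (u ⟨$⟩ʳ_) (inverseʳ (t w)))))

      -- In terms of Q this is the map σ ↦ σ⁻¹ σᵘ; it is injective, hence onto, hence u inverts Q.
      difference : Fin n → Fin n
      difference w = branch (∋⊎∌ S w) w (t w ⟨$⟩ˡ (u ⟨$⟩ʳ w))

      difference-in : ∀ {w} → S ∋ w → difference w ≡ w
      difference-in {w} p = branch-left (∋⊎∌ S w) (λ q → ∋-∌ {A = S} p q)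

      difference-out : ∀ {w} → S ∌ w → difference w ≡ t w ⟨$⟩ˡ (u ⟨$⟩ʳ w)
      difference-out {w} q = branch-right (∋⊎∌ S w) (λ p → ∋-∌ {A = S} p q)

      difference-∌ : ∀ {w} → S ∌ w → S ∌ difference w
      difference-∌ {w} q = subst (S ∌_) (sym (difference-out q)) (t⁻-∌ w (u-∌ q))

      quotient : Fin n → Permutation′ n
      quotient w = flip (t w) ∙ t (u ⟨$⟩ʳ w)

      quotient∈ : ∀ w → InQ (quotient w)
      quotient∈ w = Q-∙ (Q-inv (t∈ w)) (t∈ (u ⟨$⟩ʳ w))

      quotient-v : ∀ {w} → S ∌ w → quotient w ⟨$⟩ʳ v ≡ difference w
      quotient-v {w} Sw = trans (cong (t w ⟨$⟩ˡ_) (tv (u-∌ Sw))) (sym (difference-out Sw))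

      -- From `σ⁻¹σᵘ = π⁻¹πᵘ` it follows that `u` fixes `πσ⁻¹`, which is trivial by `only-v`.
      difference-injective-out : ∀ {w w′} → S ∌ w → S ∌ w′ → difference w ≡ difference w′ → w ≡ w′
      difference-injective-out {w} {w′} Sw Sw′ eq = trans (sym t′v) (tv Sw′)
        where
        same : quotient w ≈ quotient w′
        same = Q-unique (quotient w) (quotient w′) (quotient∈ w) (quotient∈ w′)
          (trans (quotient-v Sw) (trans eq (sym (quotient-v Sw′))))
        x : Fin n
        x = t w′ ⟨$⟩ʳ (t w ⟨$⟩ˡ v)
        ux : u ⟨$⟩ʳ x ≡ x
        ux = trans (u-t Sw′ _) (trans (cong (t (u ⟨$⟩ʳ w′) ⟨$⟩ʳ_) (trans (u-t⁻ Sw v) (cong (t (u ⟨$⟩ʳ w) ⟨$⟩ˡ_) u-v)))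
          (trans (sym (inverseʳ (t w′))) (cong (t w′ ⟨$⟩ʳ_) (trans (sym (same _)) (cong (t w ⟨$⟩ˡ_) (inverseʳ (t (u ⟨$⟩ʳ w))))))))
        x≡v : x ≡ v
        x≡v = only-v (t-∌ w′ (t⁻-∌ w Sv)) ux
        flips : flip (t w) ≈ flip (t w′)
        flips = Q-unique (flip (t w)) (flip (t w′)) (Q-inv (t∈ w)) (Q-inv (t∈ w′)) (sym (inv-of (t w′) x≡v))
        t′v : t w′ ⟨$⟩ʳ v ≡ w
        t′v = trans (cong (t w′ ⟨$⟩ʳ_) (trans (sym (inv-of (t w) (tv Sw))) (flips w))) (inverseʳ (t w′))

      difference-injective : ∀ {w w′} → difference w ≡ difference w′ → w ≡ w′
      difference-injective {w} {w′} eq = cases (∋⊎∌ S w) (∋⊎∌ S w′)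
        where
        cases : S ∋ w ⊎ S ∌ w → S ∋ w′ ⊎ S ∌ w′ → w ≡ w′
        cases (inj₁ p) (inj₁ p′) = trans (sym (difference-in p)) (trans eq (difference-in p′))
        cases (inj₂ q) (inj₂ q′) = difference-injective-out q q′ eq
        cases (inj₁ p) (inj₂ q′) = ⊥-elim (∋-∌ {A = S} (subst (S ∋_) (trans (sym (difference-in p)) eq) p) (difference-∌ q′))
        cases (inj₂ q) (inj₁ p′) = ⊥-elim (∋-∌ {A = S} (subst (S ∋_) (trans (sym (difference-in p′)) (sym eq)) p′) (difference-∌ q))

      -- Every element of `Q` has the form `σ⁻¹σᵘ`, and the involution `u` sends it to `(σᵘ)⁻¹σ`,
      -- its inverse.
      inverts : ∀ {y} → S ∌ y → u ⟨$⟩ʳ y ≡ t y ⟨$⟩ˡ v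
      inverts {y} Sy = from (surjective difference difference-injective y)
        where
        from : (∃ λ w → difference w ≡ y) → u ⟨$⟩ʳ y ≡ t y ⟨$⟩ˡ v
        from (w , eq) = trans (cong (u ⟨$⟩ʳ_) (trans (sym eq) (difference-out Sw))) (trans (u-t⁻ Sw _)
            (trans (cong (t (u ⟨$⟩ʳ w) ⟨$⟩ˡ_) (uu w)) (sym (inv-of (t y) ty))))
          where
          Sw : S ∌ w
          Sw = ≢true λ p → ∋-∌ {A = S} (subst (S ∋_) (trans (sym (difference-in p)) eq) p) Sy
          ty : t y ⟨$⟩ʳ (t (u ⟨$⟩ʳ w) ⟨$⟩ˡ w) ≡ v
          ty = trans (sym (Q-≈t (quotient w) (quotient∈ w) Sy (trans (quotient-v Sw) eq) _))
            (trans (cong (t w ⟨$⟩ˡ_) (inverseʳ (t (u ⟨$⟩ʳ w)))) (inv-of (t w) (tv Sw)))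

    module _ (s₁ s₂ : Fin n) (S₁ : S ∋ s₁) (S₂ : S ∋ s₂) (s₁≢s₂ : s₁ ≢ s₂) where
      rest : Subset n
      rest = del (del S s₁) s₂

      S₂′ : del S s₁ ∋ s₂
      S₂′ = del-∋ S (s₁≢s₂ ∘ sym) S₂

      ∣rest∣ : suc (suc (suc ∣ rest ∣)) ≡ d
      ∣rest∣ = trans (cong (λ z → suc (suc z)) (sym (∣del∣ (del S s₁) s₂ S₂′))) (trans (cong suc (sym (∣del∣ S s₁ S₁))) ∣S∣)

      rest-∌ : ∀ {i} → S ∌ i → rest ∌ i
      rest-∌ q = del-∌ (del S s₁) s₂ (del-∌ S s₁ q)

      -- The points of `S` other than `s₁`, `s₂`, together with `v`, number `d − 2`, just few enough
      -- for `swap`. The square of the result fixes the base `S ∪ v`, so the result is an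
      -- involution.
      swapper : ∃ λ u → Swapper u × u ⟨$⟩ʳ s₁ ≡ s₂ × (∀ i → S ∋ i → i ≢ s₁ → i ≢ s₂ → u ⟨$⟩ʳ i ≡ i)
      swapper =
        let u , Hu , fix , us₁ , us₂ = swap (ins rest v) s₁ s₂
              (ℕₚ.≤-reflexive (trans (cong (λ z → suc (suc z)) (∣ins∣ rest v (rest-∌ Sv))) ∣rest∣))
              (ins-∌ rest (∋∌⇒≢ {A = S} S₁ Sv) (del-∌ (del S s₁) s₂ (del-self S s₁)))
              (ins-∌ rest (∋∌⇒≢ {A = S} S₂ Sv) (del-self (del S s₁) s₂)) s₁≢s₂
        in u , build u Hu fix us₁ us₂ , us₁ , λ i p i≢s₁ i≢s₂ → fix i (ins-⊒ rest v (del-∋ (del S s₁) i≢s₂ (del-∋ S i≢s₁ p)))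
        where
        build : ∀ u → H u → Fixes u (ins rest v) → u ⟨$⟩ʳ s₁ ≡ s₂ → u ⟨$⟩ʳ s₂ ≡ s₁ → Swapper u
        build u Hu fix us₁ us₂ = record { u∈ = Hu ; u-v = uv ; u-S = λ {i} p → proj₁ (on i p) ; uu = twice ; few = few }
          where
          uv : u ⟨$⟩ʳ v ≡ v
          uv = fix v (ins-self rest v)
          on : ∀ i → S ∋ i → S ∋ u ⟨$⟩ʳ i × u ⟨$⟩ʳ (u ⟨$⟩ʳ i) ≡ i
          on i p with i ≟ s₁ | i ≟ s₂
          ... | yes refl | _ = subst (S ∋_) (sym us₁) S₂ , trans (cong (u ⟨$⟩ʳ_) us₁) us₂
          ... | no _ | yes refl = subst (S ∋_) (sym us₂) S₁ , trans (cong (u ⟨$⟩ʳ_) us₂) us₁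
          ... | no i≢s₁ | no i≢s₂ = subst (S ∋_) (sym ui) p , trans (cong (u ⟨$⟩ʳ_) ui) ui
            where
            ui : u ⟨$⟩ʳ i ≡ i
            ui = fix i (ins-⊒ rest v (del-∋ (del S s₁) i≢s₂ (del-∋ S i≢s₁ p)))
          twice : ∀ i → u ⟨$⟩ʳ (u ⟨$⟩ʳ i) ≡ i
          twice = Q-unique (u ∙ u) idₚ (∙∈ Hu Hu , λ i p → proj₂ (on i p)) Q-id (trans (cong (u ⟨$⟩ʳ_) uv) uv)
          few : ∀ a b → S ∌ a → S ∌ b → a ≢ v → b ≢ v → u ⟨$⟩ʳ a ≡ a → u ⟨$⟩ʳ b ≡ b → a ≡ b
          few a b Sa Sb a≢v b≢v ua ub with a ≟ b
          ... | yes eq = eq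
          -- With `a` and `b` fixed as well, `u` fixes `(d − 3) + 3` points, hence is the identity.
          ... | no a≢b = ⊥-elim (s₁≢s₂ (trans (sym (base≥ big (ℕₚ.≤-reflexive (sym ∣big∣)) u Hu fix-big s₁)) us₁))
            where
            big : Subset n
            big = ins (ins (ins rest v) a) b
            ∌a : ins rest v ∌ a
            ∌a = ins-∌ rest a≢v (rest-∌ Sa)
            ∌b : ins (ins rest v) a ∌ b
            ∌b = ins-∌ (ins rest v) (a≢b ∘ sym) (ins-∌ rest b≢v (rest-∌ Sb))
            ∣big∣ : ∣ big ∣ ≡ d
            ∣big∣ = trans (∣ins∣ (ins (ins rest v) a) b ∌b) (trans (cong suc (∣ins∣ (ins rest v) a ∌a)) (trans (cong (λ z → suc (suc z)) (∣ins∣ rest v (rest-∌ Sv))) ∣rest∣))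
            fix-big : Fixes u big
            fix-big i p with ins⁻ (ins (ins rest v) a) b p
            ... | inj₁ refl = ub
            ... | inj₂ p₁ with ins⁻ (ins rest v) a p₁
            ... | inj₁ refl = ua
            ... | inj₂ p₂   = fix i p₂

    -- Apart from `v` there are at least two points outside `S`, and `few` allows only one of them
    -- to be fixed.
    moved-outside : ∀ u → Swapper u → ∃ λ w → S ∌ w × u ⟨$⟩ʳ w ≢ w
    moved-outside u sw = second (fresh (ins S v) (ℕₚ.≤-trans (s≤s (∣ins∣≤ S v)) (ℕₚ.≤-trans (ℕₚ.n≤1+n _) room)))
      where
      room : suc (suc (suc ∣ S ∣)) ≤ n
      room = ℕₚ.≤-trans (s≤s (s≤s (ℕₚ.≤-trans (ℕₚ.≤-reflexive ∣S∣) d≤k))) 2+k≤n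
      second : (∃ λ a → ins S v ∌ a) → ∃ λ w → S ∌ w × u ⟨$⟩ʳ w ≢ w
      second (a , a∌) = choose (fresh (ins (ins S v) a) (ℕₚ.≤-trans (s≤s (∣ins∣≤ (ins S v) a)) (ℕₚ.≤-trans (s≤s (s≤s (∣ins∣≤ S v))) room)))
        where
        choose : (∃ λ b → ins (ins S v) a ∌ b) → ∃ λ w → S ∌ w × u ⟨$⟩ʳ w ≢ w
        choose (b , b∌) with u ⟨$⟩ʳ a ≟ a | u ⟨$⟩ʳ b ≟ b | ins-∌⁻ S a∌ | ins-∌⁻ (ins S v) b∌
        ... | no ≢a | _ | _ , Sa | _ = a , Sa , ≢a
        ... | yes _ | no ≢b | _ | _ , b∌′ = b , proj₂ (ins-∌⁻ S b∌′) , ≢b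
        ... | yes ua | yes ub | a≢v , Sa | b≢a , b∌′ =
          ⊥-elim (b≢a (sym (Swapper.few sw a b Sa (proj₂ (ins-∌⁻ S b∌′)) a≢v (proj₁ (ins-∌⁻ S b∌′)) ua ub)))

    three-members : ∃ λ s₁ → ∃ λ s₂ → ∃ λ s₃ → S ∋ s₁ × S ∋ s₂ × S ∋ s₃ × s₁ ≢ s₂ × s₁ ≢ s₃ × s₂ ≢ s₃
    three-members = first (member S (ℕₚ.≤-trans (s≤s z≤n) 3≤))
      where
      3≤ : 3 ≤ ∣ S ∣
      3≤ = ℕₚ.≤-pred (subst (4 ≤_) (sym ∣S∣) 4≤d)
      first : (∃ λ s₁ → S ∋ s₁) → _
      first (s₁ , p₁) = next (pick S (ins (∅ n) s₁) (ℕₚ.≤-trans (s≤s (ℕₚ.≤-trans (∣ins∣≤ (∅ n) s₁) (s≤s (ℕₚ.≤-reflexive (∣∅∣ n))))) (ℕₚ.≤-trans (ℕₚ.n≤1+n 2) 3≤)))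
        where
        next : (∃ λ s₂ → S ∋ s₂ × ins (∅ n) s₁ ∌ s₂) → _
        next (s₂ , p₂ , q₂) = third (pick S (doubleton s₁ s₂) (subst (_< ∣ S ∣) (sym (∣doubleton∣ s₁≢s₂)) 3≤))
          where
          s₁≢s₂ : s₁ ≢ s₂
          s₁≢s₂ = proj₁ (ins-∌⁻ (∅ n) q₂) ∘ sym
          third : (∃ λ s₃ → S ∋ s₃ × doubleton s₁ s₂ ∌ s₃) → ∃ λ s₁ → ∃ λ s₂ → ∃ λ s₃ → S ∋ s₁ × S ∋ s₂ × S ∋ s₃ × s₁ ≢ s₂ × s₁ ≢ s₃ × s₂ ≢ s₃
          third (s₃ , p₃ , q₃) = s₁ , s₂ , s₃ , p₁ , p₂ , p₃ , s₁≢s₂ ,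
            proj₁ (ins-∌⁻ (∅ n) (proj₂ (ins-∌⁻ (ins (∅ n) s₁) q₃))) ∘ sym , proj₁ (ins-∌⁻ (ins (∅ n) s₁) q₃) ∘ sym

    -- If `Q` has no involution, the swappers of `s₁, s₂` and of `s₂, s₃` both invert `Q`, so they
    -- agree outside `S`. That complement is a base, so they are equal, yet only the second takes
    -- `s₂` to `s₃`. The bound `4 ≤ d` supplies the third point of `S`.
    absurd : ⊥
    absurd =
      let s₁ , s₂ , s₃ , p₁ , p₂ , p₃ , s₁≢s₂ , s₁≢s₃ , s₂≢s₃ = three-members
          u , sw , us₁ , fix = swapper s₁ s₂ p₁ p₂ s₁≢s₂
          u′ , sw′ , us₂ , _ = swapper s₂ s₃ p₂ p₃ s₂≢s₃
          w₁ , Sw₁ , moved = moved-outside u sw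
      in cases s₂≢s₃ u sw u′ sw′ us₂ (fix s₃ p₃ (s₁≢s₃ ∘ sym) (s₂≢s₃ ∘ sym)) w₁ Sw₁ moved tt≡v?
      where
      cases : ∀ {s₂ s₃} → s₂ ≢ s₃ → ∀ u → Swapper u → ∀ u′ → Swapper u′ → u′ ⟨$⟩ʳ s₂ ≡ s₃ → u ⟨$⟩ʳ s₃ ≡ s₃ →
        ∀ w₁ → S ∌ w₁ → u ⟨$⟩ʳ w₁ ≢ w₁ →
        (∃ λ w → S ∌ w × w ≢ v × t w ⟨$⟩ʳ w ≡ v) ⊎ ¬ (∃ λ w → S ∌ w × w ≢ v × t w ⟨$⟩ʳ w ≡ v) → ⊥
      cases _ u sw _ _ _ _ w₁ Sw₁ moved (inj₁ (w , Sw , w≢v , inv₀)) = Involutive.contradiction-from w Sw w≢v inv₀ u sw w₁ Sw₁ moved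
      cases {s₂} {s₃} s₂≢s₃ u sw u′ sw′ u′s₂ us₃ _ _ _ (inj₂ none) =
        s₂≢s₃ (perm-inj u (trans (trans (same s₂) u′s₂) (sym us₃)))
        where
        same : u ≈ u′
        same = agree (∁ S) outside≥d u u′ (Swapper.u∈ sw) (Swapper.u∈ sw′) λ i p →
          trans (NonInvolutive.inverts none u sw (∁-∋⁻ S p)) (sym (NonInvolutive.inverts none u′ sw′ (∁-∋⁻ S p)))

three-cycle-exists : ∀ k → 2 ≤ k → Classical → (H : Permutation′ (k + k) → Set) → IsPermGroup H →
  (∀ j → j < k → FlagTransitive H j) →
  ∃ λ σ → H σ × ∃ λ p → ∃ λ q → ∃ λ r → ThreeCycle σ p q r
three-cycle-exists k 2≤k lem H grp flags =
  from (least lem BaseOfSize n (full n , ∣full∣ n , λ σ _ fix i → fix i (full-∋ i)))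
  where
  open Bases k 2≤k lem H grp flags
  from : (∃ λ d → BaseOfSize d × (∀ j → j < d → ¬ BaseOfSize j)) → HasThreeCycle
  from (d , base , minimal) = size (ℕₚ.≤-<-connex d k)
    where
    size : d ≤ k ⊎ k < d → HasThreeCycle
    size (inj₂ k<d) = large-base⇒three-cycle d base minimal k<d
    size (inj₁ d≤k) = small (ℕₚ.m≤n⇒m<n∨m≡n (SmallBase.3≤d d d≤k base minimal))
      where
      small : 3 < d ⊎ 3 ≡ d → HasThreeCycle
      small (inj₂ refl) = ThreePointBase.three-cycle k 2≤k lem H grp flags d≤k base minimal
      small (inj₁ 4≤d) =
        let S , _ , ∣S∣ = subset-of-size (full n) (ℕ.pred d) (ℕₚ.≤-trans (ℕₚ.pred[n]≤n) (ℕₚ.≤-trans d≤k (ℕₚ.≤-trans k≤n (ℕₚ.≤-reflexive (sym (∣full∣ n))))))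
            ∣S∣′ : suc ∣ S ∣ ≡ d
            ∣S∣′ = trans (cong suc ∣S∣) (suc-pred 4≤d)
            v , Sv = fresh S (ℕₚ.≤-trans (ℕₚ.≤-reflexive ∣S∣′) (ℕₚ.≤-trans d≤k k≤n))
        in ⊥-elim (LargerBase.absurd k 2≤k lem H grp flags d d≤k base minimal 4≤d S ∣S∣′ v Sv)
        where
        suc-pred : ∀ {d} → 3 < d → suc (ℕ.pred d) ≡ d
        suc-pred (s≤s _) = refl

-- Transpositions, 3-cycles and parity

transpose-left : ∀ {n} (i j : Fin n) → transpose i j ⟨$⟩ʳ i ≡ j
transpose-left i j with i ≟ i
... | yes _  = refl
... | no i≢i = ⊥-elim (i≢i refl)

transpose-right : ∀ {n} (i j : Fin n) → transpose i j ⟨$⟩ʳ j ≡ i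
transpose-right i j with j ≟ i
... | yes eq = eq
... | no _ with j ≟ j
...   | yes _  = refl
...   | no j≢j = ⊥-elim (j≢j refl)

transpose-off : ∀ {n} (i j : Fin n) {l} → l ≢ i → l ≢ j → transpose i j ⟨$⟩ʳ l ≡ l
transpose-off i j {l} l≢i l≢j with l ≟ i
... | yes eq = ⊥-elim (l≢i eq)
... | no _ with l ≟ j
...   | yes eq = ⊥-elim (l≢j eq)
...   | no _   = refl

transpose-same : ∀ {n} (i : Fin n) → transpose i i ≈ idₚ
transpose-same i l with l ≟ i in eq
... | yes refl = refl
... | no l≢i rewrite eq = refl

transpose-sym : ∀ {n} (i j : Fin n) → transpose i j ≈ transpose j i
transpose-sym i j l = cases (l ≟ i) (l ≟ j)
  where
  cases : Dec (l ≡ i) → Dec (l ≡ j) → transpose i j ⟨$⟩ʳ l ≡ transpose j i ⟨$⟩ʳ l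
  cases (yes refl) _          = trans (transpose-left l j) (sym (transpose-right j l))
  cases (no _)     (yes refl) = trans (transpose-right i l) (sym (transpose-left l i))
  cases (no l≢i)   (no l≢j)   = trans (transpose-off i j l≢i l≢j) (sym (transpose-off j i l≢j l≢i))

transpose-involutive : ∀ {n} (i j : Fin n) l → transpose i j ⟨$⟩ʳ (transpose i j ⟨$⟩ʳ l) ≡ l
transpose-involutive i j l = trans (cong (transpose i j ⟨$⟩ʳ_) (transpose-sym i j l)) (inverseʳ (transpose i j))

rotation : ∀ {n} → Fin n → Fin n → Fin n → Permutation′ n
rotation i j l = transpose i j ∙ transpose j l

rotation-cycle : ∀ {n} {i j l : Fin n} → i ≢ j → j ≢ l → i ≢ l → ThreeCycle (rotation i j l) i j l
rotation-cycle {i = i} {j} {l} i≢j j≢l i≢l = cycle i≢j j≢l i≢l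
  (trans (cong (transpose i j ⟨$⟩ʳ_) (transpose-off j l i≢j i≢l)) (transpose-left i j))
  (trans (cong (transpose i j ⟨$⟩ʳ_) (transpose-left j l)) (transpose-off i j (i≢l ∘ sym) (j≢l ∘ sym)))
  (trans (cong (transpose i j ⟨$⟩ʳ_) (transpose-right j l)) (transpose-right i j))
  (λ m m≢i m≢j m≢l → trans (cong (transpose i j ⟨$⟩ʳ_) (transpose-off j l m≢j m≢l)) (transpose-off i j m≢i m≢j))

three-cycle-unique : ∀ {n} {σ π : Permutation′ n} {p q r} → ThreeCycle σ p q r → ThreeCycle π p q r → σ ≈ π
three-cycle-unique {p = p} {q} {r} (cycle _ _ _ σp σq σr σo) (cycle _ _ _ πp πq πr πo) i with i ≟ p | i ≟ q | i ≟ r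
... | yes refl | _ | _ = trans σp (sym πp)
... | no _ | yes refl | _ = trans σq (sym πq)
... | no _ | no _ | yes refl = trans σr (sym πr)
... | no ≢p | no ≢q | no ≢r = trans (σo i ≢p ≢q ≢r) (sym (πo i ≢p ≢q ≢r))

three-cycle-conj : ∀ {n} (π : Permutation′ n) {σ p q r} → ThreeCycle σ p q r →
  ThreeCycle (π ∙ σ ∙ flip π) (π ⟨$⟩ʳ p) (π ⟨$⟩ʳ q) (π ⟨$⟩ʳ r)
three-cycle-conj π {σ} (cycle p≢q q≢r p≢r σp σq σr σo) = cycle (p≢q ∘ perm-inj π) (q≢r ∘ perm-inj π) (p≢r ∘ perm-inj π)
  (step σp) (step σq) (step σr)
  (λ i ≢p ≢q ≢r → trans (cong (π ⟨$⟩ʳ_) (σo (π ⟨$⟩ˡ i) (away ≢p) (away ≢q) (away ≢r))) (inverseʳ π))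
  where
  step : ∀ {a b} → σ ⟨$⟩ʳ a ≡ b → π ⟨$⟩ʳ (σ ⟨$⟩ʳ (π ⟨$⟩ˡ (π ⟨$⟩ʳ a))) ≡ π ⟨$⟩ʳ b
  step eq = cong (π ⟨$⟩ʳ_) (trans (cong (σ ⟨$⟩ʳ_) (inverseˡ π)) eq)
  away : ∀ {i p} → i ≢ π ⟨$⟩ʳ p → π ⟨$⟩ˡ i ≢ p
  away ne eq = ne (trans (sym (inverseʳ π)) (cong (π ⟨$⟩ʳ_) eq))

three-cycle-turn : ∀ {n} {σ : Permutation′ n} {p q r} → ThreeCycle σ p q r → ThreeCycle σ q r p
three-cycle-turn (cycle p≢q q≢r p≢r σp σq σr σo) =
  cycle q≢r (p≢r ∘ sym) (p≢q ∘ sym) σq σr σp (λ i ≢q ≢r ≢p → σo i ≢p ≢q ≢r)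

three-cycle-flip : ∀ {n} {σ : Permutation′ n} {p q r} → ThreeCycle σ p q r → ThreeCycle (flip σ) r q p
three-cycle-flip {σ = σ} (cycle p≢q q≢r p≢r σp σq σr σo) =
  cycle (q≢r ∘ sym) (p≢q ∘ sym) (p≢r ∘ sym) (inv-of σ σq) (inv-of σ σp) (inv-of σ σr)
    (λ i ≢r ≢q ≢p → inv-of σ (σo i ≢p ≢q ≢r))

AllThreeCycles : ∀ {n} → (Permutation′ n → Set) → Set
AllThreeCycles {n} H = ∀ (i j l : Fin n) → i ≢ j → j ≢ l → i ≢ l → H (rotation i j l)

-- By 3-transitivity the conjugates of one 3-cycle are all of them.
all-three-cycles : ∀ k → 2 ≤ k → Classical → (H : Permutation′ (k + k) → Set) → IsPermGroup H →
  (∀ j → j < k → FlagTransitive H j) → AllThreeCycles H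
all-three-cycles k 2≤k lem H grp flags i j l i≢j j≢l i≢l =
  let σ , Hσ , p , q , r , c = three-cycle-exists k 2≤k lem H grp flags
      open ThreeCycle c
      π , Hπ , πp , πq , πr = Bases.3-transitive k 2≤k lem H grp flags p q r i j l p≢q p≢r q≢r i≢j i≢l j≢l
  in resp (three-cycle-unique (subst (λ x → ThreeCycle (π ∙ σ ∙ flip π) x j l) πp
       (subst (λ y → ThreeCycle (π ∙ σ ∙ flip π) (π ⟨$⟩ʳ p) y l) πq
       (subst (ThreeCycle (π ∙ σ ∙ flip π) (π ⟨$⟩ʳ p) (π ⟨$⟩ʳ q)) πr (three-cycle-conj π c))))
       (rotation-cycle i≢j j≢l i≢l)) (∙∈ Hπ (∙∈ Hσ (inv∈ Hπ)))
  where open IsPermGroup grp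

module Parity {n} (H : Permutation′ n → Set) (grp : IsPermGroup H) (all : AllThreeCycles H) where
  open IsPermGroup grp

  adjacent-pair : ∀ i j l → i ≢ j → j ≢ l → H (transpose i j ∙ transpose j l)
  adjacent-pair i j l i≢j j≢l with i ≟ l
  ... | no i≢l   = all i j l i≢j j≢l i≢l
  ... | yes refl = resp (λ m → sym (inverseʳ (transpose i j))) id∈

  -- Inserting `(j l)(j l)` writes `(i j)(l m)` as a product of two pairs of transpositions with a
  -- common point.
  pair : ∀ i j l m → i ≢ j → l ≢ m → H (transpose i j ∙ transpose l m)
  pair i j l m i≢j l≢m with j ≟ l
  ... | yes refl = adjacent-pair i j m i≢j l≢m
  ... | no j≢l   = resp (λ x → cong (transpose i j ⟨$⟩ʳ_) (transpose-involutive j l (transpose l m ⟨$⟩ʳ x)))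
    (∙∈ (adjacent-pair i j l i≢j j≢l) (adjacent-pair j l m j≢l l≢m))

  -- This stands in for the sign. Along a decomposition into transpositions each nontrivial factor
  -- switches the alternative. The two alternatives are not claimed to exclude each other; that
  -- comes later from `no-transposition`.
  parity : ∀ σ → H σ ⊎ (∀ i j → i ≢ j → H (σ ∙ transpose i j))
  parity σ with on-list (decompose σ)
    where
    on-list : (xs : TranspositionList n) → H (eval xs) ⊎ (∀ i j → i ≢ j → H (eval xs ∙ transpose i j))
    on-list [] = inj₁ id∈
    on-list ((i , j) ∷ xs) with i ≟ j | on-list xs
    ... | yes refl | inj₁ h = inj₁ (resp (λ x → cong (eval xs ⟨$⟩ʳ_) (sym (transpose-same i x))) h)
    ... | yes refl | inj₂ h = inj₂ λ l m l≢m → resp (λ x → cong (eval xs ⟨$⟩ʳ_) (sym (transpose-same i _))) (h l m l≢m)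
    ... | no i≢j   | inj₁ h = inj₂ λ l m l≢m → ∙∈ h (pair i j l m i≢j l≢m)
    ... | no i≢j   | inj₂ h = inj₁ (h i j i≢j)
  ... | inj₁ h = inj₁ (resp (eval-decompose σ) h)
  ... | inj₂ h = inj₂ λ i j i≢j → resp (λ x → eval-decompose σ (transpose i j ⟨$⟩ʳ x)) (h i j i≢j)

-- Edges of J(2k,k)

permute-∁ : ∀ {n} (σ : Permutation′ n) A → permute σ (∁ A) ≡ ∁ (permute σ A)
permute-∁ σ A = permute-unique σ (∁ A) (∁ (permute σ A)) λ i →
  trans (lookup-map (σ ⟨$⟩ʳ i) not (permute σ A)) (trans (cong not (lookup-permute σ A i)) (sym (lookup-map i not A)))

∁-involutive : ∀ {n} (A : Subset n) → ∁ (∁ A) ≡ A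
∁-involutive A = lookup-ext λ i → trans (lookup-map i not (∁ A)) (trans (cong not (lookup-map i not A)) (not-involutive _))

permute-zipWith : ∀ {n} (f : Bool → Bool → Bool) (σ : Permutation′ n) A B →
  permute σ (zipWith f A B) ≡ zipWith f (permute σ A) (permute σ B)
permute-zipWith f σ A B = permute-unique σ (zipWith f A B) _ λ i →
  trans (lookup-zipWith f (σ ⟨$⟩ʳ i) (permute σ A) (permute σ B))
    (trans (cong₂ f (lookup-permute σ A i) (lookup-permute σ B i)) (sym (lookup-zipWith f i A B)))

-- Inclusion-exclusion. For two `k`-sets in `2k` points it says that their complements meet in as
-- many points as they do, so `τ` preserves adjacency.
∣∩∣+∣∁∩∁∣ : ∀ {n} (A B : Subset n) → ∣ A ∣ + ∣ B ∣ + ∣ ∁ A ∩ ∁ B ∣ ≡ n + ∣ A ∩ B ∣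
∣∩∣+∣∁∩∁∣ []          []          = refl
∣∩∣+∣∁∩∁∣ {suc n} (true ∷ A)  (true ∷ B)  =
  trans (cong suc (trans (cong (_+ ∣ ∁ A ∩ ∁ B ∣) (ℕₚ.+-suc (∣ A ∣) (∣ B ∣))) (cong suc (∣∩∣+∣∁∩∁∣ A B))))
        (cong suc (sym (ℕₚ.+-suc n (∣ A ∩ B ∣))))
∣∩∣+∣∁∩∁∣ (true ∷ A)  (false ∷ B) = cong suc (∣∩∣+∣∁∩∁∣ A B)
∣∩∣+∣∁∩∁∣ (false ∷ A) (true ∷ B)  =
  trans (cong (_+ ∣ ∁ A ∩ ∁ B ∣) (ℕₚ.+-suc (∣ A ∣) (∣ B ∣))) (cong suc (∣∩∣+∣∁∩∁∣ A B))
∣∩∣+∣∁∩∁∣ (false ∷ A) (false ∷ B) = trans (ℕₚ.+-suc (∣ A ∣ + ∣ B ∣) (∣ ∁ A ∩ ∁ B ∣)) (cong suc (∣∩∣+∣∁∩∁∣ A B))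

module _ {k : ℕ} where

  permP : Permutation′ (k + k) → Pair k → Pair k
  permP σ (u , v) = permute σ u , permute σ v

  compP : Pair k → Pair k
  compP (u , v) = ∁ u , ∁ v

  permP-∙ : ∀ σ π e → permP (σ ∙ π) e ≡ permP σ (permP π e)
  permP-∙ σ π (u , v) = cong₂ _,_ (permute-∙ σ π u) (permute-∙ σ π v)

  permP-cong : ∀ {σ π} → σ ≈ π → ∀ e → permP σ e ≡ permP π e
  permP-cong {σ} {π} eq (u , v) = cong₂ _,_ (permute-cong {σ = σ} {π} eq u) (permute-cong {σ = σ} {π} eq v)

  permP-id : ∀ {σ} → σ ≈ idₚ → ∀ e → permP σ e ≡ e
  permP-id {σ} eq (u , v) = cong₂ _,_ (trans (permute-cong {σ = σ} {idₚ} eq u) (permute-id u)) (trans (permute-cong {σ = σ} {idₚ} eq v) (permute-id v))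

  permP-compP : ∀ σ e → permP σ (compP e) ≡ compP (permP σ e)
  permP-compP σ (u , v) = cong₂ _,_ (permute-∁ σ u) (permute-∁ σ v)

  compP-involutive : ∀ e → compP (compP e) ≡ e
  compP-involutive (u , v) = cong₂ _,_ (∁-involutive u) (∁-involutive v)

  permP-flip : ∀ σ e → permP (flip σ) (permP σ e) ≡ e
  permP-flip σ (u , v) = cong₂ _,_ (permute-flip σ u) (permute-flip σ v)

  IsEdge-permP : ∀ σ e → IsEdge k e → IsEdge k (permP σ e)
  IsEdge-permP σ (u , v) (∣u∣ , ∣v∣ , ∣u∩v∣) = trans (∣permute∣ σ u) ∣u∣ , trans (∣permute∣ σ v) ∣v∣ ,
    trans (cong ∣_∣ (sym (permute-zipWith _∧_ σ u v))) (trans (∣permute∣ σ (u ∩ v)) ∣u∩v∣)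

  IsEdge-compP : ∀ e → IsEdge k e → IsEdge k (compP e)
  IsEdge-compP (u , v) (∣u∣ , ∣v∣ , ∣u∩v∣) = half u ∣u∣ , half v ∣v∣ ,
    trans (ℕₚ.+-cancelˡ-≡ (k + k) _ _ (trans (cong₂ (λ a b → a + b + ∣ ∁ u ∩ ∁ v ∣) (sym ∣u∣) (sym ∣v∣)) (∣∩∣+∣∁∩∁∣ u v))) ∣u∩v∣
    where
    half : ∀ u → ∣ u ∣ ≡ k → ∣ ∁ u ∣ ≡ k
    half u eq = ℕₚ.+-cancelˡ-≡ k _ _ (trans (cong (_+ ∣ ∁ u ∣) (sym eq)) (∣A∣+∣∁A∣ u))

  IsEdge-actP : ∀ g e → IsEdge k e → IsEdge k (actP k g e)
  IsEdge-actP (σ , false) e ed = IsEdge-permP σ e ed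
  IsEdge-actP (σ , true)  e ed = IsEdge-compP (permP σ e) (IsEdge-permP σ e ed)

  actP-inv : ∀ g e → actP k (inv {k} g) (actP k g e) ≡ e
  actP-inv (σ , false) e = permP-flip σ e
  actP-inv (σ , true)  e = trans (cong compP (permP-compP (flip σ) (permP σ e)))
    (trans (compP-involutive _) (permP-flip σ e))

  Invariant : Aut k → (Pair k → Pair k → Set) → Set
  Invariant g S = ∀ e e′ → S e e′ → S (actP k g e) (actP k g e′)

  preserves : ∀ {L S} → IsSubgroup k L → (∀ g → L g → Invariant g S) → Preserves k L S
  preserves {S = S} sub inv-S g Lg e e′ = mk⇔ (inv-S g Lg e e′)
    (λ s → subst₂ S (actP-inv g e) (actP-inv g e′) (inv-S (inv {k} g) (IsSubgroup.inv∈ sub Lg) _ _ s))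

ins-∩ : ∀ {n} (A : Subset n) {x y} → A ∌ x → A ∌ y → x ≢ y → ins A x ∩ ins A y ≡ A
ins-∩ A {x} {y} Ax Ay x≢y = lookup-ext λ i → trans (lookup-zipWith _∧_ i (ins A x) (ins A y)) (pointwise i (i ≟ x) (i ≟ y))
  where
  ∧-idem : ∀ b → b ∧ b ≡ b
  ∧-idem true  = refl
  ∧-idem false = refl
  pointwise : ∀ i → Dec (i ≡ x) → Dec (i ≡ y) → lookup (ins A x) i ∧ lookup (ins A y) i ≡ lookup A i
  pointwise i (yes refl) (yes refl) = ⊥-elim (x≢y refl)
  pointwise i (yes refl) (no i≢y)   = trans (cong₂ _∧_ (ins-self A i) (trans (lookup-ins A i≢y) Ax)) (sym Ax)
  pointwise i (no i≢x)   (yes refl) = trans (cong₂ _∧_ (trans (lookup-ins A i≢x) Ay) (ins-self A i)) (sym Ay)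
  pointwise i (no i≢x)   (no i≢y)   = trans (cong₂ _∧_ (lookup-ins A i≢x) (lookup-ins A i≢y)) (∧-idem (lookup A i))

flag-edge : ∀ k → 1 ≤ k → ∀ A x y → IsFlag (k ∸ 1) A x y → IsEdge k (ins A x , ins A y)
flag-edge (suc j) _ A x y (∣A∣ , Ax , Ay , x≢y) =
  trans (∣ins∣ A x Ax) (cong suc ∣A∣) , trans (∣ins∣ A y Ay) (cong suc ∣A∣) , trans (cong ∣_∣ (ins-∩ A Ax Ay x≢y)) ∣A∣

∧⁻ : ∀ {b c} → b ∧ c ≡ true → b ≡ true × c ≡ true
∧⁻ {true} {true} _ = refl , refl

edge-flag : ∀ k → 1 ≤ k → ∀ e → IsEdge k e → ∃ λ A → ∃ λ x → ∃ λ y → IsFlag (k ∸ 1) A x y × e ≡ (ins A x , ins A y)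
edge-flag (suc j) _ (u , v) (∣u∣ , ∣v∣ , ∣u∩v∣) = build (pick u A (lt u ∣u∣)) (pick v A (lt v ∣v∣))
  where
  A : Subset _
  A = u ∩ v
  lt : ∀ w → ∣ w ∣ ≡ suc j → ∣ A ∣ < ∣ w ∣
  lt w eq = subst₂ _<_ (sym ∣u∩v∣) (sym eq) ℕₚ.≤-refl
  A⁻ : ∀ {i} → A ∋ i → u ∋ i × v ∋ i
  A⁻ {i} p = ∧⁻ (trans (sym (lookup-zipWith _∧_ i u v)) p)
  grow : ∀ {w x} → (∀ {i} → A ∋ i → w ∋ i) → w ∋ x → A ∌ x → ∣ w ∣ ≡ suc j → ins A x ≡ w
  grow {w} {x} A⊑w wx Ax eq = ⊑-∣∣≡ {A = ins A x} {w} s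
    (ℕₚ.≤-reflexive (trans eq (sym (trans (∣ins∣ A x Ax) (cong suc ∣u∩v∣)))))
    where
    s : ins A x ⊑ w
    s p with ins⁻ A x p
    ... | inj₁ refl = wx
    ... | inj₂ q    = A⊑w q
  build : (∃ λ x → u ∋ x × A ∌ x) → (∃ λ y → v ∋ y × A ∌ y) →
    ∃ λ A → ∃ λ x → ∃ λ y → IsFlag j A x y × (u , v) ≡ (ins A x , ins A y)
  build (x , ux , Ax) (y , vy , Ay) = A , x , y , (∣u∩v∣ , Ax , Ay , x≢y) ,
    cong₂ _,_ (sym (grow (λ p → proj₁ (A⁻ p)) ux Ax ∣u∣)) (sym (grow (λ p → proj₂ (A⁻ p)) vy Ay ∣v∣))
    where
    x≢y : x ≢ y
    x≢y refl = ∋-∌ {A = A} (trans (lookup-zipWith _∧_ x u v) (cong₂ _∧_ ux vy)) Ax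

module _ {k : ℕ} (G : Aut k → Set) (sub : IsSubgroup k G) where
  open IsSubgroup sub

  -- G is not assumed to be closed under pointwise equality of permutations, so close it.
  infix 4 _∈Ĝ
  _∈Ĝ : Aut k → Set
  (σ , b) ∈Ĝ = ∃ λ π → G (π , b) × π ≈ σ

  Ĝ-∙ : ∀ {σ b π c} → (σ , b) ∈Ĝ → (π , c) ∈Ĝ → (σ ∙ π , b xor c) ∈Ĝ
  Ĝ-∙ {σ = σ} (σ′ , Gσ , eσ) (π′ , Gπ , eπ) = σ′ ∙ π′ , ·∈ Gσ Gπ , λ i → trans (eσ _) (cong (σ ⟨$⟩ʳ_) (eπ i))

  Ĝ-inv : ∀ {σ b} → (σ , b) ∈Ĝ → (flip σ , b) ∈Ĝ
  Ĝ-inv {σ} (σ′ , Gσ , eσ) = flip σ′ , inv∈ Gσ , λ i → inv-of σ′ (trans (eσ (σ ⟨$⟩ˡ i)) (inverseʳ σ))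

  Ĝ-resp : ∀ {σ π b} → σ ≈ π → (σ , b) ∈Ĝ → (π , b) ∈Ĝ
  Ĝ-resp eq (σ′ , Gσ , eσ) = σ′ , Gσ , λ i → trans (eσ i) (eq i)

  Ĥ : Permutation′ (k + k) → Set
  Ĥ σ = (σ , false) ∈Ĝ

  Ĥ-group : IsPermGroup Ĥ
  Ĥ-group = record
    { resp = λ {σ} {π} → Ĝ-resp {σ} {π}
    ; id∈  = idₚ , one∈ , (λ _ → refl)
    ; ∙∈   = λ {σ} {π} → Ĝ-∙ {σ} {false} {π} {false}
    ; inv∈ = λ {σ} → Ĝ-inv {σ} }

  -- The set `A` is the intersection of the two ends of the arc, and `x` is the point of the first
  -- end missing from the second, so the image of the arc determines the image of the flag.
  Ĥ-flags : 1 ≤ k → ArcTransitive k (InSym k G) → FlagTransitive Ĥ (k ∸ 1)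
  Ĥ-flags 1≤k arc A x y A′ x′ y′ f@(∣A∣ , Ax , Ay , x≢y) f′@(∣A′∣ , A′x′ , A′y′ , x′≢y′) =
    from (arc (ins A x) (ins A y) (ins A′ x′) (ins A′ y′) (flag-edge k 1≤k A x y f) (flag-edge k 1≤k A′ x′ y′ f′))
    where
    from : (∃[ g ] (InSym k G g × act k g (ins A x) ≡ ins A′ x′ × act k g (ins A y) ≡ ins A′ y′)) →
      ∃ λ σ → Ĥ σ × permute σ A ≡ A′ × σ ⟨$⟩ʳ x ≡ x′ × σ ⟨$⟩ʳ y ≡ y′
    from ((σ , .false) , (Gσ , refl) , eu , ev) = σ , (σ , Gσ , (λ _ → refl)) ,
        trans (cong (permute σ) (sym (ins-∩ A Ax Ay x≢y)))
          (trans (permute-zipWith _∧_ σ (ins A x) (ins A y)) (trans (cong₂ _∩_ eu ev) (ins-∩ A′ A′x′ A′y′ x′≢y′))) ,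
        point x y x′ y′ Ax x≢y eu ev , point y x y′ x′ Ay (x≢y ∘ sym) ev eu
      where
      point : ∀ x y x′ y′ → A ∌ x → x ≢ y → permute σ (ins A x) ≡ ins A′ x′ → permute σ (ins A y) ≡ ins A′ y′ → σ ⟨$⟩ʳ x ≡ x′
      point x y x′ y′ Ax x≢y eu ev with ins⁻ A′ x′ (permute-∋ σ {ins A x} eu (ins-self A x))
      ... | inj₁ eq = eq
      ... | inj₂ p  = ⊥-elim (∋-∌ {A = ins A′ y′} (ins-⊒ A′ y′ p)
              (subst (_∌ (σ ⟨$⟩ʳ x)) ev (trans (lookup-permute σ (ins A y) x) (ins-∌ A x≢y Ax))))

Dichotomy : (k : ℕ) (R S : Pair k → Pair k → Set) → Set
Dichotomy k R S = (∀ e e′ → S e e′ → R e e′) ⊎ (∀ e e′ → IsEdge k e → IsEdge k e′ → S e e′)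

-- The symmetric difference of the ends: `{x, y}` for the edge from `A ∪ x` to `A ∪ y`.
-- Complementing both ends does not change it.
pairOf : ∀ {k} → Pair k → Subset (X k)
pairOf (u , v) = zipWith _xor_ u v

lookup-pairOf : ∀ {k} (e : Pair k) i → lookup (pairOf {k} e) i ≡ lookup (proj₁ e) i xor lookup (proj₂ e) i
lookup-pairOf (u , v) i = lookup-zipWith _xor_ i u v

xor-not : ∀ a b → not a xor not b ≡ a xor b
xor-not true  true  = refl
xor-not true  false = refl
xor-not false true  = refl
xor-not false false = refl

pairOf-compP : ∀ {k} (e : Pair k) → pairOf {k} (compP {k} e) ≡ pairOf {k} e
pairOf-compP {k} (u , v) = lookup-ext λ i → trans (lookup-zipWith _xor_ i (∁ u) (∁ v))
  (trans (cong₂ _xor_ (lookup-map i not u) (lookup-map i not v))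
    (trans (xor-not (lookup u i) (lookup v i)) (sym (lookup-zipWith _xor_ i u v))))

pairOf-permP : ∀ {k} σ (e : Pair k) → pairOf {k} (permP {k} σ e) ≡ permute σ (pairOf {k} e)
pairOf-permP σ (u , v) = sym (permute-zipWith _xor_ σ u v)

pairOf-actP : ∀ {k} g (e : Pair k) → pairOf {k} (actP k g e) ≡ permute (proj₁ g) (pairOf {k} e)
pairOf-actP {k} (σ , false) e = pairOf-permP {k} σ e
pairOf-actP {k} (σ , true)  e = trans (pairOf-compP {k} (permP {k} σ e)) (pairOf-permP {k} σ e)

xor-self : ∀ b → b xor b ≡ false
xor-self true  = refl
xor-self false = refl

pairOf-flag-∌ : ∀ {k} A (x y : Fin (X k)) {i} → i ≢ x → i ≢ y → pairOf {k} (ins A x , ins A y) ∌ i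
pairOf-flag-∌ {k} A x y {i} i≢x i≢y = trans (lookup-pairOf {k} (ins A x , ins A y) i)
  (trans (cong₂ _xor_ (lookup-ins A i≢x) (lookup-ins A i≢y)) (xor-self (lookup A i)))

pairOf-flag-∋ : ∀ {k} A (x y : Fin (X k)) → x ≢ y → A ∌ x → pairOf {k} (ins A x , ins A y) ∋ x
pairOf-flag-∋ {k} A x y x≢y Ax = trans (lookup-pairOf {k} (ins A x , ins A y) x)
  (cong₂ _xor_ (ins-self A x) (trans (lookup-ins A x≢y) Ax))

SamePair : (k : ℕ) → Pair k → Pair k → Set
SamePair k e e′ = IsEdge k e × IsEdge k e′ × pairOf {k} e ≡ pairOf {k} e′

SamePair-partition : ∀ k → IsEdgePartition k (SamePair k)
SamePair-partition k = record
  { onEdges = λ e e′ (p , q , _) → p , q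
  ; refl    = λ e p → p , p , refl
  ; sym     = λ e e′ (p , q , eq) → q , p , sym eq
  ; trans   = λ e e′ e″ (p , _ , eq) (_ , q , eq′) → p , q , trans eq eq′
  ; unord   = λ u v p → p , flipped u v p , lookup-ext λ i → trans (lookup-zipWith _xor_ i u v)
      (trans (xor-comm (lookup u i) (lookup v i)) (sym (lookup-zipWith _xor_ i v u))) }
  where
  flipped : ∀ u v → IsEdge k (u , v) → IsEdge k (v , u)
  flipped u v (p , q , r) = q , p , trans (cong ∣_∣ (∩-comm v u)) r

-- Classical logic from primitivity, and groups containing τ

module Reduction (k : ℕ) (2≤k : 2 ≤ k) (G : Aut k → Set) (sub : IsSubgroup k G)
  (R : Pair k → Pair k → Set) (decomp : IsDecomposition k R) (R-inv : Preserves k G R)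
  (prim : (S : Pair k → Pair k → Set) → IsEdgePartition k S → (∀ e e′ → R e e′ → S e e′) → Preserves k G S → Dichotomy k R S) where

  open IsSubgroup sub
  open IsDecomposition decomp
  module R = IsEdgePartition partition

  1≤k : 1 ≤ k
  1≤k = ℕₚ.≤-trans (s≤s z≤n) 2≤k

  R-act : ∀ g → G g → Invariant {k} g R
  R-act g Gg e e′ = Equivalence.to (R-inv g Gg e e′)

  -- A partition R that is primitive in the sense of Defs decides every proposition Q:
  -- the partition R ∨ (Q → one part) is either R or total.
  lem : Classical
  lem Q = from (prim S partition-S (λ e e′ r → proj₁ (R.onEdges e e′ r) , proj₂ (R.onEdges e e′ r) , inj₁ r)
                  (preserves sub λ g Gg e e′ (p , q , rq) → IsEdge-actP {k} g e p , IsEdge-actP {k} g e′ q , map₁ (R-act g Gg e e′) rq))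
    where
    S : Pair k → Pair k → Set
    S e e′ = IsEdge k e × IsEdge k e′ × (R e e′ ⊎ Q)
    join : ∀ e e′ e″ → R e e′ ⊎ Q → R e′ e″ ⊎ Q → R e e″ ⊎ Q
    join e e′ e″ (inj₁ r) (inj₁ r′) = inj₁ (R.trans e e′ e″ r r′)
    join e e′ e″ (inj₂ q) _         = inj₂ q
    join e e′ e″ (inj₁ _) (inj₂ q)  = inj₂ q
    partition-S : IsEdgePartition k S
    partition-S = record
      { onEdges = λ e e′ (p , q , _) → p , q
      ; refl    = λ e p → p , p , inj₁ (R.refl e p)
      ; sym     = λ e e′ (p , q , rq) → q , p , map₁ (R.sym e e′) rq
      ; trans   = λ e e′ e″ (p , _ , rq) (_ , q , rq′) → p , q , join e e′ e″ rq rq′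
      ; unord   = λ u v p → p , proj₂ (R.onEdges _ _ (R.unord u v p)) , inj₁ (R.unord u v p) }
    from : Dichotomy k R S → Q ⊎ ¬ Q
    from d with twoParts
    ... | e , e′ , p , p′ , ¬r with d
    ... | inj₁ S⊆R = inj₂ λ q → ¬r (S⊆R e e′ (p , p′ , inj₂ q))
    ... | inj₂ total with total e e′ p p′
    ... | _ , _ , inj₁ r = ⊥-elim (¬r r)
    ... | _ , _ , inj₂ q = inj₁ q

  InĜ : Aut k → Set
  InĜ g = _∈Ĝ G sub g

  InĤ : Permutation′ (k + k) → Set
  InĤ = Ĥ G sub

  not-total : ¬ (∀ e e′ → IsEdge k e → IsEdge k e′ → R e e′)
  not-total total with twoParts
  ... | e , e′ , p , p′ , ¬r = ¬r (total e e′ p p′)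

  act-≈ : ∀ {S} b {σ π} → σ ≈ π → Invariant {k} (σ , b) S → Invariant {k} (π , b) S
  act-≈ {S} false {σ} {π} eq i e e′ s = subst₂ S (permP-cong {k} {σ} {π} eq e) (permP-cong {k} {σ} {π} eq e′) (i e e′ s)
  act-≈ {S} true  {σ} {π} eq i e e′ s =
    subst₂ S (cong (compP {k}) (permP-cong {k} {σ} {π} eq e)) (cong (compP {k}) (permP-cong {k} {σ} {π} eq e′)) (i e e′ s)

  R-Ĝ : ∀ {σ b} → InĜ (σ , b) → Invariant {k} (σ , b) R
  R-Ĝ {σ} {b} (π , Gπ , eq) = act-≈ {R} b {π} {σ} eq (R-act (π , b) Gπ)

  module Coarser (S : Pair k → Pair k → Set) (S-part : IsEdgePartition k S) (R⊆S : ∀ e e′ → R e e′ → S e e′)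
                 (S-inv : Preserves k (InSym k G) S) where
    module S = IsEdgePartition S-part

    S-Ĥ : ∀ {σ} → InĤ σ → Invariant {k} (σ , false) S
    S-Ĥ {σ} (π , Gπ , eq) = act-≈ {S} false {π} {σ} eq λ e e′ → Equivalence.to (S-inv (π , false) (Gπ , refl) e e′)

    from-invariance : (∀ σ → G (σ , true) → Invariant {k} (σ , true) S) → Dichotomy k R S
    from-invariance S-inv-τ = prim S S-part R⊆S (preserves sub all)
      where
      all : ∀ g → G g → Invariant {k} g S
      all (σ , true)  Gσ = S-inv-τ σ Gσ
      all (σ , false) Gσ = S-Ĥ {σ} (σ , Gσ , λ _ → refl)

    module WithComplement (τ∈ : InĜ (idₚ , true)) where

      Complementary : Pair k → Pair k → Set
      Complementary e e′ = R e e′ ⊎ R e (compP {k} e′)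

      R-comp : ∀ e e′ → R e e′ → R (compP {k} e) (compP {k} e′)
      R-comp e e′ r = subst₂ R (cong (compP {k}) (permP-id {k} {idₚ} (λ _ → refl) e)) (cong (compP {k}) (permP-id {k} {idₚ} (λ _ → refl) e′)) (R-Ĝ {idₚ} {true} τ∈ e e′ r)

      R-comp′ : ∀ e e′ → R e (compP {k} e′) → R (compP {k} e) e′
      R-comp′ e e′ r = subst (R (compP {k} e)) (compP-involutive {k} e′) (R-comp e (compP {k} e′) r)

      comp-edge⁻ : ∀ e → IsEdge k (compP {k} e) → IsEdge k e
      comp-edge⁻ e p = subst (IsEdge k) (compP-involutive {k} e) (IsEdge-compP {k} (compP {k} e) p)

      Complementary-trans : ∀ e e′ e″ → Complementary e e′ → Complementary e′ e″ → Complementary e e″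
      Complementary-trans e e′ e″ (inj₁ r) (inj₁ r′) = inj₁ (R.trans _ _ _ r r′)
      Complementary-trans e e′ e″ (inj₁ r) (inj₂ r′) = inj₂ (R.trans _ _ _ r r′)
      Complementary-trans e e′ e″ (inj₂ r) (inj₁ r′) = inj₂ (R.trans _ _ _ r (R-comp e′ e″ r′))
      Complementary-trans e e′ e″ (inj₂ r) (inj₂ r′) = inj₁ (R.trans _ _ _ r (R-comp′ e′ e″ r′))

      Complementary-partition : IsEdgePartition k Complementary
      Complementary-partition = record
        { onEdges = λ { e e′ (inj₁ r) → R.onEdges e e′ r
                      ; e e′ (inj₂ r) → proj₁ (R.onEdges _ _ r) , comp-edge⁻ e′ (proj₂ (R.onEdges _ _ r)) }
        ; refl    = λ e p → inj₁ (R.refl e p)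
        ; sym     = λ { e e′ (inj₁ r) → inj₁ (R.sym e e′ r)
                      ; e e′ (inj₂ r) → inj₂ (R.sym _ _ (R-comp′ e e′ r)) }
        ; trans   = Complementary-trans
        ; unord   = λ u v p → inj₁ (R.unord u v p) }

      act-comp : ∀ g e → actP k g (compP {k} e) ≡ compP {k} (actP k g e)
      act-comp (σ , false) e = permP-compP {k} σ e
      act-comp (σ , true)  e = cong (compP {k}) (permP-compP {k} σ e)

      conclusion : Dichotomy k R S
      conclusion = from (prim Complementary Complementary-partition (λ _ _ → inj₁) (preserves sub C-inv))
        where
        C-inv : ∀ g → G g → Invariant {k} g Complementary
        C-inv g Gg e e′ (inj₁ r) = inj₁ (R-act g Gg e e′ r)
        C-inv g Gg e e′ (inj₂ r) = inj₂ (subst (R (actP k g e)) (act-comp g e′) (R-act g Gg e (compP {k} e′) r))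
        from : Dichotomy k R Complementary → Dichotomy k R S
        -- Every edge is `R`-equivalent to its complement, hence `S`-equivalent, and removing `τ`
        -- from `(σ , true)` leaves an element of `Ĥ`.
        from (inj₁ C⊆R) = from-invariance λ σ Gσ e e′ s →
            let self = λ e p → R⊆S _ _ (C⊆R e (compP {k} e) (inj₂ (subst (R e) (sym (compP-involutive {k} e)) (R.refl e p))))
                Hσ : InĤ σ
                Hσ = Ĝ-resp G sub {σ ∙ idₚ} {σ} (λ _ → refl) (Ĝ-∙ G sub {σ} {true} {idₚ} {true} (σ , Gσ , λ _ → refl) τ∈)
                s′ = S-Ĥ {σ} Hσ e e′ s
                p , p′ = S.onEdges _ _ s′
            in S.trans _ _ _ (S.sym _ _ (self _ p)) (S.trans _ _ _ s′ (self _ p′))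
        -- Here R has two parts, so S has at most two.
        from (inj₂ total) = classify (lem (∃₂ λ e e′ → S e e′ × ¬ R e e′))
          where
          classify : (∃₂ λ e e′ → S e e′ × ¬ R e e′) ⊎ ¬ (∃₂ λ e e′ → S e e′ × ¬ R e e′) → Dichotomy k R S
          classify (inj₂ none) = inj₁ λ e e′ s → decide e e′ s (lem (R e e′))
            where
            decide : ∀ e e′ → S e e′ → R e e′ ⊎ ¬ R e e′ → R e e′
            decide e e′ s (inj₁ r)  = r
            decide e e′ s (inj₂ ¬r) = ⊥-elim (none (e , e′ , s , ¬r))
          classify (inj₁ (e , e′ , s , ¬r)) = inj₂ λ f f′ p p′ → S.trans f e f′ (S.sym e f (near f p)) (near f′ p′)
            where
            e-edge = proj₁ (S.onEdges e e′ s)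
            e′-edge = proj₂ (S.onEdges e e′ s)
            -- If `f` is not joined to `e` directly, then `e` is `R`-related to the complements of
            -- both `e′` and `f`, and complementing back relates `e′` to `f`.
            near : ∀ f → IsEdge k f → S e f
            near f p with total e f e-edge p | total e e′ e-edge e′-edge
            ... | inj₁ r | _ = R⊆S e f r
            ... | inj₂ _ | inj₁ r′ = ⊥-elim (¬r r′)
            ... | inj₂ r | inj₂ r′ = S.trans e e′ f s (R⊆S e′ f (subst₂ R (compP-involutive {k} e′) (compP-involutive {k} f)
                (R-comp _ _ (R.trans _ _ _ (R.sym _ _ r′) r))))

-- An element fixing 0 and exchanging 1 and 2 has no choice left at 3. So a 3-transitive group of
-- degree four contains a transposition. The equation `2 ≡ k` is an argument so that matching on it
-- turns the degree into a numeral.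
degree-four-transposition : ∀ k → 2 ≤ k → 2 ≡ k → ∀ {H : Permutation′ (k + k) → Set} → (∀ i j → i ≢ j → ¬ H (transpose i j)) →
  (∀ p q r p′ q′ r′ → p ≢ q → p ≢ r → q ≢ r → p′ ≢ q′ → p′ ≢ r′ → q′ ≢ r′ →
    ∃ λ σ → H σ × σ ⟨$⟩ʳ p ≡ p′ × σ ⟨$⟩ʳ q ≡ q′ × σ ⟨$⟩ʳ r ≡ r′) → (∀ {σ π} → σ ≈ π → H σ → H π) → ⊥
degree-four-transposition .2 _ refl {H} none trans₃ resp = from (trans₃ zero 1F 2F zero 2F 1F (λ ()) (λ ()) (λ ()) (λ ()) (λ ()) (λ ()))
  where
  from : (∃ λ σ → H σ × σ ⟨$⟩ʳ zero ≡ zero × σ ⟨$⟩ʳ 1F ≡ 2F × σ ⟨$⟩ʳ 2F ≡ 1F) → ⊥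
  from (σ , Hσ , σ0 , σ1 , σ2) = none 1F 2F (λ ()) (resp {σ} {transpose 1F 2F} same Hσ)
    where
    last : ∀ x → σ ⟨$⟩ʳ 3F ≡ x → x ≡ 3F
    last zero eq with () ← perm-inj σ {3F} {zero} (trans eq (sym σ0))
    last 1F   eq with () ← perm-inj σ {3F} {2F} (trans eq (sym σ2))
    last 2F   eq with () ← perm-inj σ {3F} {1F} (trans eq (sym σ1))
    last 3F   eq = refl
    same : σ ≈ transpose 1F 2F
    same zero = σ0
    same 1F   = σ1
    same 2F   = σ2
    same 3F   = last _ refl

-- Groups G without τ that are larger than H

module Twisted (k : ℕ) (2≤k : 2 ≤ k) (G : Aut k → Set) (sub : IsSubgroup k G)
  (R : Pair k → Pair k → Set) (decomp : IsDecomposition k R) (R-inv : Preserves k G R)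
  (prim : (S : Pair k → Pair k → Set) → IsEdgePartition k S → (∀ e e′ → R e e′ → S e e′) → Preserves k G S → Dichotomy k R S)
  (arc : ArcTransitive k (InSym k G)) (ρ : Permutation′ (k + k)) (Gρ : G (ρ , true)) (τ∉ : ¬ (_∈Ĝ G sub (idₚ , true))) where

  open Reduction k 2≤k G sub R decomp R-inv prim

  Ĥ-grp : IsPermGroup InĤ
  Ĥ-grp = Ĥ-group G sub

  open IsPermGroup Ĥ-grp

  n : ℕ
  n = k + k

  2+k∸1≤n : 2 + (k ∸ 1) ≤ n
  2+k∸1≤n = ℕₚ.≤-trans (ℕₚ.+-monoʳ-≤ 2 (ℕₚ.m∸n≤m k 1)) (ℕₚ.+-monoˡ-≤ k 2≤k)

  flags : ∀ j → j < k → FlagTransitive InĤ j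
  flags j j<k = Flags.flags-below lem InĤ Ĥ-grp (k ∸ 1) j (room k 1≤k) (ℕₚ.∸-monoˡ-≤ 1 j<k) (Ĥ-flags G sub 1≤k arc)
    where
    room : ∀ k → 1 ≤ k → 2 + ((k ∸ 1) + (k ∸ 1)) ≤ k + k
    room (suc k) _ = ℕₚ.≤-reflexive (cong suc (sym (ℕₚ.+-suc k k)))

  rotations : AllThreeCycles InĤ
  rotations = all-three-cycles k 2≤k lem InĤ Ĥ-grp flags

  parity : ∀ σ → InĤ σ ⊎ (∀ i j → i ≢ j → InĤ (σ ∙ transpose i j))
  parity = Parity.parity InĤ Ĥ-grp rotations

  odd-∉ : ∀ {σ} → InĜ (σ , true) → ¬ InĤ σ
  odd-∉ {σ} Gσ Hσ = τ∉ (Ĝ-resp G sub {flip σ ∙ σ} {idₚ} (λ i → inverseˡ σ) (Ĝ-∙ G sub {flip σ} {false} {σ} {true} (inv∈ {σ} Hσ) Gσ))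

  ρ∈ : InĜ (ρ , true)
  ρ∈ = ρ , Gρ , λ _ → refl

  -- Since `ρ` is not in `Ĥ`, `parity` puts `ρ (i j)` there; cancelling it against `(ρ , true)`
  -- leaves `(i j)` paired with `τ`.
  odd-transposition : ∀ i j → i ≢ j → InĜ (transpose i j , true)
  odd-transposition i j i≢j = from (parity ρ)
    where
    from : InĤ ρ ⊎ (∀ i j → i ≢ j → InĤ (ρ ∙ transpose i j)) → InĜ (transpose i j , true)
    from (inj₁ Hρ) = ⊥-elim (odd-∉ {ρ} ρ∈ Hρ)
    from (inj₂ h) = Ĝ-resp G sub {flip (ρ ∙ transpose i j) ∙ ρ} {transpose i j}
      (λ x → trans (cong (transpose i j ⟨$⟩ˡ_) (inverseˡ ρ)) (transpose-sym j i x))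
      (Ĝ-∙ G sub {flip (ρ ∙ transpose i j)} {false} {ρ} {true} (inv∈ {ρ ∙ transpose i j} (h i j i≢j)) ρ∈)

  no-transposition : ∀ i j → i ≢ j → ¬ InĤ (transpose i j)
  no-transposition i j i≢j = odd-∉ {transpose i j} (odd-transposition i j i≢j)

  3≤k : 3 ≤ k
  3≤k = from (ℕₚ.m≤n⇒m<n∨m≡n 2≤k)
    where
    from : 2 < k ⊎ 2 ≡ k → 3 ≤ k
    from (inj₁ lt) = lt
    from (inj₂ 2≡k) = ⊥-elim (degree-four-transposition k 2≤k 2≡k no-transposition
      (λ p q r p′ q′ r′ → Bases.3-transitive k 2≤k lem InĤ Ĥ-grp flags p q r p′ q′ r′) (λ {σ} {π} → resp {σ} {π}))

  SamePair-preserved : Preserves k G (SamePair k)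
  SamePair-preserved = preserves sub λ g _ e e′ (p , q , eq) → IsEdge-actP {k} g e p , IsEdge-actP {k} g e′ q ,
    trans (pairOf-actP {k} g e) (trans (cong (permute (proj₁ g)) eq) (sym (pairOf-actP {k} g e′)))

  SamePair-not-total : ¬ (∀ e e′ → IsEdge k e → IsEdge k e′ → SamePair k e e′)
  SamePair-not-total total = from (four-points (ℕₚ.+-mono-≤ 2≤k 2≤k))
    where
    from : (∃ λ (p : Fin n) → ∃ λ q → ∃ λ r → ∃ λ s → p ≢ q × p ≢ r × q ≢ r × p ≢ s × q ≢ s × r ≢ s) → ⊥
    from (p , q , r , s , p≢q , p≢r , q≢r , _) =
      let A , fA = Flags.flag-of-size lem InĤ Ĥ-grp (k ∸ 1) p q p≢q 2+k∸1≤n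
          B , fB = Flags.flag-of-size lem InĤ Ĥ-grp (k ∸ 1) r q (q≢r ∘ sym) 2+k∸1≤n
          _ , _ , eq = total (ins A p , ins A q) (ins B r , ins B q) (flag-edge k 1≤k A p q fA) (flag-edge k 1≤k B r q fB)
      in ∋-∌ {A = pairOf {k} (ins A p , ins A q)} (pairOf-flag-∋ {k} A p q p≢q (proj₁ (proj₂ fA)))
           (subst (_∌ p) (sym eq) (pairOf-flag-∌ {k} B r q p≢r p≢q))

  -- `SamePair` is itself a `G`-invariant partition and not total, so primitivity allows it to be no
  -- coarser than `R`.
  R⊆SamePair⇒SamePair⊆R : (∀ e e′ → R e e′ → SamePair k e e′) → ∀ e e′ → SamePair k e e′ → R e e′
  R⊆SamePair⇒SamePair⊆R R⊆T = from (prim (SamePair k) (SamePair-partition k) R⊆T SamePair-preserved)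
    where
    from : Dichotomy k R (SamePair k) → ∀ e e′ → SamePair k e e′ → R e e′
    from (inj₁ T⊆R)   = T⊆R
    from (inj₂ total) = ⊥-elim (SamePair-not-total total)

  -- Two pairs cover at most four points, and `3 ≤ k` gives at least six.
  two-outside : ∀ (e e′ : Pair k) → IsEdge k e → IsEdge k e′ → ∃₂ λ i j → i ≢ j ×
    pairOf {k} e ∌ i × pairOf {k} e ∌ j × pairOf {k} e′ ∌ i × pairOf {k} e′ ∌ j
  two-outside e e′ p p′ = from (edge-flag k 1≤k e p) (edge-flag k 1≤k e′ p′)
    where
    from : (∃ λ A → ∃ λ x → ∃ λ y → IsFlag (k ∸ 1) A x y × e ≡ (ins A x , ins A y)) →
           (∃ λ A → ∃ λ x → ∃ λ y → IsFlag (k ∸ 1) A x y × e′ ≡ (ins A x , ins A y)) →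
           ∃₂ λ i j → i ≢ j × pairOf {k} e ∌ i × pairOf {k} e ∌ j × pairOf {k} e′ ∌ i × pairOf {k} e′ ∌ j
    from (A , x , y , _ , refl) (B , z , w , _ , refl) =
      let i , i∌ = fresh P (ℕₚ.≤-trans (s≤s ∣P∣) (ℕₚ.≤-trans (ℕₚ.n≤1+n 5) 6≤n))
          j , j∌ = fresh (ins P i) (ℕₚ.≤-trans (s≤s (ℕₚ.≤-trans (∣ins∣≤ P i) (s≤s ∣P∣))) 6≤n)
          j≢i , j∌′ = ins-∌⁻ P j∌
          (ix , iy , iz , iw) = off i i∌
          (jx , jy , jz , jw) = off j j∌′
      in i , j , j≢i ∘ sym , pairOf-flag-∌ {k} A x y ix iy , pairOf-flag-∌ {k} A x y jx jy ,
         pairOf-flag-∌ {k} B z w iz iw , pairOf-flag-∌ {k} B z w jz jw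
      where
      6≤n : 6 ≤ n
      6≤n = ℕₚ.+-mono-≤ 3≤k 3≤k
      P₁ P₂ P₃ P : Subset n
      P₁ = ins (∅ n) x
      P₂ = ins P₁ y
      P₃ = ins P₂ z
      P  = ins P₃ w
      ∣P∣ : ∣ P ∣ ≤ 4
      ∣P∣ = ins-≤ P₃ w (ins-≤ P₂ z (ins-≤ P₁ y (ins-≤ (∅ n) x (ℕₚ.≤-reflexive (∣∅∣ n)))))
      off : ∀ i → P ∌ i → i ≢ x × i ≢ y × i ≢ z × i ≢ w
      off i i∌ =
        let a , q = ins-∌⁻ P₃ i∌
            b , q = ins-∌⁻ P₂ q
            c , q = ins-∌⁻ P₁ q
            d , _ = ins-∌⁻ (∅ n) q
        in d , c , b , a

  twist : Fin n → Fin n → Pair k → Pair k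
  twist i j e = compP {k} (permP {k} (transpose i j) e)

  twist-edge : ∀ i j e → IsEdge k e → IsEdge k (twist i j e)
  twist-edge i j e p = IsEdge-actP {k} (transpose i j , true) e p

  permute-transpose : ∀ i j (A : Subset n) → A ∌ i → A ∌ j → permute (transpose i j) A ≡ A
  permute-transpose i j A Ai Aj = permute-unique (transpose i j) A A λ l → cases l (l ≟ i) (l ≟ j)
    where
    cases : ∀ l → Dec (l ≡ i) → Dec (l ≡ j) → lookup A (transpose i j ⟨$⟩ʳ l) ≡ lookup A l
    cases l (yes refl) _          = trans (cong (lookup A) (transpose-left l j)) (trans Aj (sym Ai))
    cases l (no _)     (yes refl) = trans (cong (lookup A) (transpose-right i l)) (trans Ai (sym Aj))
    cases l (no l≢i)   (no l≢j)   = cong (lookup A) (transpose-off i j l≢i l≢j)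

  arc-move : ∀ e e′ → IsEdge k e → IsEdge k e′ → ∃ λ σ → InĤ σ × permP {k} σ e ≡ e′
  arc-move (u , v) (u′ , v′) p p′ = from (arc u v u′ v′ p p′)
    where
    from : (∃[ g ] (InSym k G g × act k g u ≡ u′ × act k g v ≡ v′)) → ∃ λ σ → InĤ σ × permP {k} σ (u , v) ≡ (u′ , v′)
    from ((σ , .false) , (Gσ , refl) , eu , ev) = σ , (σ , Gσ , λ _ → refl) , cong₂ _,_ eu ev

  -- The subgroup Z of Ĥ fixing the part of S that contains e.
  module PartStabiliser (S : Pair k → Pair k → Set) (S-part : IsEdgePartition k S)
      (S-Ĥ : ∀ {σ} → InĤ σ → Invariant {k} (σ , false) S) (e : Pair k) (e-edge : IsEdge k e) where
    module S = IsEdgePartition S-part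

    Z : Permutation′ n → Set
    Z σ = InĤ σ × S e (permP {k} σ e)

    Z-grp : IsPermGroup Z
    Z-grp = record
      { resp = λ {σ} {π} eq (Hσ , r) → resp {σ} {π} eq Hσ , subst (S e) (permP-cong {k} {σ} {π} eq e) r
      ; id∈  = id∈ , subst (S e) (sym (permP-id {k} {idₚ} (λ _ → refl) e)) (S.refl e e-edge)
      ; ∙∈   = λ {σ} {π} (Hσ , r) (Hπ , r′) → ∙∈ {σ} {π} Hσ Hπ ,
                 subst (S e) (sym (permP-∙ {k} σ π e)) (S.trans _ _ _ r (S-Ĥ {σ} Hσ _ _ r′))
      ; inv∈ = λ {σ} (Hσ , r) → inv∈ {σ} Hσ ,
                 S.sym _ _ (subst (S _) (permP-flip {k} σ e) (S-Ĥ {flip σ} (inv∈ {σ} Hσ) _ _ r)) }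

    Z-fixing : ∀ {σ f} → S e f → InĤ σ → permP {k} σ f ≡ f → Z σ
    Z-fixing {σ} r Hσ eq = Hσ , S.trans _ _ _ r (S.sym _ _ (subst (S _) eq (S-Ĥ {σ} Hσ _ _ r)))

    -- The element `(θ , true)` fixes `e` and preserves `S`, so it normalises the stabiliser of the
    -- part of `e`. As `τ` is central, it cancels in the conjugate.
    Z-normalised : ∀ θ → InĜ (θ , true) → Invariant {k} (θ , true) S → actP k (θ , true) e ≡ e →
      ∀ {σ} → Z σ → Z (θ ∙ σ ∙ flip θ)
    Z-normalised θ Gθ S-θ fix {σ} (Hσ , r) =
      Ĝ-∙ G sub {θ} {true} {σ ∙ flip θ} {true} Gθ (Ĝ-∙ G sub {σ} {false} {flip θ} {true} Hσ (Ĝ-inv G sub {θ} {true} Gθ)) ,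
      subst₂ S fix moved (S-θ e (permP {k} σ e) r)
      where
      moved : actP k (θ , true) (permP {k} σ e) ≡ permP {k} (θ ∙ σ ∙ flip θ) e
      moved = trans (cong (compP {k}) (trans (sym (permP-∙ {k} θ σ e))
          (trans (permP-cong {k} {θ ∙ σ} {(θ ∙ σ ∙ flip θ) ∙ θ} (λ i → cong (λ l → θ ⟨$⟩ʳ (σ ⟨$⟩ʳ l)) (sym (inverseˡ θ))) e)
                 (permP-∙ {k} (θ ∙ σ ∙ flip θ) θ e))))
        (trans (sym (permP-compP {k} (θ ∙ σ ∙ flip θ) (permP {k} θ e))) (cong (permP {k} (θ ∙ σ ∙ flip θ)) fix))

  module TwistedCoarser (S : Pair k → Pair k → Set) (S-part : IsEdgePartition k S) (R⊆S : ∀ e e′ → R e e′ → S e e′)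
                        (S-inv : Preserves k (InSym k G) S) where
    open Coarser S S-part R⊆S S-inv

    -- Ĥ has index two in Ĝ, so one odd element suffices, and it may depend on the pair of edges.
    from-twists : (∀ e e′ → S e e′ → ∃₂ λ i j → i ≢ j × S (twist i j e) (twist i j e′)) → Dichotomy k R S
    from-twists h = from-invariance λ σ Gσ e e′ s → go σ Gσ e e′ s (h e e′ s) (parity σ)
      where
      untwist : ∀ σ i j e → permP {k} (σ ∙ transpose i j) (twist i j e) ≡ actP k (σ , true) e
      untwist σ i j e = trans (permP-compP {k} (σ ∙ transpose i j) (permP {k} (transpose i j) e)) (cong (compP {k})
        (trans (sym (permP-∙ {k} (σ ∙ transpose i j) (transpose i j) e))
          (permP-cong {k} {(σ ∙ transpose i j) ∙ transpose i j} {σ} (λ l → cong (σ ⟨$⟩ʳ_) (transpose-involutive i j l)) e)))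
      go : ∀ σ → G (σ , true) → ∀ e e′ → S e e′ → (∃₂ λ i j → i ≢ j × S (twist i j e) (twist i j e′)) →
        InĤ σ ⊎ (∀ i j → i ≢ j → InĤ (σ ∙ transpose i j)) → S (actP k (σ , true) e) (actP k (σ , true) e′)
      go σ Gσ e e′ s _ (inj₁ Hσ) = ⊥-elim (odd-∉ {σ} (σ , Gσ , λ _ → refl) Hσ)
      go σ Gσ e e′ s (i , j , i≢j , s′) (inj₂ Hσ) =
        subst₂ S (untwist σ i j e) (untwist σ i j e′) (S-Ĥ {σ ∙ transpose i j} (Hσ i j i≢j) (twist i j e) (twist i j e′) s′)

    -- With `i` and `j` outside both pairs, each of the two edges has the same pair as its twist, so
    -- it is `S`-equivalent to it.
    same-pair-case : (∀ e e′ → SamePair k e e′ → R e e′) → Dichotomy k R S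
    same-pair-case T⊆R = from-twists λ e e′ s →
      let p , p′ = S.onEdges e e′ s
          i , j , i≢j , ei , ej , e′i , e′j = two-outside e e′ p p′
          related = λ f q fi fj → R⊆S _ _ (T⊆R f (twist i j f) (q , twist-edge i j f q ,
            sym (trans (pairOf-actP {k} (transpose i j , true) f) (permute-transpose i j (pairOf {k} f) fi fj))))
      in i , j , i≢j , S.trans _ _ _ (S.sym _ _ (related e p ei ej)) (S.trans _ _ _ s (related e′ p′ e′i e′j))

-- The case k ≥ 4

cycle-stabilises : ∀ {n} {σ : Permutation′ n} {p q r} (A : Subset n) → ThreeCycle σ p q r →
  lookup A p ≡ lookup A q → lookup A q ≡ lookup A r → permute σ A ≡ A
cycle-stabilises {σ = σ} {p} {q} {r} A (cycle _ _ _ σp σq σr σo) pq qr =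
  permute-unique σ A A λ i → cases i (i ≟ p) (i ≟ q) (i ≟ r)
  where
  cases : ∀ i → Dec (i ≡ p) → Dec (i ≡ q) → Dec (i ≡ r) → lookup A (σ ⟨$⟩ʳ i) ≡ lookup A i
  cases i (yes refl) _ _ = trans (cong (lookup A) σp) (sym pq)
  cases i (no _) (yes refl) _ = trans (cong (lookup A) σq) (sym qr)
  cases i (no _) (no _) (yes refl) = trans (cong (lookup A) σr) (trans pq qr)
  cases i (no i≢p) (no i≢q) (no i≢r) = cong (lookup A) (σo i i≢p i≢q i≢r)

module Links {n} (Z : Permutation′ n → Set) (grp : IsPermGroup Z) where
  open IsPermGroup grp

  Tri : Fin n → Fin n → Fin n → Set
  Tri i j l = ∃ λ σ → Z σ × ThreeCycle σ i j l

  tri-turn : ∀ {i j l} → Tri i j l → Tri j l i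
  tri-turn (σ , Zσ , c) = σ , Zσ , three-cycle-turn c

  tri-flip : ∀ {i j l} → Tri i j l → Tri l j i
  tri-flip (σ , Zσ , c) = flip σ , inv∈ Zσ , three-cycle-flip c

  tri-conj : ∀ {π i j l a b c} → Z π → Tri i j l → π ⟨$⟩ʳ i ≡ a → π ⟨$⟩ʳ j ≡ b → π ⟨$⟩ʳ l ≡ c → Tri a b c
  tri-conj {π} Zπ (σ , Zσ , c) refl refl refl = π ∙ σ ∙ flip π , ∙∈ Zπ (∙∈ Zσ (inv∈ Zπ)) , three-cycle-conj π c

  -- If the points are distinct, conjugating `(i j l)` by `(j k m)` gives `(i k l)`, and conjugating
  -- `(i j l)` by that gives the inverse of `(i j k)`. The coincidences `l = k`, `m = i`, `l = m`
  -- are shorter. This is what makes `Linked` transitive.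
  tri-join : ∀ {i j k l m} → Tri i j l → Tri j k m → i ≢ k → Tri i j k
  tri-join {i} {j} {k} {l} {m} s@(_ , _ , cs) t@(π , Zπ , ct) i≢k with l ≟ k | m ≟ i | l ≟ m
  ... | yes refl | _ | _ = s
  ... | no _ | yes refl | _ = tri-turn (tri-turn t)
  ... | no _ | no _ | yes refl =
    tri-turn (tri-turn (tri-flip (tri-conj Zπ s (T.off i (ThreeCycle.p≢q cs) i≢k (ThreeCycle.p≢r cs)) T.p↦q T.r↦p)))
    where module T = ThreeCycle ct
  ... | no l≢k | no m≢i | no l≢m =
    tri-flip (tri-conj (proj₁ (proj₂ ikl)) s (ThreeCycle.p↦q cikl)
      (ThreeCycle.off cikl j (ThreeCycle.p≢q cs ∘ sym) (ThreeCycle.p≢q ct) (ThreeCycle.q≢r cs))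
      (ThreeCycle.r↦p cikl))
    where
    module T = ThreeCycle ct
    ikl : Tri i k l
    ikl = tri-conj Zπ s (T.off i (ThreeCycle.p≢q cs) i≢k (m≢i ∘ sym)) T.p↦q
            (T.off l (ThreeCycle.q≢r cs ∘ sym) l≢k l≢m)
    cikl = proj₂ (proj₂ ikl)

  Linked : Fin n → Fin n → Set
  Linked i j = i ≡ j ⊎ ∃ λ l → Tri i j l

  linked-sym : ∀ {i j} → Linked i j → Linked j i
  linked-sym (inj₁ eq)      = inj₁ (sym eq)
  linked-sym (inj₂ (l , t)) = inj₂ (l , tri-turn (tri-flip t))

  linked-trans : ∀ {i j k} → Linked i j → Linked j k → Linked i k
  linked-trans (inj₁ refl) q = q
  linked-trans (inj₂ t) (inj₁ refl) = inj₂ t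
  linked-trans {i} {j} {k} (inj₂ (l , s)) (inj₂ (m , t)) with i ≟ k
  ... | yes eq = inj₁ eq
  ... | no i≢k = inj₂ (j , tri-turn (tri-turn (tri-flip (tri-join s t i≢k))))

  linked-map : ∀ {π i j} → (∀ {σ} → Z σ → Z (π ∙ σ ∙ flip π)) → Linked i j → Linked (π ⟨$⟩ʳ i) (π ⟨$⟩ʳ j)
  linked-map {π} nz (inj₁ eq) = inj₁ (cong (π ⟨$⟩ʳ_) eq)
  linked-map {π} nz (inj₂ (l , σ , Zσ , c)) = inj₂ (π ⟨$⟩ʳ l , π ∙ σ ∙ flip π , nz Zσ , three-cycle-conj π c)

  all-linked⇒rotations : (∀ i j → Linked i j) → AllThreeCycles Z
  all-linked⇒rotations linked i j l i≢j j≢l i≢l = from (linked i j) (linked j l)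
    where
    from : Linked i j → Linked j l → Z (rotation i j l)
    from (inj₁ eq) _ = ⊥-elim (i≢j eq)
    from (inj₂ _) (inj₁ eq) = ⊥-elim (j≢l eq)
    from (inj₂ (_ , s)) (inj₂ (_ , t)) =
      let σ , Zσ , c = tri-join s t i≢l in resp {σ} (three-cycle-unique c (rotation-cycle i≢j j≢l i≢l)) Zσ

pairOf-flag : ∀ {k} A (x y : Fin (X k)) → x ≢ y → A ∌ x → A ∌ y → pairOf {k} (ins A x , ins A y) ≡ doubleton x y
pairOf-flag {k} A x y x≢y Ax Ay = lookup-ext λ i → cases i (i ≟ x) (i ≟ y)
  where
  cases : ∀ i → Dec (i ≡ x) → Dec (i ≡ y) → lookup (pairOf {k} (ins A x , ins A y)) i ≡ lookup (doubleton x y) i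
  cases i (yes refl) _ = trans (pairOf-flag-∋ {k} A x y x≢y Ax) (sym (doubleton-left x y))
  cases i (no _) (yes refl) = trans (trans (lookup-pairOf {k} (ins A x , ins A y) i)
    (cong₂ _xor_ (trans (lookup-ins A (x≢y ∘ sym)) Ay) (ins-self A i))) (sym (doubleton-right x y))
  cases i (no i≢x) (no i≢y) = trans (pairOf-flag-∌ {k} A x y i≢x i≢y) (sym (doubleton-∌ i≢x i≢y))

doubleton-swap : ∀ {n} (x y : Fin n) → doubleton x y ≡ doubleton y x
doubleton-swap x y = ⊑-antisym {A = doubleton x y} {doubleton y x} (half x y) (half y x)
  where
  half : ∀ x y → doubleton x y ⊑ doubleton y x
  half x y {i} p with doubleton⁻ x y {i} p
  ... | inj₁ refl = doubleton-right y x
  ... | inj₂ refl = doubleton-left y x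

-- Here `k ≥ 4` enters: `A` (for `b = true`) and the set outside `A`, `x`, `y` (for `b = false`)
-- both have `k − 1 ≥ 3` points, enough for a 3-cycle through two given ones.
class-pick : ∀ k → 4 ≤ k → ∀ A (x y : Fin (X k)) → ∣ A ∣ ≡ k ∸ 1 → ∀ b s t →
  ∃ λ l → l ≢ s × l ≢ t × lookup (ins A x) l ≡ b × lookup (ins A y) l ≡ b
class-pick k 4≤k A x y ∣A∣ true s t =
  let l , Al , l∌ = pick A (doubleton s t) (ℕₚ.≤-trans (s≤s two) (subst (3 ≤_) (sym ∣A∣) (ℕₚ.∸-monoˡ-≤ 1 4≤k)))
      l≢t , l∌′ = ins-∌⁻ (ins (∅ _) s) l∌
      l≢s , _   = ins-∌⁻ (∅ _) l∌′
  in l , l≢s , l≢t , ins-⊒ A x Al , ins-⊒ A y Al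
  where
  two : ∣ doubleton s t ∣ ≤ 2
  two = ℕₚ.≤-trans (∣ins∣≤ (ins (∅ (k + k)) s) t) (s≤s (ℕₚ.≤-trans (∣ins∣≤ (∅ (k + k)) s) (s≤s (ℕₚ.≤-reflexive (∣∅∣ (k + k))))))
class-pick k 4≤k A x y ∣A∣ false s t =
  let l , l∌ = fresh P (ℕₚ.≤-trans (s≤s ∣P∣) (room k 4≤k))
      l≢t , l∌ = ins-∌⁻ P₃ l∌
      l≢s , l∌ = ins-∌⁻ P₂ l∌
      l≢y , l∌ = ins-∌⁻ P₁ l∌
      l≢x , Al = ins-∌⁻ A l∌
  in l , l≢s , l≢t , ins-∌ A l≢x Al , ins-∌ A l≢y Al
  where
  P₁ P₂ P₃ P : Subset (k + k)
  P₁ = ins A x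
  P₂ = ins P₁ y
  P₃ = ins P₂ s
  P  = ins P₃ t
  ∣P∣ : ∣ P ∣ ≤ 4 + (k ∸ 1)
  ∣P∣ = ins-≤ P₃ t (ins-≤ P₂ s (ins-≤ P₁ y (ins-≤ A x (ℕₚ.≤-reflexive ∣A∣))))
  room : ∀ k → 4 ≤ k → suc (4 + (k ∸ 1)) ≤ k + k
  room (suc k) le = ℕₚ.+-monoˡ-≤ (suc k) le

module LargeRank (k : ℕ) (2≤k : 2 ≤ k) (G : Aut k → Set) (sub : IsSubgroup k G)
  (R : Pair k → Pair k → Set) (decomp : IsDecomposition k R) (R-inv : Preserves k G R)
  (prim : (S : Pair k → Pair k → Set) → IsEdgePartition k S → (∀ e e′ → R e e′ → S e e′) → Preserves k G S → Dichotomy k R S)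
  (arc : ArcTransitive k (InSym k G)) (ρ : Permutation′ (k + k)) (Gρ : G (ρ , true)) (τ∉ : ¬ (_∈Ĝ G sub (idₚ , true)))
  (4≤k : 4 ≤ k) where

  open Reduction k 2≤k G sub R decomp R-inv prim
  open Twisted k 2≤k G sub R decomp R-inv prim arc ρ Gρ τ∉

  module _ (A : Subset n) (x y : Fin n) (fA : IsFlag (k ∸ 1) A x y) (C : Subset n) (z w : Fin n) (fC : IsFlag (k ∸ 1) C z w) where
    private
      u v : Subset n
      u = ins A x
      v = ins A y
      e f : Pair k
      e = u , v
      f = ins C z , ins C w

    module _ (Ref : R e f) (¬same : ¬ SamePair k e f) where

      ∣A∣ = proj₁ fA
      A∌x = proj₁ (proj₂ fA)
      A∌y = proj₁ (proj₂ (proj₂ fA))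
      x≢y = proj₂ (proj₂ (proj₂ fA))

      e-edge : IsEdge k e
      e-edge = flag-edge k 1≤k A x y fA

      f-edge : IsEdge k f
      f-edge = flag-edge k 1≤k C z w fC

      open PartStabiliser R (IsDecomposition.partition decomp) (λ {σ} → R-Ĝ {σ} {false}) e e-edge
      open Links Z Z-grp

      private
        rot-fixes : ∀ {B x y i j l b} → i ≢ j → j ≢ l → i ≢ l →
          lookup (ins B x) i ≡ b → lookup (ins B y) i ≡ b → lookup (ins B x) j ≡ b → lookup (ins B y) j ≡ b →
          lookup (ins B x) l ≡ b → lookup (ins B y) l ≡ b →
          permP {k} (rotation i j l) (ins B x , ins B y) ≡ (ins B x , ins B y)
        rot-fixes {B} {x} {y} {i} {j} {l} i≢j j≢l i≢l ui vi uj vj ul vl =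
          cong₂ _,_ (cycle-stabilises (ins B x) c (trans ui (sym uj)) (trans uj (sym ul)))
                    (cycle-stabilises (ins B y) c (trans vi (sym vj)) (trans vj (sym vl)))
          where
          c : ThreeCycle (rotation i j l) i j l
          c = rotation-cycle i≢j j≢l i≢l

      -- A 3-cycle inside one of the two classes of `e` fixes both ends of `e`.
      class-linked : ∀ b i j → lookup u i ≡ b → lookup v i ≡ b → lookup u j ≡ b → lookup v j ≡ b → Linked i j
      class-linked b i j ui vi uj vj with i ≟ j
      ... | yes eq = inj₁ eq
      ... | no i≢j =
        let l , l≢i , l≢j , ul , vl = class-pick k 4≤k A x y ∣A∣ b i j in
        inj₂ (l , rotation i j l , Z-fixing {rotation i j l} (R.refl e e-edge) (rotations i j l i≢j (l≢j ∘ sym) (l≢i ∘ sym))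
          (rot-fixes {A} {x} {y} {i} {j} {l} i≢j (l≢j ∘ sym) (l≢i ∘ sym) ui vi uj vj ul vl) , rotation-cycle i≢j (l≢j ∘ sym) (l≢i ∘ sym))

      EndSwap : Permutation′ n → Set
      EndSwap σ = Z σ × σ ⟨$⟩ʳ x ≡ y × σ ⟨$⟩ʳ y ≡ x × (∀ i → i ≢ x → i ≢ y →
        lookup u (σ ⟨$⟩ʳ i) ≡ lookup u i × lookup v (σ ⟨$⟩ʳ i) ≡ lookup v i)

      -- With `a` and `a′` in `A`, the product `(x y)(a a′)` is even and reverses `e`, and `R`
      -- relates an edge to its reversal.
      swap-ends : ∃ EndSwap
      swap-ends = first (class-pick k 4≤k A x y ∣A∣ true x y)
        where
        inA : ∀ a → u ∋ a → v ∋ a → A ∋ a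
        inA a ua va with ins⁻ A x {a} ua | ins⁻ A y {a} va
        ... | inj₂ p | _ = p
        ... | inj₁ _ | inj₂ p = p
        ... | inj₁ refl | inj₁ eq = ⊥-elim (x≢y eq)
        build : ∀ a a′ → a ≢ a′ → A ∋ a → A ∋ a′ → ∃ EndSwap
        build a a′ a≢a′ Aa Aa′ = σ , (Hσ , R-swap) , σx , σy , labels
          where
          σ : Permutation′ n
          σ = transpose x y ∙ transpose a a′
          Hσ : InĤ σ
          Hσ = Parity.pair InĤ Ĥ-grp rotations x y a a′ x≢y a≢a′
          avoid : ∀ {i} → A ∌ i → transpose a a′ ⟨$⟩ʳ i ≡ i
          avoid q = transpose-off a a′ (∋∌⇒≢ {A = A} Aa q ∘ sym) (∋∌⇒≢ {A = A} Aa′ q ∘ sym)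
          σx : σ ⟨$⟩ʳ x ≡ y
          σx = trans (cong (transpose x y ⟨$⟩ʳ_) (avoid A∌x)) (transpose-left x y)
          σy : σ ⟨$⟩ʳ y ≡ x
          σy = trans (cong (transpose x y ⟨$⟩ʳ_) (avoid A∌y)) (transpose-right x y)
          σA : ∀ i → lookup A (σ ⟨$⟩ʳ i) ≡ lookup A i
          σA i = cases (i ≟ a) (i ≟ a′) (i ≟ x) (i ≟ y)
            where
            keep : ∀ {l} → A ∋ l → transpose x y ⟨$⟩ʳ l ≡ l
            keep p = transpose-off x y (∋∌⇒≢ {A = A} p A∌x) (∋∌⇒≢ {A = A} p A∌y)
            cases : Dec (i ≡ a) → Dec (i ≡ a′) → Dec (i ≡ x) → Dec (i ≡ y) → lookup A (σ ⟨$⟩ʳ i) ≡ lookup A i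
            cases (yes refl) _ _ _ = trans (cong (lookup A) (trans (cong (transpose x y ⟨$⟩ʳ_) (transpose-left i a′)) (keep Aa′))) (trans Aa′ (sym Aa))
            cases (no _) (yes refl) _ _ = trans (cong (lookup A) (trans (cong (transpose x y ⟨$⟩ʳ_) (transpose-right a i)) (keep Aa))) (trans Aa (sym Aa′))
            cases (no _) (no _) (yes refl) _ = trans (cong (lookup A) σx) (trans A∌y (sym A∌x))
            cases (no _) (no _) (no _) (yes refl) = trans (cong (lookup A) σy) (trans A∌x (sym A∌y))
            cases (no i≢a) (no i≢a′) (no i≢x) (no i≢y) = cong (lookup A)
              (trans (cong (transpose x y ⟨$⟩ʳ_) (transpose-off a a′ i≢a i≢a′)) (transpose-off x y i≢x i≢y))
          labels : ∀ i → i ≢ x → i ≢ y → lookup u (σ ⟨$⟩ʳ i) ≡ lookup u i × lookup v (σ ⟨$⟩ʳ i) ≡ lookup v i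
          labels i i≢x i≢y =
              trans (lookup-ins A σi≢x) (trans (σA i) (sym (lookup-ins A i≢x)))
            , trans (lookup-ins A σi≢y) (trans (σA i) (sym (lookup-ins A i≢y)))
            where
            σi≢x : σ ⟨$⟩ʳ i ≢ x
            σi≢x eq = i≢y (perm-inj σ (trans eq (sym σy)))
            σi≢y : σ ⟨$⟩ʳ i ≢ y
            σi≢y eq = i≢x (perm-inj σ (trans eq (sym σx)))
          swapped : permP {k} σ e ≡ (v , u)
          swapped = cong₂ _,_
            (trans (permute-ins σ A x) (cong₂ ins (permute-unique σ A A σA) σx))
            (trans (permute-ins σ A y) (cong₂ ins (permute-unique σ A A σA) σy))
          R-swap : R e (permP {k} σ e)
          R-swap = subst (R e) (sym swapped) (R.unord u v e-edge)

        first : (∃ λ a → a ≢ x × a ≢ y × u ∋ a × v ∋ a) → ∃ EndSwap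
        first (a , _ , _ , ua , va) = second (class-pick k 4≤k A x y ∣A∣ true a a)
          where
          second : (∃ λ a′ → a′ ≢ a × a′ ≢ a × u ∋ a′ × v ∋ a′) → ∃ EndSwap
          second (a′ , a′≢a , _ , ua′ , va′) = build a a′ (a′≢a ∘ sym) (inA a ua va) (inA a′ ua′ va′)

      -- `ρ` followed by `τ` moves `e` to some arc, and an element of `Ĥ` brings it back. The
      -- equations say that `θ` exchanges the two classes of `e`, and `x` with `y`.
      complementing : ∃ λ θ → InĜ (θ , true) × (∀ i → lookup u (θ ⟨$⟩ʳ i) ≡ not (lookup u i) × lookup v (θ ⟨$⟩ʳ i) ≡ not (lookup v i)) × actP k (θ , true) e ≡ e
      complementing =
        let h , Hh , eq = arc-move (actP k (ρ , true) e) e (IsEdge-actP {k} (ρ , true) e e-edge) e-edge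
            stable = trans (cong (compP {k}) (permP-∙ {k} h ρ e)) (trans (sym (permP-compP {k} h (permP {k} ρ e))) eq)
        in h ∙ ρ , Ĝ-∙ G sub {h} {false} {ρ} {true} Hh ρ∈ ,
           (λ i → negated (h ∙ ρ) u (cong proj₁ stable) i , negated (h ∙ ρ) v (cong proj₂ stable) i) , stable
        where
        negated : ∀ θ B → ∁ (permute θ B) ≡ B → ∀ i → lookup B (θ ⟨$⟩ʳ i) ≡ not (lookup B i)
        negated θ B eq i = trans (cong (λ D → lookup D (θ ⟨$⟩ʳ i)) (sym eq))
          (trans (lookup-map (θ ⟨$⟩ʳ i) not (permute θ B)) (cong not (lookup-permute θ B i)))

      -- As the pairs differ, some end `p` of `e` is not an end of `f`. It lies in a class of `f`
      -- with at least three points, one of them an `a` other than `x` and `y`. A 3-cycle through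
      -- `p` and `a` in that class fixes `f`, which is in the part of `e`, so it belongs to `Z`.
      end-link : ∃₂ λ p a → (p ≡ x ⊎ p ≡ y) × a ≢ x × a ≢ y × Linked p a
      end-link = choose (x ≟ z) (x ≟ w) (y ≟ z) (y ≟ w)
        where
        z≢w = proj₂ (proj₂ (proj₂ fC))
        equal : pairOf {k} e ≡ pairOf {k} f → ⊥
        equal eq = ¬same (e-edge , f-edge , eq)
        pe : pairOf {k} e ≡ doubleton x y
        pe = pairOf-flag {k} A x y x≢y A∌x A∌y
        pf : pairOf {k} f ≡ doubleton z w
        pf = pairOf-flag {k} C z w z≢w (proj₁ (proj₂ fC)) (proj₁ (proj₂ (proj₂ fC)))
        link : ∀ p → (p ≡ x ⊎ p ≡ y) → p ≢ z → p ≢ w → ∃₂ λ p a → (p ≡ x ⊎ p ≡ y) × a ≢ x × a ≢ y × Linked p a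
        link p end p≢z p≢w = first (class-pick k 4≤k C z w (proj₁ fC) (lookup C p) x y)
            where
          off-end : ∀ {a} → (p ≡ x ⊎ p ≡ y) → a ≢ x → a ≢ y → p ≢ a
          off-end (inj₁ refl) a≢x _ eq = a≢x (sym eq)
          off-end (inj₂ refl) _ a≢y eq = a≢y (sym eq)
          first : (∃ λ a → a ≢ x × a ≢ y × lookup (ins C z) a ≡ lookup C p × lookup (ins C w) a ≡ lookup C p) →
            ∃₂ λ p a → (p ≡ x ⊎ p ≡ y) × a ≢ x × a ≢ y × Linked p a
          first (a , a≢x , a≢y , fa , ga) = second (class-pick k 4≤k C z w (proj₁ fC) (lookup C p) p a)
            where
            p≢a : p ≢ a
            p≢a = off-end end a≢x a≢y
            second : (∃ λ c → c ≢ p × c ≢ a × lookup (ins C z) c ≡ lookup C p × lookup (ins C w) c ≡ lookup C p) →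
              ∃₂ λ p a → (p ≡ x ⊎ p ≡ y) × a ≢ x × a ≢ y × Linked p a
            second (c , c≢p , c≢a , fc , gc) = p , a , end , a≢x , a≢y , inj₂ (c , rotation p a c ,
              Z-fixing {rotation p a c} Ref (rotations p a c p≢a (c≢a ∘ sym) (c≢p ∘ sym))
                (rot-fixes {C} {z} {w} p≢a (c≢a ∘ sym) (c≢p ∘ sym) (lookup-ins C p≢z) (lookup-ins C p≢w) fa ga fc gc) ,
              rotation-cycle p≢a (c≢a ∘ sym) (c≢p ∘ sym))
        choose : Dec (x ≡ z) → Dec (x ≡ w) → Dec (y ≡ z) → Dec (y ≡ w) → ∃₂ λ p a → (p ≡ x ⊎ p ≡ y) × a ≢ x × a ≢ y × Linked p a
        choose (no x≢z) (no x≢w) _ _ = link x (inj₁ refl) x≢z x≢w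
        choose _ _ (no y≢z) (no y≢w) = link y (inj₂ refl) y≢z y≢w
        choose (yes x≡z) _ _ (yes y≡w) = ⊥-elim (equal (trans pe (trans (cong₂ doubleton x≡z y≡w) (sym pf))))
        choose _ (yes x≡w) (yes y≡z) _ = ⊥-elim (equal (trans pe (trans (doubleton-swap x y) (trans (cong₂ doubleton y≡z x≡w) (sym pf)))))
        choose (yes x≡z) _ (yes y≡z) _ = ⊥-elim (x≢y (trans x≡z (sym y≡z)))
        choose _ (yes x≡w) _ (yes y≡w) = ⊥-elim (x≢y (trans x≡w (sym y≡w)))

      off-ends : ∀ {a} → a ≢ x → a ≢ y → lookup u a ≡ lookup v a
      off-ends a≢x a≢y = trans (lookup-ins A a≢x) (sym (lookup-ins A a≢y))

      -- Applying the exchange of the ends links both `x` and `y` to `a`. Applying `θ` then links an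
      -- end, the image of `x`, to a point of the class opposite to `a`, so both classes and both
      -- ends are joined.
      all-linked : ∀ i j → Linked i j
      all-linked i j = gather end-link complementing swap-ends
        where
        both : ∀ {p a} {s : Permutation′ n} → (p ≡ x ⊎ p ≡ y) → Linked p a → Linked (s ⟨$⟩ʳ p) a → s ⟨$⟩ʳ x ≡ y → s ⟨$⟩ʳ y ≡ x → Linked x a × Linked y a
        both (inj₁ refl) pa spa sx sy = pa , subst (λ q → Linked q _) sx spa
        both (inj₂ refl) pa spa sx sy = subst (λ q → Linked q _) sy spa , pa
        ends-linked : ∀ {a} → Linked x a → Linked y a → ∀ q → lookup u q ≡ not (lookup u x) × lookup v q ≡ not (lookup v x) → Linked q a
        ends-linked xa ya q (uq , vq) with q ≟ x | q ≟ y
        ... | yes refl | _ = xa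
        ... | no _ | yes refl = ya
        ... | no q≢x | no q≢y with () ← trans (sym (cong not (ins-self A x))) (trans (sym uq) (trans (off-ends q≢x q≢y)
                (trans vq (cong not (trans (lookup-ins A x≢y) A∌x)))))
        not-≢ : ∀ b c → b ≢ c → b ≡ not c
        not-≢ true  true  ne = ⊥-elim (ne refl)
        not-≢ true  false ne = refl
        not-≢ false true  ne = refl
        not-≢ false false ne = ⊥-elim (ne refl)
        reach : ∀ a (θ : Permutation′ n) → a ≢ x → a ≢ y → (∀ i → lookup u (θ ⟨$⟩ʳ i) ≡ not (lookup u i) × lookup v (θ ⟨$⟩ʳ i) ≡ not (lookup v i)) →
          Linked x a → Linked y a → Linked a (θ ⟨$⟩ʳ a) → ∀ i → Dec (lookup u i ≡ lookup u a) → Linked a i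
        reach a θ a≢x a≢y neg xa ya far i same with i ≟ x | i ≟ y
        ... | yes refl | _ = linked-sym xa
        ... | no _ | yes refl = linked-sym ya
        reach a θ a≢x a≢y neg xa ya far i (yes eq) | no i≢x | no i≢y =
          class-linked (lookup u a) a i refl (sym (off-ends a≢x a≢y)) eq (trans (sym (off-ends i≢x i≢y)) eq)
        reach a θ a≢x a≢y neg xa ya far i (no ne) | no i≢x | no i≢y = linked-trans far
          (class-linked (not (lookup u a)) (θ ⟨$⟩ʳ a) i (proj₁ (neg a)) (trans (proj₂ (neg a)) (cong not (sym (off-ends a≢x a≢y))))
            (not-≢ _ _ ne) (trans (sym (off-ends i≢x i≢y)) (not-≢ _ _ ne)))

        conclude : ∀ a (θ : Permutation′ n) → a ≢ x → a ≢ y →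
          (∀ i → lookup u (θ ⟨$⟩ʳ i) ≡ not (lookup u i) × lookup v (θ ⟨$⟩ʳ i) ≡ not (lookup v i)) →
          Linked (θ ⟨$⟩ʳ x) (θ ⟨$⟩ʳ a) → Linked x a × Linked y a → Linked i j
        conclude a θ a≢x a≢y neg θx (xa , ya) = linked-trans (linked-sym (to i)) (to j)
          where
          far : Linked a (θ ⟨$⟩ʳ a)
          far = linked-trans (linked-sym (ends-linked xa ya (θ ⟨$⟩ʳ x) (neg x))) θx
          to : ∀ i → Linked a i
          to i = reach a θ a≢x a≢y neg xa ya far i (lookup u i Bool.≟ lookup u a)
        gather : (∃₂ λ p a → (p ≡ x ⊎ p ≡ y) × a ≢ x × a ≢ y × Linked p a) →
          (∃ λ θ → InĜ (θ , true) × (∀ i → lookup u (θ ⟨$⟩ʳ i) ≡ not (lookup u i) × lookup v (θ ⟨$⟩ʳ i) ≡ not (lookup v i)) × actP k (θ , true) e ≡ e) →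
          ∃ EndSwap → Linked i j
        gather (p , a , end , a≢x , a≢y , pa) (θ , Gθ , neg , fix) (s , Zs , sx , sy , lab) =
          conclude a θ a≢x a≢y neg (linked-map {θ} (λ {σ} → Z-normalised θ Gθ (R-Ĝ {θ} {true} Gθ) fix {σ}) (proj₁ xy)) xy
          where
          open IsPermGroup Z-grp
          spa : Linked (s ⟨$⟩ʳ p) (s ⟨$⟩ʳ a)
          spa = linked-map {s} (λ {σ} Zσ → ∙∈ {s} {σ ∙ flip s} Zs (∙∈ {σ} {flip s} Zσ (inv∈ {s} Zs))) pa
          back : Linked (s ⟨$⟩ʳ a) a
          back = class-linked (lookup u a) (s ⟨$⟩ʳ a) a (proj₁ (lab a a≢x a≢y))
            (trans (proj₂ (lab a a≢x a≢y)) (sym (off-ends a≢x a≢y))) refl (sym (off-ends a≢x a≢y))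
          xy : Linked x a × Linked y a
          xy = both {s = s} end pa (linked-trans spa back) sx sy

      -- `Z` now contains all 3-cycles. If `σ` takes `e` to `g` without lying in `Z`, then
      -- `σ (a a′)` with `a`, `a′` in `A` lies in `Z` and also takes `e` to `g`.
      R-reaches : ∀ g → IsEdge k g → R e g
      R-reaches g g-edge = choose (arc-move e g e-edge g-edge) (class-pick k 4≤k A x y ∣A∣ true x y)
        where
        from : ∀ σ → permP {k} σ e ≡ g → ∀ a a′ → a ≢ a′ → lookup u a ≡ lookup u a′ → lookup v a ≡ lookup v a′ →
          Z σ ⊎ (∀ i j → i ≢ j → Z (σ ∙ transpose i j)) → R e g
        from σ eq a a′ a≢a′ ua va (inj₁ (_ , r)) = subst (R e) eq r
        from σ eq a a′ a≢a′ ua va (inj₂ h) = subst (R e) (trans (permP-∙ {k} σ (transpose a a′) e)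
            (trans (cong (permP {k} σ) (cong₂ _,_ (still u ua) (still v va))) eq)) (proj₂ (h a a′ a≢a′))
          where
          still : ∀ B → lookup B a ≡ lookup B a′ → permute (transpose a a′) B ≡ B
          still B ba = permute-unique (transpose a a′) B B λ i → cases i (i ≟ a) (i ≟ a′)
            where
            cases : ∀ i → Dec (i ≡ a) → Dec (i ≡ a′) → lookup B (transpose a a′ ⟨$⟩ʳ i) ≡ lookup B i
            cases i (yes refl) _ = trans (cong (lookup B) (transpose-left i a′)) (sym ba)
            cases i (no _) (yes refl) = trans (cong (lookup B) (transpose-right a i)) ba
            cases i (no i≢a) (no i≢a′) = cong (lookup B) (transpose-off a a′ i≢a i≢a′)
        choose : (∃ λ σ → InĤ σ × permP {k} σ e ≡ g) → (∃ λ a → a ≢ x × a ≢ y × u ∋ a × v ∋ a) → R e g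
        choose (σ , _ , eq) (a , _ , _ , ua , va) = second (class-pick k 4≤k A x y ∣A∣ true a a)
          where
          second : (∃ λ a′ → a′ ≢ a × a′ ≢ a × u ∋ a′ × v ∋ a′) → R e g
          second (a′ , a′≢a , _ , ua′ , va′) = from σ eq a a′ (a′≢a ∘ sym) (trans ua (sym ua′)) (trans va (sym va′))
            (Parity.parity Z Z-grp (all-linked⇒rotations all-linked) σ)

  R⊆SamePair : ∀ e f → R e f → SamePair k e f
  R⊆SamePair e f r = from (edge-flag k 1≤k e (proj₁ (R.onEdges e f r))) (edge-flag k 1≤k f (proj₂ (R.onEdges e f r))) r (lem (SamePair k e f))
    where
    from : (∃ λ A → ∃ λ x → ∃ λ y → IsFlag (k ∸ 1) A x y × e ≡ (ins A x , ins A y)) →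
           (∃ λ A → ∃ λ x → ∃ λ y → IsFlag (k ∸ 1) A x y × f ≡ (ins A x , ins A y)) → R e f → SamePair k e f ⊎ ¬ SamePair k e f → SamePair k e f
    from _ _ _ (inj₁ same) = same
    from (A , x , y , fA , refl) (C , z , w , fC , refl) r (inj₂ ¬same) =
      ⊥-elim (not-total λ g h pg ph → R.trans g e h (R.sym e g (reaches g pg)) (reaches h ph))
      where
      reaches : ∀ g → IsEdge k g → R (ins A x , ins A y) g
      reaches = R-reaches A x y fA C z w fC r ¬same

-- The case k = 3

subsets : ∀ n → List (Subset n)
subsets zero    = [] ∷ []
subsets (suc n) = mapᴸ (true ∷_) (subsets n) ++ mapᴸ (false ∷_) (subsets n)

∈-subsets : ∀ {n} (A : Subset n) → A ∈ subsets n
∈-subsets []          = here refl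
∈-subsets (true ∷ A)  = ∈-++⁺ˡ (∈-map⁺ (true ∷_) (∈-subsets A))
∈-subsets (false ∷ A) = ∈-++⁺ʳ (mapᴸ (true ∷_) (subsets _)) (∈-map⁺ (false ∷_) (∈-subsets A))

-- Permutations of Fin 6 are represented by tables of values because these normalise much faster than functions.
Table : Set
Table = Vec (Fin 6) 6

infixr 9 _⊙_
_⊙_ : Table → Table → Table
p ⊙ q = Vec.map (lookup p) q

_≟ᵗ_ : (p q : Table) → Dec (p ≡ q)
_≟ᵗ_ = Vecₚ.≡-dec _≟_

_≟ˢ_ : (A B : Subset 6) → Dec (A ≡ B)
_≟ˢ_ = Vecₚ.≡-dec Bool._≟_

table : Permutation′ 6 → Table
table σ = tabulate (σ ⟨$⟩ʳ_)

u₀ v₀ : Subset 6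
u₀ = true ∷ true ∷ true ∷ false ∷ false ∷ false ∷ []
v₀ = true ∷ true ∷ false ∷ true ∷ false ∷ false ∷ []

e₀ : Pair 3
e₀ = u₀ , v₀

-- ν₁, ν₂, ν₃ are the involutions in the stabiliser of the edge e₀ in the alternating group, and ρ₀ is an odd permutation
-- for which ρ₀ τ fixes e₀.
ν₁ ν₂ ν₃ δ₂ ρ₀ : Permutation′ 6
ν₁ = transpose 0F 1F ∙ transpose 2F 3F
ν₂ = transpose 0F 1F ∙ transpose 4F 5F
ν₃ = transpose 2F 3F ∙ transpose 4F 5F
δ₂ = transpose 0F 4F ∙ transpose 1F 5F
ρ₀ = δ₂ ∙ transpose 2F 3F

-- This is `(0 2 4)(1 3 5)`, which permutes the pairs `{0,1}`, `{2,3}`, `{4,5}` cyclically, whereas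
-- `δ₂` exchanges the first and the last.
δ₃ : Table
δ₃ = 2F ∷ 3F ∷ 4F ∷ 5F ∷ 0F ∷ 1F ∷ []

data Letter : Set where
  g₁ g₂ v₁ v₂ v₃ : Letter

letter : Table → Table → Letter → Table
letter p q g₁ = p
letter p q g₂ = q
letter p q v₁ = table ν₁
letter p q v₂ = table ν₂
letter p q v₃ = table ν₃

Word : Set
Word = List Letter

value : Table → Table → Word → Table
value p q = foldr (λ l t → letter p q l ⊙ t) (table idₚ)

-- The identity and the three involutions form a Klein four-group inside every stabiliser
-- considered, so words are recorded only up to a right factor from it.
endings : List Word
endings = [] ∷ (v₁ ∷ []) ∷ (v₂ ∷ []) ∷ (v₃ ∷ []) ∷ []

Expressible : List Word → Table → Table → Table → Set
Expressible ws p q t = Any (λ w → Any (λ v → value p q (w ++ v) ≡ t) endings) ws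

expressible? : ∀ ws p q t → Dec (Expressible ws p q t)
expressible? ws p q t = any? (λ w → any? (λ v → value p q (w ++ v) ≟ᵗ t) endings) ws

-- Found by a computer search; the letters stand for a permutation p and its conjugate by ρ₀ in words,
-- and for p and δ₂ or δ₃ in words₂ and words₃.
words words₂ words₃ : List Word
words =
  (g₁ ∷ v₂ ∷ g₂ ∷ v₂ ∷ g₁ ∷ []) ∷ (g₁ ∷ v₂ ∷ g₁ ∷ g₂ ∷ g₁ ∷ []) ∷ (g₁ ∷ g₂ ∷ g₂ ∷ v₃ ∷ g₂ ∷ []) ∷
  (g₂ ∷ g₂ ∷ v₁ ∷ g₂ ∷ v₃ ∷ g₁ ∷ []) ∷ (g₂ ∷ g₁ ∷ v₃ ∷ g₁ ∷ g₂ ∷ []) ∷ (g₁ ∷ v₃ ∷ g₂ ∷ v₃ ∷ g₂ ∷ g₂ ∷ []) ∷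
  (g₂ ∷ v₁ ∷ g₁ ∷ v₂ ∷ g₁ ∷ v₃ ∷ g₂ ∷ []) ∷ (g₂ ∷ v₃ ∷ g₂ ∷ v₁ ∷ g₁ ∷ v₁ ∷ g₁ ∷ []) ∷
  (g₂ ∷ v₂ ∷ g₂ ∷ v₁ ∷ g₂ ∷ g₂ ∷ []) ∷ (g₂ ∷ g₁ ∷ v₂ ∷ g₂ ∷ g₁ ∷ []) ∷ (g₁ ∷ g₁ ∷ g₂ ∷ g₂ ∷ []) ∷
  (g₁ ∷ v₃ ∷ g₁ ∷ v₁ ∷ g₂ ∷ v₁ ∷ g₂ ∷ []) ∷ (g₁ ∷ v₂ ∷ g₁ ∷ g₂ ∷ v₂ ∷ g₂ ∷ []) ∷
  (g₂ ∷ v₃ ∷ g₂ ∷ v₁ ∷ g₂ ∷ v₂ ∷ g₂ ∷ []) ∷ (g₂ ∷ g₁ ∷ v₁ ∷ g₂ ∷ v₂ ∷ g₁ ∷ []) ∷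
  (g₂ ∷ v₃ ∷ g₂ ∷ v₃ ∷ g₁ ∷ v₁ ∷ g₁ ∷ []) ∷ (g₂ ∷ v₃ ∷ g₁ ∷ v₂ ∷ g₁ ∷ v₁ ∷ g₂ ∷ []) ∷ (g₂ ∷ g₂ ∷ g₂ ∷ g₁ ∷ []) ∷
  (g₁ ∷ v₃ ∷ g₁ ∷ v₁ ∷ g₁ ∷ v₃ ∷ g₁ ∷ []) ∷ []
words₂ =
  (g₂ ∷ g₁ ∷ g₂ ∷ []) ∷ (g₂ ∷ v₁ ∷ g₁ ∷ g₂ ∷ []) ∷ (g₂ ∷ v₃ ∷ g₁ ∷ g₂ ∷ []) ∷ (g₁ ∷ []) ∷ (v₂ ∷ g₁ ∷ []) ∷
  (v₁ ∷ g₁ ∷ v₁ ∷ g₁ ∷ []) ∷ (v₃ ∷ g₁ ∷ g₁ ∷ []) ∷ (v₃ ∷ g₁ ∷ v₁ ∷ g₁ ∷ []) ∷ (v₃ ∷ g₁ ∷ g₂ ∷ g₁ ∷ []) ∷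
  (v₁ ∷ g₁ ∷ g₂ ∷ v₂ ∷ g₁ ∷ []) ∷ (v₁ ∷ g₁ ∷ g₂ ∷ v₁ ∷ g₁ ∷ []) ∷ (v₃ ∷ g₁ ∷ g₂ ∷ v₃ ∷ g₁ ∷ []) ∷ (v₁ ∷ g₁ ∷ g₁ ∷ []) ∷
  (v₁ ∷ g₁ ∷ v₂ ∷ g₁ ∷ []) ∷ (v₁ ∷ g₁ ∷ g₂ ∷ v₃ ∷ g₁ ∷ []) ∷ (v₃ ∷ g₁ ∷ g₂ ∷ v₁ ∷ g₁ ∷ []) ∷ (v₃ ∷ g₁ ∷ v₂ ∷ g₁ ∷ []) ∷
  (v₃ ∷ g₁ ∷ v₃ ∷ g₁ ∷ []) ∷ (v₁ ∷ g₁ ∷ g₂ ∷ g₁ ∷ []) ∷ (v₃ ∷ g₁ ∷ g₂ ∷ v₂ ∷ g₁ ∷ []) ∷ (v₁ ∷ g₁ ∷ v₃ ∷ g₁ ∷ []) ∷ []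
words₃ =
  (g₁ ∷ []) ∷ (g₁ ∷ g₂ ∷ []) ∷ (g₁ ∷ g₂ ∷ g₂ ∷ []) ∷ (v₂ ∷ g₁ ∷ []) ∷ (v₂ ∷ g₁ ∷ g₂ ∷ []) ∷ (v₂ ∷ g₁ ∷ g₂ ∷ g₂ ∷ []) ∷
  (g₂ ∷ v₂ ∷ g₁ ∷ []) ∷ (g₂ ∷ v₃ ∷ g₁ ∷ []) ∷ (g₂ ∷ g₂ ∷ v₁ ∷ g₁ ∷ []) ∷ (g₂ ∷ g₂ ∷ v₂ ∷ g₁ ∷ []) ∷
  (g₂ ∷ v₂ ∷ g₁ ∷ g₂ ∷ []) ∷ (g₂ ∷ v₂ ∷ g₁ ∷ g₂ ∷ g₂ ∷ []) ∷ (g₂ ∷ v₃ ∷ g₁ ∷ g₂ ∷ []) ∷ (g₂ ∷ v₃ ∷ g₁ ∷ g₂ ∷ g₂ ∷ []) ∷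
  (g₂ ∷ g₂ ∷ v₁ ∷ g₁ ∷ g₂ ∷ []) ∷ (g₂ ∷ g₂ ∷ v₁ ∷ g₁ ∷ g₂ ∷ g₂ ∷ []) ∷ (g₂ ∷ g₂ ∷ v₂ ∷ g₁ ∷ g₂ ∷ []) ∷
  (g₂ ∷ g₂ ∷ v₂ ∷ g₁ ∷ g₂ ∷ g₂ ∷ []) ∷ []

-- Transversals for the stabilisers of the point 2, of the points 2 and 3, and of the arc e₀ in the alternating group.
first second third : List (Permutation′ 6)
first  = idₚ ∷ rotation 2F 0F 1F ∷ rotation 2F 1F 0F ∷ rotation 2F 3F 0F ∷ rotation 2F 4F 0F ∷ rotation 2F 5F 0F ∷ []
second = idₚ ∷ rotation 3F 0F 1F ∷ rotation 3F 1F 0F ∷ rotation 3F 4F 0F ∷ rotation 3F 5F 0F ∷ []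
third  = idₚ ∷ rotation 1F 4F 5F ∷ rotation 1F 5F 4F ∷ rotation 0F 4F 5F ∷ rotation 0F 5F 4F ∷ δ₂ ∷ []

product : Permutation′ 6 → Permutation′ 6 → Permutation′ 6 → Table
product α β γ = table α ⊙ table β ⊙ table γ

Reached : Subset 6 → Subset 6 → Set
Reached u v = Any (λ α → Any (λ β → Any (λ γ →
  Vec.map (lookup u) (product α β γ) ≡ u₀ × Vec.map (lookup v) (product α β γ) ≡ v₀) third) second) first

-- `J(6,3)` has 20 · 9 = 180 arcs, as many as the 6 · 5 · 6 products. A product takes `e₀` to
-- `(u , v)` when reading `u` and `v` along it gives `u₀` and `v₀`.
arcs-reached : All (λ u → ∣ u ∣ ≡ 3 → All (λ v → ∣ u ∩ v ∣ ≡ 2 → ∣ v ∣ ≡ 3 → Reached u v) (subsets 6)) (subsets 6)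
arcs-reached = toWitness {a? = all? (λ u → (∣ u ∣ ℕ.≟ 3) →-dec all? (λ v → (∣ u ∩ v ∣ ℕ.≟ 2) →-dec ((∣ v ∣ ℕ.≟ 3) →-dec
  any? (λ α → any? (λ β → any? (λ γ →
    (Vec.map (lookup u) (product α β γ) ≟ˢ u₀) ×-dec (Vec.map (lookup v) (product α β γ) ≟ˢ v₀)) third) second) first)) (subsets 6)) (subsets 6)} _

conjugate : Table → Table
conjugate p = table ρ₀ ⊙ p ⊙ table ρ₀

pair₀ : Subset 6
pair₀ = pairOf {3} e₀

-- The first alternative says that `p` keeps the pair of `e₀`. In the others the conjugate of `p`
-- may be used as a letter, because `R` is invariant under `ρ₀` followed by `τ`.
Generates : Table → Set
Generates p = Vec.map (lookup pair₀) p ≡ pair₀ ⊎ Expressible words p (conjugate p) (table δ₂) ⊎ Expressible words p (conjugate p) δ₃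

AllProducts : (Table → Set) → Set
AllProducts P = All (λ α → All (λ β → All (λ γ → P (product α β γ)) third) second) first

all-products? : ∀ {P : Table → Set} → (∀ p → Dec (P p)) → Dec (AllProducts P)
all-products? P? = all? (λ α → all? (λ β → all? (λ γ → P? (product α β γ)) third) second) first

products-generate : AllProducts Generates
products-generate = toWitness {a? = all-products? (λ p → (Vec.map (lookup pair₀) p ≟ˢ pair₀) ⊎-dec
  (expressible? words p (conjugate p) (table δ₂) ⊎-dec expressible? words p (conjugate p) δ₃))} _

-- For the stabiliser of a part of `S`, closure under conjugation by `ρ₀` is what has to be shown.
-- So the conjugate is written in `p`, `δ₂` and the involutions, which are already known to lie in
-- the group.
products-normalise₂ : AllProducts (λ p → Expressible words₂ p (table δ₂) (conjugate p))
products-normalise₂ = toWitness {a? = all-products? (λ p → expressible? words₂ p (table δ₂) (conjugate p))} _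

products-normalise₃ : AllProducts (λ p → Expressible words₃ p δ₃ (conjugate p))
products-normalise₃ = toWitness {a? = all-products? (λ p → expressible? words₃ p δ₃ (conjugate p))} _

Tabulated : (Permutation′ 6 → Set) → Table → Set
Tabulated Z p = ∃ λ σ → Z σ × (∀ i → σ ⟨$⟩ʳ i ≡ lookup p i)

module _ {Z : Permutation′ 6 → Set} (grp : IsPermGroup Z) where
  open IsPermGroup grp

  tabulated-⊙ : ∀ {p q} → Tabulated Z p → Tabulated Z q → Tabulated Z (p ⊙ q)
  tabulated-⊙ {p} {q} (σ , Zσ , eσ) (π , Zπ , eπ) = σ ∙ π , ∙∈ {σ} {π} Zσ Zπ ,
    λ i → trans (trans (eσ _) (cong (lookup p) (eπ i))) (sym (lookup-map i (lookup p) q))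

  tabulated-table : ∀ {σ} → Z σ → Tabulated Z (table σ)
  tabulated-table {σ} Zσ = σ , Zσ , λ i → sym (lookup∘tabulate (σ ⟨$⟩ʳ_) i)

  module _ (Z₁ : Z ν₁) (Z₂ : Z ν₂) (Z₃ : Z ν₃) where

    tabulated-value : ∀ {p q} → Tabulated Z p → Tabulated Z q → ∀ w → Tabulated Z (value p q w)
    tabulated-value zp zq []       = tabulated-table {idₚ} id∈
    tabulated-value {p} {q} zp zq (l ∷ w) = tabulated-⊙ {letter p q l} {value p q w} (on l) (tabulated-value zp zq w)
      where
      on : ∀ l → Tabulated Z (letter p q l)
      on g₁ = zp
      on g₂ = zq
      on v₁ = tabulated-table {ν₁} Z₁
      on v₂ = tabulated-table {ν₂} Z₂
      on v₃ = tabulated-table {ν₃} Z₃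

    tabulated-expressible : ∀ {ws p q t} → Tabulated Z p → Tabulated Z q → Expressible ws p q t → Tabulated Z t
    tabulated-expressible {ws} {p} {q} {t} zp zq ex = from (find ex)
      where
      from : (∃ λ w → w ∈ ws × Any (λ v → value p q (w ++ v) ≡ t) endings) → Tabulated Z t
      from (w , _ , ex′) =
        let v , _ , eq = find ex′ in subst (Tabulated Z) eq (tabulated-value zp zq (w ++ v))

module RankThree (G : Aut 3 → Set) (sub : IsSubgroup 3 G)
  (R : Pair 3 → Pair 3 → Set) (decomp : IsDecomposition 3 R) (R-inv : Preserves 3 G R)
  (prim : (S : Pair 3 → Pair 3 → Set) → IsEdgePartition 3 S → (∀ e e′ → R e e′ → S e e′) → Preserves 3 G S → Dichotomy 3 R S)
  (arc : ArcTransitive 3 (InSym 3 G)) (ρ : Permutation′ 6) (Gρ : G (ρ , true)) (τ∉ : ¬ (_∈Ĝ G sub (idₚ , true)))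
  (2≤3 : 2 ≤ 3) where

  open Reduction 3 2≤3 G sub R decomp R-inv prim
  open Twisted 3 2≤3 G sub R decomp R-inv prim arc ρ Gρ τ∉
  open IsPermGroup Ĥ-grp

  e₀-edge : IsEdge 3 e₀
  e₀-edge = refl , refl , refl

  even-pair : ∀ i j l m → i ≢ j → l ≢ m → InĤ (transpose i j ∙ transpose l m)
  even-pair = Parity.pair InĤ Ĥ-grp rotations

  δ₂∈ : InĤ δ₂
  δ₂∈ = even-pair 0F 4F 1F 5F (λ ()) (λ ())

  first∈ : All InĤ first
  first∈ = id∈ ∷ rotations 2F 0F 1F (λ ()) (λ ()) (λ ()) ∷ rotations 2F 1F 0F (λ ()) (λ ()) (λ ()) ∷
    rotations 2F 3F 0F (λ ()) (λ ()) (λ ()) ∷ rotations 2F 4F 0F (λ ()) (λ ()) (λ ()) ∷ rotations 2F 5F 0F (λ ()) (λ ()) (λ ()) ∷ []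

  second∈ : All InĤ second
  second∈ = id∈ ∷ rotations 3F 0F 1F (λ ()) (λ ()) (λ ()) ∷ rotations 3F 1F 0F (λ ()) (λ ()) (λ ()) ∷
    rotations 3F 4F 0F (λ ()) (λ ()) (λ ()) ∷ rotations 3F 5F 0F (λ ()) (λ ()) (λ ()) ∷ []

  third∈ : All InĤ third
  third∈ = id∈ ∷ rotations 1F 4F 5F (λ ()) (λ ()) (λ ()) ∷ rotations 1F 5F 4F (λ ()) (λ ()) (λ ()) ∷
    rotations 0F 4F 5F (λ ()) (λ ()) (λ ()) ∷ rotations 0F 5F 4F (λ ()) (λ ()) (λ ()) ∷ δ₂∈ ∷ []

  Product : (Permutation′ 6) → Table → Set
  Product σ p = InĤ σ × (∀ i → σ ⟨$⟩ʳ i ≡ lookup p i) ×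
    ∃ λ α → ∃ λ β → ∃ λ γ → α ∈ first × β ∈ second × γ ∈ third × p ≡ product α β γ

  every-product : ∀ {P : Table → Set} {σ p} → Product σ p → AllProducts P → P p
  every-product (_ , _ , _ , _ , _ , α∈ , β∈ , γ∈ , refl) all = all-lookup (all-lookup (all-lookup all α∈) β∈) γ∈

  reach : ∀ f → IsEdge 3 f → ∃₂ λ σ p → Product σ p × permP {3} σ e₀ ≡ f
  reach (u , v) (∣u∣ , ∣v∣ , ∣u∩v∣) = on-first (find (all-lookup (all-lookup arcs-reached (∈-subsets u) ∣u∣) (∈-subsets v) ∣u∩v∣ ∣v∣))
    where
    Sends : Table → Set
    Sends p = Vec.map (lookup u) p ≡ u₀ × Vec.map (lookup v) p ≡ v₀
    on-first : (∃ λ α → α ∈ first × Any (λ β → Any (λ γ → Sends (product α β γ)) third) second) →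
      ∃₂ λ σ p → Product σ p × permP {3} σ e₀ ≡ (u , v)
    on-first (α , α∈ , x) = on-second (find x)
      where
      on-second : (∃ λ β → β ∈ second × Any (λ γ → Sends (product α β γ)) third) → _
      on-second (β , β∈ , y) = on-third (find y)
        where
        on-third : (∃ λ γ → γ ∈ third × Sends (product α β γ)) → ∃₂ λ σ p → Product σ p × permP {3} σ e₀ ≡ (u , v)
        on-third (γ , γ∈ , eu , ev) = σ , p ,
            (∙∈ {α} {β ∙ γ} (all-lookup first∈ α∈) (∙∈ {β} {γ} (all-lookup second∈ β∈) (all-lookup third∈ γ∈)) , values ,
              α , β , γ , α∈ , β∈ , γ∈ , refl) ,
            cong₂ _,_ (sends u u₀ eu) (sends v v₀ ev)
          where
          σ : Permutation′ 6
          σ = α ∙ β ∙ γ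
          p : Table
          p = product α β γ
          values : ∀ i → σ ⟨$⟩ʳ i ≡ lookup p i
          values i = sym (trans (lookup-map i (lookup (table α)) (table β ⊙ table γ))
            (trans (cong (lookup (table α)) (trans (lookup-map i (lookup (table β)) (table γ))
              (trans (cong (lookup (table β)) (lookup∘tabulate (γ ⟨$⟩ʳ_) i)) (lookup∘tabulate (β ⟨$⟩ʳ_) _))))
              (lookup∘tabulate (α ⟨$⟩ʳ_) _)))
          sends : ∀ B B₀ → Vec.map (lookup B) p ≡ B₀ → permute σ B₀ ≡ B
          sends B B₀ eq = permute-unique σ B₀ B λ i →
            trans (cong (lookup B) (values i)) (trans (sym (lookup-map i (lookup B) p)) (cong (λ D → lookup D i) eq))

  ρ₀∈ : InĜ (ρ₀ , true)
  ρ₀∈ = Ĝ-∙ G sub {δ₂} {false} {transpose 2F 3F} {true} δ₂∈ (odd-transposition 2F 3F (λ ()))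

  ρ₀-e₀ : actP 3 (ρ₀ , true) e₀ ≡ e₀
  ρ₀-e₀ = refl

  flip-ρ₀ : ∀ i → ρ₀ ⟨$⟩ˡ i ≡ ρ₀ ⟨$⟩ʳ i
  flip-ρ₀ 0F = refl
  flip-ρ₀ 1F = refl
  flip-ρ₀ 2F = refl
  flip-ρ₀ 3F = refl
  flip-ρ₀ 4F = refl
  flip-ρ₀ 5F = refl

  conjugate-table : ∀ {σ p} → (∀ i → σ ⟨$⟩ʳ i ≡ lookup p i) → ∀ i → (ρ₀ ∙ σ ∙ flip ρ₀) ⟨$⟩ʳ i ≡ lookup (conjugate p) i
  conjugate-table {σ} {p} eq i = sym (trans (lookup-map i (lookup (table ρ₀)) (p ⊙ table ρ₀))
    (trans (lookup∘tabulate (ρ₀ ⟨$⟩ʳ_) (lookup (p ⊙ table ρ₀) i)) (cong (ρ₀ ⟨$⟩ʳ_) (trans (lookup-map i (lookup p) (table ρ₀))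
      (trans (cong (lookup p) (trans (lookup∘tabulate (ρ₀ ⟨$⟩ʳ_) i) (sym (flip-ρ₀ i)))) (sym (eq _)))))))

  module EdgeGroup (S : Pair 3 → Pair 3 → Set) (S-part : IsEdgePartition 3 S)
      (S-Ĥ : ∀ {σ} → InĤ σ → Invariant {3} (σ , false) S) where
    open PartStabiliser S S-part (λ {σ} → S-Ĥ {σ}) e₀ e₀-edge public

    Z₁ : Z ν₁
    Z₁ = even-pair 0F 1F 2F 3F (λ ()) (λ ()) , S.unord u₀ v₀ e₀-edge

    Z₂ : Z ν₂
    Z₂ = even-pair 0F 1F 4F 5F (λ ()) (λ ()) , S.refl e₀ e₀-edge

    Z₃ : Z ν₃
    Z₃ = even-pair 2F 3F 4F 5F (λ ()) (λ ()) , S.unord u₀ v₀ e₀-edge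

    expressible∈ : ∀ {ws p q t} → Tabulated Z p → Tabulated Z q → Expressible ws p q t → Tabulated Z t
    expressible∈ = tabulated-expressible Z-grp Z₁ Z₂ Z₃

  module RGroup = EdgeGroup R (IsDecomposition.partition decomp) (λ {σ} → R-Ĝ {σ} {false})

  -- Moving `e` to `e₀` turns the relation `r` into an element of the stabiliser of a part, and
  -- `¬same` excludes the first alternative of `Generates`.
  generator : ∀ e f → R e f → ¬ SamePair 3 e f → Tabulated RGroup.Z (table δ₂) ⊎ Tabulated RGroup.Z δ₃
  generator e f r ¬same = from (arc-move e e₀ (proj₁ (R.onEdges e f r)) e₀-edge)
    where
    from : (∃ λ h → InĤ h × permP {3} h e ≡ e₀) → _
    from (h , Hh , eq) = go (reach (permP {3} h f) (proj₂ (R.onEdges _ _ r′)))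
      where
      r′ : R e₀ (permP {3} h f)
      r′ = subst (λ g → R g (permP {3} h f)) eq (R-Ĝ {h} {false} Hh e f r)
      go : (∃₂ λ σ p → Product σ p × permP {3} σ e₀ ≡ permP {3} h f) → Tabulated RGroup.Z (table δ₂) ⊎ Tabulated RGroup.Z δ₃
      go (σ , p , pr@(Hσ , values , _) , eq′) = cases (every-product {Generates} {σ} {p} pr products-generate)
        where
        Zσ : RGroup.Z σ
        Zσ = Hσ , subst (R e₀) (sym eq′) r′
        zp : Tabulated RGroup.Z p
        zp = σ , Zσ , values
        zc : Tabulated RGroup.Z (conjugate p)
        zc = ρ₀ ∙ σ ∙ flip ρ₀ , RGroup.Z-normalised ρ₀ ρ₀∈ (R-Ĝ {ρ₀} {true} ρ₀∈) ρ₀-e₀ {σ} Zσ , conjugate-table {σ} {p} values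
        cases : Generates p → Tabulated RGroup.Z (table δ₂) ⊎ Tabulated RGroup.Z δ₃
        cases (inj₂ (inj₁ ex)) = inj₁ (RGroup.expressible∈ {words} zp zc ex)
        cases (inj₂ (inj₂ ex)) = inj₂ (RGroup.expressible∈ {words} zp zc ex)
        cases (inj₁ fixed) = ⊥-elim (¬same (proj₁ (R.onEdges e f r) , proj₂ (R.onEdges e f r) , same))
          where
          σ-pair : permute σ pair₀ ≡ pair₀
          σ-pair = permute-unique σ pair₀ pair₀ λ i →
            trans (cong (lookup pair₀) (values i)) (trans (sym (lookup-map i (lookup pair₀) p)) (cong (λ D → lookup D i) fixed))
          hp : permute h (pairOf {3} e) ≡ permute h (pairOf {3} f)
          hp = trans (sym (pairOf-permP {3} h e)) (trans (cong (pairOf {3}) eq) (trans (sym σ-pair)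
            (trans (sym (pairOf-permP {3} σ e₀)) (trans (cong (pairOf {3}) eq′) (pairOf-permP {3} h f)))))
          same : pairOf {3} e ≡ pairOf {3} f
          same = trans (sym (permute-flip h (pairOf {3} e))) (trans (cong (permute (flip h)) hp) (permute-flip h (pairOf {3} f)))

  module _ (S : Pair 3 → Pair 3 → Set) (S-part : IsEdgePartition 3 S) (R⊆S : ∀ e e′ → R e e′ → S e e′)
           (S-inv : Preserves 3 (InSym 3 G) S) where
    open Coarser S S-part R⊆S S-inv using (S-Ĥ; from-invariance)
    open TwistedCoarser S S-part R⊆S S-inv using (same-pair-case)
    module SGroup = EdgeGroup S S-part (λ {σ} → S-Ĥ {σ})
    private module S = IsEdgePartition S-part

    -- An element `π` paired with `τ` factors as `h`, taking `e` to `e₀`, then `ρ₀` with `τ`, which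
    -- fixes `e₀`, then an even `κ`. Only the middle factor is in question, and writing the second
    -- edge as `σ e₀` turns its effect into conjugation of `σ`.
    normalises : (∀ {σ p} → Product σ p → Tabulated SGroup.Z p → Tabulated SGroup.Z (conjugate p)) → Dichotomy 3 R S
    normalises conj = from-invariance λ π Gπ e e′ s → go π Gπ e e′ s (arc-move e e₀ (proj₁ (S.onEdges e e′ s)) e₀-edge)
      where
      go : ∀ π → G (π , true) → ∀ e e′ → S e e′ → (∃ λ h → InĤ h × permP {3} h e ≡ e₀) → S (actP 3 (π , true) e) (actP 3 (π , true) e′)
      go π Gπ e e′ s (h , Hh , eq) = step (reach (permP {3} h e′) (proj₂ (S.onEdges _ _ s′)))
        where
        s′ : S e₀ (permP {3} h e′)
        s′ = subst (λ g → S g (permP {3} h e′)) eq (S-Ĥ {h} Hh e e′ s)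
        κ : Permutation′ 6
        κ = π ∙ flip h ∙ flip ρ₀
        Hκ : InĤ κ
        Hκ = Ĝ-∙ G sub {π} {true} {flip h ∙ flip ρ₀} {true} (π , Gπ , λ _ → refl)
          (Ĝ-∙ G sub {flip h} {false} {flip ρ₀} {true} (inv∈ {h} Hh) (Ĝ-inv G sub {ρ₀} {true} ρ₀∈))
        κ-act : ∀ g → permP {3} κ (actP 3 (ρ₀ , true) (permP {3} h g)) ≡ actP 3 (π , true) g
        κ-act g = trans (permP-compP {3} κ (permP {3} ρ₀ (permP {3} h g))) (cong (compP {3})
          (trans (cong (permP {3} κ) (sym (permP-∙ {3} ρ₀ h g))) (trans (sym (permP-∙ {3} κ (ρ₀ ∙ h) g))
            (permP-cong {3} {κ ∙ ρ₀ ∙ h} {π} (λ i → cong (π ⟨$⟩ʳ_) (trans (cong (h ⟨$⟩ˡ_) (inverseˡ ρ₀)) (inverseˡ h))) g))))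
        step : (∃₂ λ σ p → Product σ p × permP {3} σ e₀ ≡ permP {3} h e′) → S (actP 3 (π , true) e) (actP 3 (π , true) e′)
        step (σ , p , pr@(Hσ , values , _) , eq′) = finish (conj {σ} {p} pr (σ , (Hσ , subst (S e₀) (sym eq′) s′) , values))
          where
          finish : Tabulated SGroup.Z (conjugate p) → S (actP 3 (π , true) e) (actP 3 (π , true) e′)
          finish (ς , (_ , t) , eς) = subst₂ S (trans (cong (λ g → permP {3} κ (actP 3 (ρ₀ , true) g)) (sym eq)) (κ-act e)) (κ-act e′)
              (S-Ĥ {κ} Hκ e₀ (actP 3 (ρ₀ , true) (permP {3} h e′)) (subst (S e₀) moved t))
            where
            moved : permP {3} ς e₀ ≡ actP 3 (ρ₀ , true) (permP {3} h e′)
            moved = trans (permP-cong {3} {ς} {ρ₀ ∙ σ ∙ flip ρ₀} (λ i → trans (eς i) (sym (conjugate-table {σ} {p} values i))) e₀)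
              (trans (permP-∙ {3} ρ₀ (σ ∙ flip ρ₀) e₀) (trans (cong (permP {3} ρ₀) (trans (permP-∙ {3} σ (flip ρ₀) e₀)
                (trans (permP-compP {3} σ e₀) (cong (compP {3}) eq′)))) (permP-compP {3} ρ₀ (permP {3} h e′))))

    dichotomy : Dichotomy 3 R S
    dichotomy = from (lem (∃₂ λ e f → R e f × ¬ SamePair 3 e f))
      where
      -- The stabiliser of a part of `R` lies in that of the part of `S` containing it; this brings
      -- `δ₂` or `δ₃` to `S`.
      lift : ∀ {t} → Tabulated RGroup.Z t → Tabulated SGroup.Z t
      lift (σ , (Hσ , r) , eq) = σ , (Hσ , R⊆S _ _ r) , eq
      from : (∃₂ λ e f → R e f × ¬ SamePair 3 e f) ⊎ ¬ (∃₂ λ e f → R e f × ¬ SamePair 3 e f) → Dichotomy 3 R S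
      from (inj₂ none) = same-pair-case (R⊆SamePair⇒SamePair⊆R λ e f r → decide e f r (lem (SamePair 3 e f)))
        where
        decide : ∀ e f → R e f → SamePair 3 e f ⊎ ¬ SamePair 3 e f → SamePair 3 e f
        decide e f r (inj₁ same) = same
        decide e f r (inj₂ ¬same) = ⊥-elim (none (e , f , r , ¬same))
      from (inj₁ (e , f , r , ¬same)) = with-generator (generator e f r ¬same)
        where
        with-generator : Tabulated RGroup.Z (table δ₂) ⊎ Tabulated RGroup.Z δ₃ → Dichotomy 3 R S
        with-generator (inj₁ z) = normalises λ {σ} {p} pr zp →
          SGroup.expressible∈ {words₂} zp (lift {table δ₂} z) (every-product {λ p → Expressible words₂ p (table δ₂) (conjugate p)} {σ} {p} pr products-normalise₂)
        with-generator (inj₂ z) = normalises λ {σ} {p} pr zp →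
          SGroup.expressible∈ {words₃} zp (lift {δ₃} z) (every-product {λ p → Expressible words₃ p δ₃ (conjugate p)} {σ} {p} pr products-normalise₃)

-- Combination of the cases

theorem3p6 : (k : ℕ) → 2 ≤ k → (G : Aut k → Set) → IsSubgroup k G →
    ArcTransitive k G → ArcTransitive k (InSym k G) →
    (R : Pair k → Pair k → Set) →
    IsPrimitiveDecomposition k G R → IsPrimitiveDecomposition k (InSym k G) R
theorem3p6 k 2≤k G sub _ arc R (decomp , R-inv , _ , prim) =
  decomp , (λ (σ , b) (Gσ , _) → R-inv (σ , b) Gσ) , transitive , dichotomy
  where
  open IsDecomposition decomp
  open Reduction k 2≤k G sub R decomp R-inv prim

  -- An element of `H` taking one arc to the other takes the part of the first to the part of the
  -- second.
  transitive : TransitiveOnParts k (InSym k G) R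
  transitive e@(u , v) e′@(u′ , v′) p p′ =
    let g , Lg , eu , ev = arc u v u′ v′ p p′ in
    g , Lg , subst (λ f → R f e′) (sym (cong₂ _,_ eu ev)) (IsEdgePartition.refl partition e′ p′)

  dichotomy : (S : Pair k → Pair k → Set) → IsEdgePartition k S → (∀ e e′ → R e e′ → S e e′) →
    Preserves k (InSym k G) S → Dichotomy k R S
  dichotomy S S-part R⊆S S-inv = by-odd (lem (∃ λ ρ → G (ρ , true)))
    where
    open Coarser S S-part R⊆S S-inv
    by-odd : (∃ λ ρ → G (ρ , true)) ⊎ ¬ (∃ λ ρ → G (ρ , true)) → Dichotomy k R S
    by-odd (inj₂ none) = from-invariance λ σ Gσ → ⊥-elim (none (σ , Gσ))
    by-odd (inj₁ (ρ , Gρ)) = by-τ (lem (InĜ (idₚ , true)))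
      where
      by-τ : InĜ (idₚ , true) ⊎ ¬ InĜ (idₚ , true) → Dichotomy k R S
      by-τ (inj₁ τ∈) = WithComplement.conclusion τ∈
      by-τ (inj₂ τ∉) = by-rank (ℕₚ.m≤n⇒m<n∨m≡n 3≤k)
        where
        open Twisted k 2≤k G sub R decomp R-inv prim arc ρ Gρ τ∉
        -- All data depending on `k` are abstracted again so that the equation `3 ≡ k` can be
        -- matched.
        rank-three : ∀ {k} → 3 ≡ k → (2≤k : 2 ≤ k) (G : Aut k → Set) (sub : IsSubgroup k G)
          (R : Pair k → Pair k → Set) → IsDecomposition k R → Preserves k G R →
          ((S : Pair k → Pair k → Set) → IsEdgePartition k S → (∀ e e′ → R e e′ → S e e′) → Preserves k G S → Dichotomy k R S) →
          ArcTransitive k (InSym k G) → (ρ : Permutation′ (k + k)) → G (ρ , true) → ¬ (_∈Ĝ G sub (idₚ , true)) →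
          (S : Pair k → Pair k → Set) → IsEdgePartition k S → (∀ e e′ → R e e′ → S e e′) →
          Preserves k (InSym k G) S → Dichotomy k R S
        rank-three refl 2≤k G sub R decomp R-inv prim arc ρ Gρ τ∉ =
          RankThree.dichotomy G sub R decomp R-inv prim arc ρ Gρ τ∉ 2≤k
        by-rank : 3 < k ⊎ 3 ≡ k → Dichotomy k R S
        by-rank (inj₁ 4≤k) = TwistedCoarser.same-pair-case S S-part R⊆S S-inv
          (R⊆SamePair⇒SamePair⊆R (LargeRank.R⊆SamePair k 2≤k G sub R decomp R-inv prim arc ρ Gρ τ∉ 4≤k))
        by-rank (inj₂ 3≡k) = rank-three 3≡k 2≤k G sub R decomp R-inv prim arc ρ Gρ τ∉ S S-part R⊆S S-inv
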